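{- The $n+1$ images, under the circular shift group $C_{n+1}$, of the collection of the $n$ hyper-rhombic cells $\xi_i+\Diamond_{i,n+1}$ ($1\le i\le n$) of $V(\mathbf 0)$ sharing the vertex $-\xi_{n+1}$ form the boundary of $V(\mathbf 0)$. Overall, the boundary of $V(\mathbf 0)$ is composed of the $n(n+1)$ congruent hyper-rhombic faces $$\{\xi_i+\Diamond_{ij}:1\le i\ne j\le n+1\}.$$ Moreover, the face $\xi_i+\Diamond_{ij}$ ($1\le i\ne j\le n+1$) has the following properties. (1) It is obtained by transforming $\xi_1+\Diamond_{1,n+1}$ with the matrix $$\Gamma_{n+1,\;j\bmod (n+1)}\begin{bmatrix}\Gamma_{n,\;(i-j-1)\bmod n}&0\\0&1\end{bmatrix}.$$ (2) It is embedded in the bisecting hyperplane of the nearest neighbor point $e_i-e_j\in A_n$, i.e. the hyperplane bisecting the segment between $\mathbf 0$ and $e_i-e_j$. (3) It is composed of the images, under $S_{n+1}$, of the roof of $\sigma_0$ that share the edge connecting $\xi_i$ and $-\xi_j$.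
   Context: Let $n$ be the dimension of the lattice, $\mathbf 1=(1,\dots,1)^T\in\mathbb R^{n+1}$, $H=\{x\in\mathbb R^{n+1}:x\cdot\mathbf 1=0\}$, and let $e_i$ be the standard unit vectors. The lattice $A_n$ is $\mathbb Z^{n+1}\cap H$. Its Voronoi cell at the origin, taken inside $H$, is $V(\mathbf 0)=\{x\in H:\|x\|\le\|x-q\|\text{ for all }q\in A_n\}$, and its boundary is taken relative to $H$. A cell of $V(\mathbf 0)$ is an $(n-1)$-dimensional face of it. Let $\xi_i=e_i-\frac1{n+1}\mathbf 1$ for $1\le i\le n+1$. For $i\ne j$ put $\Diamond_{ij}=\Diamond_{i,j}=\{\sum_{k\ne i,j}t_k\xi_k:0\le t_k\le1\}$, the $(n-1)$-dimensional parallelepiped spanned by all $\xi_k$ with $k\in\{1,\dots,n+1\}\setminus\{i,j\}$. Let $v_j=\sum_{i=1}^j\xi_i$ for $0\le j\le n$, let $\sigma_0$ be the convex hull of $\{v_0,\dots,v_n\}$, and let the roof of $\sigma_0$ be its face equal to the convex hull of $\{v_1,\dots,v_n\}$. $S_m$ denotes the group of $m\times m$ permutation matrices. For $0\le j\le m-1$, $\Gamma_{m,j}$ is the $m\times m$ circular shift matrix obtained by circularly shifting the rows of the identity matrix downward by $j$, i.e. $\Gamma_{m,j}e_i=e_{i+j}$ with indices taken modulo $m$ in $\{1,\dots,m\}$; $C_m=\{\Gamma_{m,j}:0\le j\le m-1\}$. Here $a\bmod m$ denotes the residue of $a$ in $\{0,\dots,m-1\}$. An $m$-dimensional hyper-rhombus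 is a parallelepiped all of whose faces are congruent $(m-1)$-dimensional hyper-rhombi; this definition is recursive, with 2-dimensional rhombi as its base case. Congruent means related by an isometry. "Composed of" means being the union of the listed pieces, which do not overlap (they may meet along their boundaries).
   Formalization: In (1) the inner shift exponent is (i−j−1) mod (n+1) instead of mod n; the printed exponent fails whenever i<j and n≥2 (n=2, i=1, j=2 gives ξ_3+◇_{3,2}), and the two agree for j<i. Points and segments count as hyper-rhombi for n=1,2. -}

module Defs where

open import Algebra.Bundles using (CommutativeRing)
open import Algebra.Core using (Op₁; Op₂)
import Algebra.Definitions.RawMonoid as RawMonoidDefs
open import Algebra.Structures using (IsCommutativeRing)
open import Data.Bool.Base using (if_then_else_; _∨_)
open import Data.Fin.Base using (Fin; zero; suc; toℕ; fromℕ; inject; Fin′)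
open import Data.Fin.Permutation using (Permutation′; _⟨$⟩ʳ_)
open import Data.Fin.Properties using (_≟_)
open import Data.Fin.Relation.Unary.Top using (view; ‵fromℕ; ‵inject₁)
open import Data.Integer.Base using (ℤ; +_; -[1+_])
import Data.Integer.Base as ℤ
import Data.Integer.DivMod as ℤ
open import Data.Nat.Base using (ℕ; zero; suc; pred; NonZero)
import Data.Nat.Base as ℕ
open import Data.Nat.DivMod using (_%_; _mod_)
open import Data.Product.Base using (∃-syntax; Σ-syntax; _×_; _,_)
open import Data.Vec.Functional using (Vector; []; _∷_)
open import Level using (Level; _⊔_) renaming (suc to lsuc)
open import Relation.Binary.Core using (Rel)
open import Relation.Binary.PropositionalEquality.Core using (_≢_)
open import Relation.Binary.Structures using (IsDecTotalOrder)
open import Relation.Nullary using (¬_; does)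
open import Relation.Unary using (Pred; _∈_; _∉_; _⊆_; _≐_; ⋃)

-- The standard library has no real numbers. The geometry below is developed
-- over an arbitrary ordered field, of which (classically) ℝ is an instance.
-- `_⁻¹` is a total function, with no condition on the value at zero.

record OrderedField (c ℓ₁ ℓ₂ : Level) : Set (lsuc (c ⊔ ℓ₁ ⊔ ℓ₂)) where
  infix  8 -_ _⁻¹
  infixl 7 _*_
  infixl 6 _+_ _-_
  infix  4 _≈_ _≤_ _<_
  field
    Carrier           : Set c
    _≈_               : Rel Carrier ℓ₁
    _≤_               : Rel Carrier ℓ₂
    _+_ _*_           : Op₂ Carrier
    -_                : Op₁ Carrier
    _⁻¹               : Op₁ Carrier
    0# 1#             : Carrier
    isCommutativeRing : IsCommutativeRing _≈_ _+_ _*_ -_ 0# 1#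
    0≉1               : ¬ (0# ≈ 1#)
    ⁻¹-inverse        : ∀ x → ¬ (x ≈ 0#) → x * x ⁻¹ ≈ 1#
    isDecTotalOrder   : IsDecTotalOrder _≈_ _≤_
    +-monoˡ-≤         : ∀ z {x y} → x ≤ y → x + z ≤ y + z
    *-nonNeg          : ∀ {x y} → 0# ≤ x → 0# ≤ y → 0# ≤ x * y

  commutativeRing : CommutativeRing c ℓ₁
  commutativeRing = record { isCommutativeRing = isCommutativeRing }

  _-_ : Op₂ Carrier
  x - y = x + - y

  _<_ : Rel Carrier ℓ₂
  x < y = ¬ (y ≤ x)

  open RawMonoidDefs (CommutativeRing.+-rawMonoid commutativeRing) public
    using (sum) renaming (_×_ to _·ℕ_)

  fromNat : ℕ → Carrier
  fromNat k = k ·ℕ 1#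

  fromInt : ℤ → Carrier
  fromInt (+ k)    = fromNat k
  fromInt -[1+ k ] = - fromNat (suc k)

module Euclidean {c ℓ₁ ℓ₂} (F : OrderedField c ℓ₁ ℓ₂) where
  open OrderedField F

  private
    a : Level
    a = c ⊔ ℓ₁ ⊔ ℓ₂

  Point : ℕ → Set c
  Point N = Vector Carrier N

  Region : ℕ → Set (lsuc a)
  Region N = Pred (Point N) a

  infix 4 _≋_
  _≋_ : ∀ {N} → Rel (Point N) ℓ₁
  x ≋ y = ∀ k → x k ≈ y k

  infixl 6 _⊕_ _⊝_
  infixr 7 _⊛_
  infix  8 ⊖_
  _⊕_ _⊝_ : ∀ {N} → Op₂ (Point N)
  (x ⊕ y) k = x k + y k
  (x ⊝ y) k = x k - y k

  ⊖_ : ∀ {N} → Op₁ (Point N)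
  (⊖ x) k = - x k

  _⊛_ : ∀ {N} → Carrier → Point N → Point N
  (t ⊛ x) k = t * x k

  𝟎 𝟏 : ∀ {N} → Point N
  𝟎 _ = 0#
  𝟏 _ = 1#

  e : ∀ {N} → Fin N → Point N
  e i k = if does (k ≟ i) then 1# else 0#

  Σᵖ : ∀ {m N} → (Fin m → Point N) → Point N
  Σᵖ p k = sum (λ l → p l k)

  infix 7 _∙_
  _∙_ : ∀ {N} → Point N → Point N → Carrier
  x ∙ y = sum (λ k → x k * y k)

  -- An ordered field need not contain square roots, so lengths are compared
  -- through their squares.

  ‖_‖² : ∀ {N} → Point N → Carrier
  ‖ x ‖² = x ∙ x

  Near : ∀ {N} → Carrier → Point N → Point N → Set ℓ₂
  Near ε x y = ‖ x ⊝ y ‖² < ε * ε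

  Matrix : ℕ → ℕ → Set c
  Matrix m k = Fin m → Fin k → Carrier

  infixl 7 _⊗_
  _⊗_ : ∀ {m k l} → Matrix m k → Matrix k l → Matrix m l
  (A ⊗ B) r s = sum (λ t → A r t * B t s)

  apply : ∀ {m k} → Matrix m k → Point k → Point m
  apply A x r = A r ∙ x

  map : ∀ {N} → (Point N → Point N) → Region N → Region N
  map f P y = ∃[ x ] x ∈ P × y ≋ f x

  image : ∀ {N} → Matrix N N → Region N → Region N
  image A = map (apply A)

  translate : ∀ {N} → Point N → Region N → Region N
  translate p = map (p ⊕_)

  affineCombinations : ∀ {m N} → (Fin m → Point N) → Pred (Point N) (c ⊔ ℓ₁)
  affineCombinations {m} p x = Σ[ t ∈ Vector Carrier m ] sum t ≈ 1# × x ≋ Σᵖ (λ k → t k ⊛ p k)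

  aff : ∀ {N} → Region N → Region N
  aff P x = ∃[ m ] Σ[ p ∈ (Fin m → Point _) ] (∀ k → p k ∈ P) × x ∈ affineCombinations p

  hull : ∀ {m N} → (Fin m → Point N) → Region N
  hull {m} p x = Σ[ t ∈ Vector Carrier m ] (∀ k → 0# ≤ t k) × sum t ≈ 1# × x ≋ Σᵖ (λ k → t k ⊛ p k)

  segment : ∀ {N} → Point N → Point N → Region N
  segment x y = hull (x ∷ y ∷ [])

  LinearlyIndependent : ∀ {m N} → (Fin m → Point N) → Set (c ⊔ ℓ₁)
  LinearlyIndependent {m} p = ∀ (t : Vector Carrier m) → Σᵖ (λ k → t k ⊛ p k) ≋ 𝟎 → ∀ k → t k ≈ 0#

  AffinelyIndependent : ∀ {m N} → (Fin m → Point N) → Set (c ⊔ ℓ₁)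
  AffinelyIndependent {m} p =
    ∀ (t : Vector Carrier m) → sum t ≈ 0# → Σᵖ (λ k → t k ⊛ p k) ≋ 𝟎 → ∀ k → t k ≈ 0#

  -- The affine hull of P has dimension d: P contains d + 1 affinely
  -- independent points whose affine combinations include all of P.

  HasDimension : ∀ {N} → ℕ → Region N → Set a
  HasDimension d P = Σ[ p ∈ (Fin (suc d) → Point _) ]
    (∀ k → p k ∈ P) × AffinelyIndependent p × P ⊆ affineCombinations p

  IsFace : ∀ {N ℓ} → Pred (Point N) ℓ → Region N → Set (a ⊔ ℓ)
  IsFace G P = ∃[ u ] ∃[ β ]
    (∀ x → x ∈ P → u ∙ x ≤ β) × G ≐ (λ x → x ∈ P × u ∙ x ≈ β)

  IsFaceOfDimension : ∀ {N} → ℕ → Region N → Region N → Set a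
  IsFaceOfDimension d G P = IsFace G P × HasDimension d G

  IsVertex : ∀ {N} → Point N → Region N → Set a
  IsVertex v = IsFace (v ≋_)

  relativeInterior : ∀ {N} → Region N → Region N
  relativeInterior P x = x ∈ P ×
    ∃[ ε ] 0# < ε × (∀ y → y ∈ aff P → Near ε x y → y ∈ P)

  NonOverlapping : ∀ {N} → Region N → Region N → Set a
  NonOverlapping P Q = ∀ x → x ∈ P → x ∈ Q →
    x ∉ relativeInterior P × x ∉ relativeInterior Q

  infix 4 _ComposedOf_
  record _ComposedOf_ {i N} {I : Set i} (P : Region N) (Q : I → Region N) : Set (a ⊔ i) where
    field
      union          : P ≐ ⋃ I Q
      nonOverlapping : ∀ r s → ¬ (Q r ≐ Q s) → NonOverlapping (Q r) (Q s)

  -- The topological boundary of P relative to the subspace S.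

  boundaryIn : ∀ {N} → Pred (Point N) ℓ₁ → Region N → Region N
  boundaryIn S P x = x ∈ S × (∀ ε → 0# < ε →
    (∃[ y ] y ∈ S × Near ε x y × y ∈ P) × (∃[ y ] y ∈ S × Near ε x y × y ∉ P))

  Congruent : ∀ {N} → Region N → Region N → Set a
  Congruent P Q = ∃[ f ]
    (∀ x y → ‖ f x ⊝ f y ‖² ≈ ‖ x ⊝ y ‖²) × map f P ≐ Q

  box : ∀ {m N} → (Fin m → Point N) → Region N
  box {m} p x = Σ[ t ∈ Vector Carrier m ] (∀ k → 0# ≤ t k × t k ≤ 1#) × x ≋ Σᵖ (λ k → t k ⊛ p k)

  IsParallelepipedOn : ∀ {m N} → (Fin m → Point N) → Region N → Set a
  IsParallelepipedOn p P = LinearlyIndependent p × ∃[ o ] P ≐ translate o (box p)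

  IsParallelepiped : ∀ {N} → ℕ → Region N → Set a
  IsParallelepiped m P = Σ[ p ∈ (Fin m → Point _) ] IsParallelepipedOn p P

  -- The base case of the recursion is dimension 2; in dimensions 0 and 1
  -- every point and every segment counts.

  data IsHyperRhombus {N} : ℕ → Region N → Set (lsuc a) where
    point   : ∀ {P} → IsParallelepiped 0 P → IsHyperRhombus 0 P
    edge    : ∀ {P} → IsParallelepiped 1 P → IsHyperRhombus 1 P
    rhombus : ∀ {P} (p : Fin 2 → Point N) → IsParallelepipedOn p P →
              ‖ p zero ‖² ≈ ‖ p (suc zero) ‖² → IsHyperRhombus 2 P
    higher  : ∀ {m P} → IsParallelepiped (3 ℕ.+ m) P →
              (∀ G → IsFaceOfDimension (2 ℕ.+ m) G P → IsHyperRhombus (2 ℕ.+ m) G) →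
              (∀ G G′ → IsFaceOfDimension (2 ℕ.+ m) G P →
                        IsFaceOfDimension (2 ℕ.+ m) G′ P → Congruent G G′) →
              IsHyperRhombus (3 ℕ.+ m) P

  permutationMatrix : ∀ {m} → (Fin m → Fin m) → Matrix m m
  permutationMatrix σ r s = e (σ s) r

  -- Γ m j sends e i to e (i + j), with indices 0, …, m - 1 taken modulo m.

  Γ : (m : ℕ) .{{_ : NonZero m}} → ℕ → Matrix m m
  Γ m j = permutationMatrix (λ i → (toℕ i ℕ.+ j) mod m)

  -- The block matrix with diagonal blocks A and 1.

  bordered : ∀ {m} → Matrix m m → Matrix (suc m) (suc m)
  bordered A r s with view r | view s
  ... | ‵inject₁ r′ | ‵inject₁ s′ = A r′ s′
  ... | ‵fromℕ      | ‵fromℕ      = 1#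
  ... | _           | _           = 0#

-- Coordinates 1, …, n + 1 are represented by Fin (suc n); the coordinate
-- n + 1 is `fromℕ n`.

module RootLattice {c ℓ₁ ℓ₂} (F : OrderedField c ℓ₁ ℓ₂) (n : ℕ) where
  open OrderedField F
  open Euclidean F

  private
    Index : Set
    Index = Fin (suc n)

  H : Pred (Point (suc n)) ℓ₁
  H x = x ∙ 𝟏 ≈ 0#

  A : Pred (Point (suc n)) ℓ₁
  A x = x ∈ H × Σ[ z ∈ (Index → ℤ) ] (∀ k → x k ≈ fromInt (z k))

  VoronoiCell : Region (suc n)
  VoronoiCell x = x ∈ H × (∀ q → q ∈ A → ‖ x ‖² ≤ ‖ x ⊝ q ‖²)

  ∂VoronoiCell : Region (suc n)
  ∂VoronoiCell = boundaryIn H VoronoiCell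

  IsCell : Region (suc n) → Set (c ⊔ ℓ₁ ⊔ ℓ₂)
  IsCell G = IsFaceOfDimension (pred n) G VoronoiCell

  ξ : Index → Point (suc n)
  ξ i = e i ⊝ fromNat (suc n) ⁻¹ ⊛ 𝟏

  ◇ : Index → Index → Region (suc n)
  ◇ i j x = Σ[ t ∈ Vector Carrier (suc n) ] (∀ k → 0# ≤ t k × t k ≤ 1#) ×
    x ≋ Σᵖ (λ k → if does (k ≟ i) ∨ does (k ≟ j) then 𝟎 else t k ⊛ ξ k)

  ξ+◇ : Index → Index → Region (suc n)
  ξ+◇ i j = translate (ξ i) (◇ i j)

  v : Index → Point (suc n)
  v j = Σᵖ (λ (i : Fin′ j) → ξ (inject i))

  roof : Region (suc n)
  roof = hull (λ (k : Fin n) → v (suc k))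

  IsNearestNeighbour : Point (suc n) → Set (c ⊔ ℓ₁ ⊔ ℓ₂)
  IsNearestNeighbour q = q ∈ A × ¬ (q ≋ 𝟎) ×
    (∀ p → p ∈ A → ¬ (p ≋ 𝟎) → ‖ q ‖² ≤ ‖ p ‖²)

  bisector : Point (suc n) → Pred (Point (suc n)) ℓ₁
  bisector q x = q ∙ (x ⊝ fromNat 2 ⁻¹ ⊛ q) ≈ 0#

  -- The number in {1, …, n + 1} of a coordinate.

  № : Index → ℕ
  № i = suc (toℕ i)

  -- The exponent i - j - 1 of the inner shift has to be reduced modulo n + 1.
  -- It lies in {0, …, n - 1} since i ≢ j. When j < i this is also the residue
  -- modulo n, but for i < j the residue modulo n yields the wrong face: for
  -- n = 2, i = 1, j = 2 it would give ξ₃ + ◇₃₂.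

  shiftMatrix : .{{_ : NonZero n}} → Index → Index → Matrix (suc n) (suc n)
  shiftMatrix i j =
    Γ (suc n) (№ j % suc n) ⊗ bordered (Γ n ((+ № i ℤ.- + № j ℤ.- + 1) ℤ.%ℕ suc n))

  OrderedPair : Set
  OrderedPair = Σ[ (i , j) ∈ Index × Index ] i ≢ j

  faceAt : OrderedPair → Region (suc n)
  faceAt ((i , j) , _) = ξ+◇ i j

  -- The elements of S_{n+1} whose image of the roof has the given segment as
  -- an edge. For n = 1 that segment is a single point.

  RoofImageWithEdge : Point (suc n) → Point (suc n) → Set (c ⊔ ℓ₁ ⊔ ℓ₂)
  RoofImageWithEdge x y = Σ[ π ∈ Permutation′ (suc n) ]
    IsFace (segment x y) (image (permutationMatrix (π ⟨$⟩ʳ_)) roof)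

  roofImage : ∀ {x y} → RoofImageWithEdge x y → Region (suc n)
  roofImage (π , _) = image (permutationMatrix (π ⟨$⟩ʳ_)) roof

module Submission where

open import Algebra.Bundles using (CommutativeRing)
import Algebra.Properties.Ring as RingProperties
import Algebra.Properties.Semiring.Mult.TCOptimised as Multiples
import Algebra.Properties.Semiring.Sum as Summation
import Algebra.Solver.Ring as RingSolver
open import Algebra.Solver.Ring.AlmostCommutativeRing using (_-Raw-AlmostCommutative⟶_; fromCommutativeRing)
open import Data.Bool.Base using (T; true; false; if_then_else_; _∨_)
open import Data.Fin.Base using (Fin; Fin′; zero; suc; fromℕ; inject; inject₁; punchIn; punchOut; toℕ)
open import Data.Fin.Permutation using (Permutation′; _⟨$⟩ʳ_; _⟨$⟩ˡ_; _∘ₚ_; flip; insert; insert-punchIn; inverseˡ; inverseʳ; permutation; punchIn-permute; remove; transpose)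
import Data.Fin.Permutation as Permutation
import Data.Fin.Permutation.Components as Components
open import Data.Fin.Properties using (any?; fromℕ≢inject₁; inject₁-injective; punchIn-injective; punchIn-punchOut; punchInᵢ≢i; toℕ-fromℕ; toℕ-fromℕ<; toℕ-injective; toℕ-inject₁; toℕ<n; ≤fromℕ) renaming (_≟_ to _≟ᶠ_; _≤?_ to _≤ᶠ?_; ≤-antisym to ≤ᶠ-antisym; ≤-refl to ≤ᶠ-refl)
open import Data.Fin.Base using () renaming (_≤_ to _≤ᶠ_; _<_ to _<ᶠ_)
open import Data.Fin.Relation.Unary.Top using (view; ‵fromℕ; ‵inject₁)
open import Data.Integer.Base using (ℤ; +_; -[1+_])
import Data.Integer.Base as ℤ
import Data.Integer.DivMod as ℤ
import Data.Integer.Properties as ℤ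
import Data.Integer.Solver as ℤ
open import Data.Maybe using (to-witness-T)
open import Data.Maybe.Base using (Maybe; is-just)
import Data.Maybe.Base as Maybe
open import Data.Nat.Base using (ℕ; zero; suc; pred; NonZero; z≤n; s≤s)
import Data.Nat.Base as ℕ
open import Data.Nat.DivMod using (_%_; _mod_; %-distribˡ-+; m%n%n≡m%n; [m+n]%n≡m%n; [m+kn]%n≡m%n; m<n⇒m%n≡m; m%n<n)
import Data.Nat.Properties as ℕ
open import Data.Product.Base using (_×_; _,_; ∃-syntax; Σ-syntax; proj₁; proj₂)
open import Data.Sum.Base using (_⊎_; inj₁; inj₂; [_,_]′)
import Data.Vec.Base as Vec
open import Data.Vec.Functional using (Vector; []; _∷_; insertAt)
open import Data.Vec.Functional.Properties using (insertAt-lookup; insertAt-punchIn)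
open import Data.Vec.N-ary using (N-ary; Eq; _$ⁿ_; curryⁿ; curryⁿ-cong)
open import Function.Base using (_∘_; const; id)
open import Level using (_⊔_)
open import Relation.Binary.Consequences using (dec⇒weaklyDec)
open import Relation.Binary.PropositionalEquality.Core as ≡ using (_≡_; _≢_)
open import Relation.Binary.PropositionalEquality.Properties using (module ≡-Reasoning)
import Relation.Binary.Reasoning.Setoid as SetoidReasoning
open import Relation.Binary.Structures using (IsDecTotalOrder)
open import Relation.Nullary using (¬_; Dec; yes; no; does; contradiction)
open import Relation.Nullary.Decidable using (dec-true; dec-false; ¬?; decidable-stable)
open import Relation.Unary using (Pred; _∈_; _∉_; _⊆_; _≐_; ⋃)
open import Defs

-- Comparing x with the lattice points e i - e j shows that V(0) consists of the x ∈ H all of whose coordinate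
-- differences are at most 1; conversely these inequalities suffice because q² ± q ≥ 0 for an integer q. The
-- face ξ i + ◇ i j is the part of V(0) with x i - x j = 1, that is, with x i the largest coordinate, x j the smallest
-- one, and the others in between. Everything else is read off this description. Permuting coordinates permutes
-- these faces, and each is cut by the orderings of its coordinates into the images of the roof. A face of a cone
-- spanned by linearly independent vectors has codimension one only if it is given by the vanishing of a single
-- coefficient; this determines both the cells at the vertex -ξ (n + 1) and, taking a suitable corner of the box,
-- the facets of a parallelepiped.

-- A point of `H` is determined by its coordinate differences, and in differences `ξ i` may be
-- replaced by `e i`. This is how the constant 1 / (n + 1) disappears from nearly every computation.
-- Non-overlap in both decompositions rests on one fact: a functional that attains its maximum over
-- a region at a relative interior point is constant on that region. Hence an interior point of one
-- face never has the unit gap that defines another face, and an interior point of a roof image has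
-- no two equal coordinates. A face is recognised from such a gap because its points `ξ i` and
-- `⊖ ξ j` already reveal `i` and `j`. The obstacle for hyper-rhombi is that their definition
-- quantifies over all facets, known only through supporting functionals. Each facet must first be
-- identified as a box on fewer of the `ξ`, so the recursion runs over boxes spanned by arbitrary
-- injective families of the `ξ`, not over the faces of V(0) alone.

-- Polynomial identities with integer coefficients in a commutative ring.

module IntegerSolver {c ℓ} (R : CommutativeRing c ℓ) where
  private
    open module R = CommutativeRing R using (Carrier; _≈_; 0#; 1#)
    open RingProperties R.ring
    open Multiples R.semiring using (×-homo-+; ×1-homo-*; 1+×) renaming (_×_ to _·_)
    open SetoidReasoning R.setoid

    ⟦_⟧ : ℤ → Carrier
    ⟦ + k ⟧      = k · 1#
    ⟦ -[1+ k ] ⟧ = R.- (suc k · 1#)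

    neg-homo : ∀ i → ⟦ ℤ.- i ⟧ R.≈ R.- ⟦ i ⟧
    neg-homo (+ zero)  = R.sym -0#≈0#
    neg-homo (+ suc k) = R.refl
    neg-homo -[1+ k ]  = R.sym (-‿involutive _)

    cancel-1 : ∀ x y → x R.- y R.≈ (1# R.+ x) R.- (1# R.+ y)
    cancel-1 x y = begin
      x R.- y                             ≈⟨ R.+-congʳ (R.+-identityʳ x) ⟨
      x R.+ 0# R.- y                      ≈⟨ R.+-congʳ (R.+-congˡ (R.-‿inverseʳ 1#)) ⟨
      x R.+ (1# R.- 1#) R.- y             ≈⟨ R.+-congʳ (R.+-assoc _ _ _) ⟨
      x R.+ 1# R.- 1# R.- y               ≈⟨ R.+-assoc _ _ _ ⟩
      x R.+ 1# R.+ (R.- 1# R.- y)         ≈⟨ R.+-cong (R.+-comm x 1#) (-‿+-comm 1# y) ⟩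
      (1# R.+ x) R.- (1# R.+ y)           ∎

    ⊖-homo : ∀ m n → ⟦ m ℤ.⊖ n ⟧ R.≈ ⟦ + m ⟧ R.- ⟦ + n ⟧
    ⊖-homo m       zero    = R.sym (R.trans (R.+-congˡ -0#≈0#) (R.+-identityʳ _))
    ⊖-homo zero    (suc n) = R.sym (R.+-identityˡ _)
    ⊖-homo (suc m) (suc n) = begin
      ⟦ suc m ℤ.⊖ suc n ⟧                           ≡⟨ ≡.cong ⟦_⟧ (ℤ.[1+m]⊖[1+n]≡m⊖n m n) ⟩
      ⟦ m ℤ.⊖ n ⟧                                   ≈⟨ ⊖-homo m n ⟩
      ⟦ + m ⟧ R.- ⟦ + n ⟧                           ≈⟨ cancel-1 _ _ ⟩
      (1# R.+ ⟦ + m ⟧) R.- (1# R.+ ⟦ + n ⟧)         ≈⟨ R.+-cong (1+× m 1#) (R.-‿cong (1+× n 1#)) ⟨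
      ⟦ + suc m ⟧ R.- ⟦ + suc n ⟧                   ∎

    +-homo : ∀ i j → ⟦ i ℤ.+ j ⟧ R.≈ ⟦ i ⟧ R.+ ⟦ j ⟧
    +-homo (+ m)    (+ n)    = ×-homo-+ 1# m n
    +-homo (+ m)    -[1+ n ] = ⊖-homo m (suc n)
    +-homo -[1+ m ] (+ n)    = R.trans (⊖-homo n (suc m)) (R.+-comm _ _)
    +-homo -[1+ m ] -[1+ n ] = begin
      ⟦ -[1+ m ] ℤ.+ -[1+ n ] ⟧        ≡⟨ ≡.cong ⟦_⟧ (ℤ.neg-distrib-+ (+ suc m) (+ suc n)) ⟨
      ⟦ ℤ.- (+ suc m ℤ.+ + suc n) ⟧    ≈⟨ R.-‿cong (×-homo-+ 1# (suc m) (suc n)) ⟩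
      R.- (⟦ + suc m ⟧ R.+ ⟦ + suc n ⟧) ≈⟨ -‿+-comm _ _ ⟨
      ⟦ -[1+ m ] ⟧ R.+ ⟦ -[1+ n ] ⟧     ∎

    pos-homo : ∀ m n → ⟦ + m ℤ.* + n ⟧ R.≈ ⟦ + m ⟧ R.* ⟦ + n ⟧
    pos-homo m n = R.trans (R.reflexive (≡.cong ⟦_⟧ (≡.sym (ℤ.pos-* m n)))) (×1-homo-* m n)

    *-homo⁺ : ∀ m j → ⟦ + m ℤ.* j ⟧ R.≈ ⟦ + m ⟧ R.* ⟦ j ⟧
    *-homo⁺ m (+ n)    = pos-homo m n
    *-homo⁺ m -[1+ n ] = begin
      ⟦ + m ℤ.* -[1+ n ] ⟧          ≡⟨ ≡.cong ⟦_⟧ (ℤ.neg-distribʳ-* (+ m) (+ suc n)) ⟨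
      ⟦ ℤ.- (+ m ℤ.* + suc n) ⟧     ≈⟨ neg-homo (+ m ℤ.* + suc n) ⟩
      R.- ⟦ + m ℤ.* + suc n ⟧       ≈⟨ R.-‿cong (pos-homo m (suc n)) ⟩
      R.- (⟦ + m ⟧ R.* ⟦ + suc n ⟧) ≈⟨ -‿distribʳ-* _ _ ⟩
      ⟦ + m ⟧ R.* ⟦ -[1+ n ] ⟧      ∎

    *-homo : ∀ i j → ⟦ i ℤ.* j ⟧ R.≈ ⟦ i ⟧ R.* ⟦ j ⟧
    *-homo (+ m)    j = *-homo⁺ m j
    *-homo -[1+ m ] j = begin
      ⟦ -[1+ m ] ℤ.* j ⟧          ≡⟨ ≡.cong ⟦_⟧ (ℤ.neg-distribˡ-* (+ suc m) j) ⟨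
      ⟦ ℤ.- (+ suc m ℤ.* j) ⟧     ≈⟨ neg-homo (+ suc m ℤ.* j) ⟩
      R.- ⟦ + suc m ℤ.* j ⟧       ≈⟨ R.-‿cong (*-homo⁺ (suc m) j) ⟩
      R.- (⟦ + suc m ⟧ R.* ⟦ j ⟧) ≈⟨ -‿distribˡ-* _ _ ⟩
      ⟦ -[1+ m ] ⟧ R.* ⟦ j ⟧      ∎

    -- Integers map to every commutative ring and have decidable equality, so numerals such as 1 -
    -- (1 + 1) can be collected and cancelled in any `R`, whether or not its own equality is
    -- decidable.
    morphism : ℤ.+-*-rawRing -Raw-AlmostCommutative⟶ fromCommutativeRing R
    morphism = record
      { ⟦_⟧ = ⟦_⟧ ; +-homo = +-homo ; *-homo = *-homo ; -‿homo = neg-homo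
      ; 0-homo = R.refl ; 1-homo = R.refl }

    _≟ᶜ_ : ∀ i j → Maybe (⟦ i ⟧ ≈ ⟦ j ⟧)
    i ≟ᶜ j = Maybe.map (λ i≡j → R.reflexive (≡.cong ⟦_⟧ i≡j)) (dec⇒weaklyDec ℤ._≟_ i j)

    open module Solver = RingSolver ℤ.+-*-rawRing (fromCommutativeRing R) morphism _≟ᶜ_
      using (Polynomial; var; normalise; prove; _≟N_; ⟦_⟧N-cong) renaming (⟦_⟧ to ⟦_⟧ᵖ)

  open Solver public using (con; _:=_; _:+_; _:*_; _:-_; :-_)

  -- Deciding whether the normal forms agree spares the type checker from unfolding their values in R.
  module _ (n : ℕ) (f : N-ary n (Polynomial n) (Polynomial n × Polynomial n)) where
    private
      lhs rhs : Polynomial n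
      lhs = proj₁ (f $ⁿ Vec.map var (Vec.allFin n))
      rhs = proj₂ (f $ⁿ Vec.map var (Vec.allFin n))

    abstract
      solve : {T (is-just (normalise lhs ≟N normalise rhs))} → Eq n _≈_ (curryⁿ ⟦ lhs ⟧ᵖ) (curryⁿ ⟦ rhs ⟧ᵖ)
      solve {equal} = curryⁿ-cong _≈_ ⟦ lhs ⟧ᵖ ⟦ rhs ⟧ᵖ λ ρ
          → prove ρ lhs rhs (⟦ to-witness-T (normalise lhs ≟N normalise rhs) equal ⟧N-cong ρ)

-- Circular shifts of indices and residues.

⟨$⟩ʳ-injective : ∀ {N} (π : Permutation′ N) {i j} → π ⟨$⟩ʳ i ≡ π ⟨$⟩ʳ j → i ≡ j
⟨$⟩ʳ-injective π h = ≡.trans (≡.sym (inverseˡ π)) (≡.trans (≡.cong (π ⟨$⟩ˡ_) h) (inverseˡ π))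

%-remove-inner : ∀ a b N .{{_ : NonZero N}} → (a % N ℕ.+ b) % N ≡ (a ℕ.+ b) % N
%-remove-inner a b N = begin
  (a % N ℕ.+ b) % N              ≡⟨ %-distribˡ-+ (a % N) b N ⟩
  (a % N % N ℕ.+ b % N) % N      ≡⟨ ≡.cong (λ c → (c ℕ.+ b % N) % N) (m%n%n≡m%n a N) ⟩
  (a % N ℕ.+ b % N) % N          ≡⟨ %-distribˡ-+ a b N ⟨
  (a ℕ.+ b) % N                  ∎
  where open ≡-Reasoning

-- The sign of the quotient decides on which side the multiple of `N` is written, so that both sides
-- become natural numbers.
ℤ-congruent⇒%≡ : ∀ a b q N .{{_ : NonZero N}} → + a ℤ.+ q ℤ.* + N ≡ + b → a % N ≡ b % N
ℤ-congruent⇒%≡ a b (+ q) N h = begin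
  a % N                ≡⟨ [m+kn]%n≡m%n a q N ⟨
  (a ℕ.+ q ℕ.* N) % N  ≡⟨ ≡.cong (_% N) (ℤ.+-injective (≡.trans (≡.cong (λ z → + a ℤ.+ z) (ℤ.pos-* q N)) h)) ⟩
  b % N                ∎
  where open ≡-Reasoning
ℤ-congruent⇒%≡ a b -[1+ q ] N h = begin
  a % N                    ≡⟨ ≡.cong (_% N) (ℤ.+-injective a≡) ⟩
  (b ℕ.+ suc q ℕ.* N) % N  ≡⟨ [m+kn]%n≡m%n b (suc q) N ⟩
  b % N                    ∎
  where
  open ≡-Reasoning
  open ℤ.+-*-Solver
  a≡ : + a ≡ + (b ℕ.+ suc q ℕ.* N)
  a≡ = begin
    + a
        ≡⟨ solve 3 (λ a q N → a := (a :+ (:- q) :* N) :+ q :* N) ≡.refl (+ a) (+ suc q) (+ N) ⟩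
    (+ a ℤ.+ -[1+ q ] ℤ.* + N) ℤ.+ + suc q ℤ.* + N   ≡⟨ ≡.cong₂ ℤ._+_ h (≡.sym (ℤ.pos-* (suc q) N)) ⟩
    + (b ℕ.+ suc q ℕ.* N)                            ∎

toℕ-mod : ∀ a N .{{_ : NonZero N}} → toℕ (a mod N) ≡ a % N
toℕ-mod a N = toℕ-fromℕ< (m%n<n a N)

toℕ-% : ∀ {N} .{{_ : NonZero N}} (i : Fin N) → toℕ i % N ≡ toℕ i
toℕ-% i = m<n⇒m%n≡m (toℕ<n i)

-- The inverse is again a shift, by `p * k`, because `p * k + k` is a multiple of `suc p`; this
-- avoids subtraction.
rotation : ∀ p → ℕ → Permutation′ (suc p)
rotation p k = permutation (shift k) (shift (p ℕ.* k)) inverse₁ inverse₂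
  where
  open ≡-Reasoning
  shift : ℕ → Fin (suc p) → Fin (suc p)
  shift k i = (toℕ i ℕ.+ k) mod suc p
  composed : ∀ a b → b ℕ.+ a ≡ suc p ℕ.* k → ∀ i → shift a (shift b i) ≡ i
  composed a b b+a≡ i = toℕ-injective (begin
    toℕ (shift a (shift b i))                           ≡⟨ toℕ-mod (toℕ (shift b i) ℕ.+ a) (suc p) ⟩
    (toℕ (shift b i) ℕ.+ a) % suc p
        ≡⟨ ≡.cong (λ c → (c ℕ.+ a) % suc p) (toℕ-mod (toℕ i ℕ.+ b) (suc p)) ⟩
    ((toℕ i ℕ.+ b) % suc p ℕ.+ a) % suc p               ≡⟨ %-remove-inner (toℕ i ℕ.+ b) a (suc p) ⟩
    (toℕ i ℕ.+ b ℕ.+ a) % suc p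
        ≡⟨ ≡.cong (_% suc p) (≡.trans (ℕ.+-assoc (toℕ i) b a)
        (≡.cong (toℕ i ℕ.+_) (≡.trans b+a≡ (ℕ.*-comm (suc p) k)))) ⟩
    (toℕ i ℕ.+ k ℕ.* suc p) % suc p                     ≡⟨ [m+kn]%n≡m%n (toℕ i) k (suc p) ⟩
    toℕ i % suc p                                       ≡⟨ toℕ-% i ⟩
    toℕ i                                               ∎)
  inverse₁ : ∀ i → shift k (shift (p ℕ.* k) i) ≡ i
  inverse₁ = composed k (p ℕ.* k) (ℕ.+-comm (p ℕ.* k) k)
  inverse₂ : ∀ i → shift (p ℕ.* k) (shift k i) ≡ i
  inverse₂ = composed (p ℕ.* k) k ≡.refl

-- Adding the one-based number of `j` to the last index `p` gives `toℕ j + suc p`, one full turn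
-- beyond `j`.
rotation-last : ∀ p (j : Fin (suc p)) → rotation p (suc (toℕ j) % suc p) ⟨$⟩ʳ fromℕ p ≡ j
rotation-last p j = toℕ-injective (begin
  toℕ ((toℕ (fromℕ p) ℕ.+ suc (toℕ j) % suc p) mod suc p)
      ≡⟨ toℕ-mod (toℕ (fromℕ p) ℕ.+ suc (toℕ j) % suc p) (suc p) ⟩
  (toℕ (fromℕ p) ℕ.+ suc (toℕ j) % suc p) % suc p
      ≡⟨ ≡.cong (_% suc p) (≡.trans (≡.cong (ℕ._+ suc (toℕ j) % suc p) (toℕ-fromℕ p))
      (ℕ.+-comm p (suc (toℕ j) % suc p))) ⟩
  (suc (toℕ j) % suc p ℕ.+ p) % suc p                        ≡⟨ %-remove-inner (suc (toℕ j)) p (suc p) ⟩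
  (suc (toℕ j) ℕ.+ p) % suc p                                ≡⟨ ≡.cong (_% suc p) (≡.sym (ℕ.+-suc (toℕ j) p)) ⟩
  (toℕ j ℕ.+ suc p) % suc p                                  ≡⟨ [m+n]%n≡m%n (toℕ j) (suc p) ⟩
  toℕ j % suc p                                              ≡⟨ toℕ-% j ⟩
  toℕ j                                                      ∎)
  where open ≡-Reasoning

innerShift : ∀ {n} → Fin (suc n) → Fin (suc n) → ℕ
innerShift {n} i j = (+ suc (toℕ i) ℤ.- + suc (toℕ j) ℤ.- + 1) ℤ.%ℕ suc n

-- The exponent is i - j - 1 up to a multiple of n + 1; adding the one-based number of `j` leaves
-- the zero-based index `i`.
innerShift-% : ∀ {n} (i j : Fin (suc n)) → (innerShift i j ℕ.+ suc (toℕ j)) % suc n ≡ toℕ i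
innerShift-% {n} i j = ≡.trans (ℤ-congruent⇒%≡ (innerShift i j ℕ.+ suc (toℕ j)) (toℕ i) quotient (suc n) (begin
    + innerShift i j ℤ.+ + suc (toℕ j) ℤ.+ quotient ℤ.* + suc n
        ≡⟨ solve 3 (λ E J Q → E :+ J :+ Q := (E :+ Q) :+ J) ≡.refl (+ innerShift i j) (+ suc (toℕ j))
        (quotient ℤ.* + suc n) ⟩
    (+ innerShift i j ℤ.+ quotient ℤ.* + suc n) ℤ.+ + suc (toℕ j)
        ≡⟨ ≡.cong (λ z → z ℤ.+ + suc (toℕ j)) (ℤ.a≡a%ℕn+[a/ℕn]*n (+ suc (toℕ i) ℤ.- + suc (toℕ j) ℤ.- + 1) (suc n)) ⟨
    (+ suc (toℕ i) ℤ.- + suc (toℕ j) ℤ.- + 1) ℤ.+ + suc (toℕ j)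
        ≡⟨ solve 2 (λ I J → (con (+ 1) :+ I) :- J :- con (+ 1) :+ J := I) ≡.refl (+ toℕ i) (+ suc (toℕ j)) ⟩
    + toℕ i                                                         ∎)) (toℕ-% i)
  where
  open ≡-Reasoning
  open ℤ.+-*-Solver
  quotient : ℤ
  quotient = (+ suc (toℕ i) ℤ.- + suc (toℕ j) ℤ.- + 1) ℤ./ℕ suc n

-- The residue `n` stands for -1 modulo n + 1 and would force `i ≡ j`. All smaller residues survive
-- the further reduction modulo `n` inside the inner shift.
innerShift<n : ∀ {n} {i j : Fin (suc n)} → i ≢ j → innerShift i j ℕ.< n
innerShift<n {n} {i} {j} i≢j = ℕ.≤∧≢⇒< (ℕ.≤-pred (ℤ.n%ℕd<d (+ suc (toℕ i) ℤ.- + suc (toℕ j) ℤ.- + 1) (suc n))) λ E≡n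
    → i≢j (toℕ-injective (begin
    toℕ i                                  ≡⟨ innerShift-% i j ⟨
    (innerShift i j ℕ.+ suc (toℕ j)) % suc n       ≡⟨ ≡.cong (λ E → (E ℕ.+ suc (toℕ j)) % suc n) E≡n ⟩
    (n ℕ.+ suc (toℕ j)) % suc n
        ≡⟨ ≡.cong (_% suc n) (≡.trans (ℕ.+-comm n (suc (toℕ j))) (≡.sym (ℕ.+-suc (toℕ j) n))) ⟩
    (toℕ j ℕ.+ suc n) % suc n              ≡⟨ [m+n]%n≡m%n (toℕ j) (suc n) ⟩
    toℕ j % suc n                          ≡⟨ toℕ-% j ⟩
    toℕ j                                  ∎))
  where open ≡-Reasoning

punchIn-fromℕ : ∀ {p} (i : Fin p) → punchIn (fromℕ p) i ≡ inject₁ i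
punchIn-fromℕ zero    = ≡.refl
punchIn-fromℕ (suc i) = ≡.cong suc (punchIn-fromℕ i)

-- The permutation whose matrix is `bordered` of the matrix of `π`.
fixLast : ∀ {p} → Permutation′ p → Permutation′ (suc p)
fixLast {p} π = insert (fromℕ p) (fromℕ p) π

fixLast-fromℕ : ∀ {p} (π : Permutation′ p) → fixLast π ⟨$⟩ʳ fromℕ p ≡ fromℕ p
fixLast-fromℕ {p} π with fromℕ p ≟ᶠ fromℕ p
... | yes _ = ≡.refl
... | no l≢l = contradiction ≡.refl l≢l

fixLast-inject₁ : ∀ {p} (π : Permutation′ p) i → fixLast π ⟨$⟩ʳ inject₁ i ≡ inject₁ (π ⟨$⟩ʳ i)
fixLast-inject₁ {p} π i = ≡.trans (≡.cong (fixLast π ⟨$⟩ʳ_) (≡.sym (punchIn-fromℕ i)))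
  (≡.trans (insert-punchIn (fromℕ p) (fromℕ p) π i) (punchIn-fromℕ (π ⟨$⟩ʳ i)))

module Geometry {c ℓ₁ ℓ₂} (F : OrderedField c ℓ₁ ℓ₂) where
  open OrderedField F
  open Euclidean F

  -- Inequalities in an ordered field.

  module OrderedFieldProperties where
    open CommutativeRing commutativeRing public
      using (+-cong; +-congˡ; +-congʳ; *-cong; *-congˡ; *-congʳ; -‿cong; +-identityˡ; +-identityʳ;
             *-identityˡ; *-identityʳ; +-assoc; *-comm; *-assoc; distribˡ; distribʳ; zeroˡ; zeroʳ;
             -‿inverseʳ; setoid; refl; sym; trans; reflexive; semiring)
    open IsDecTotalOrder isDecTotalOrder public
      using (antisym; total; _≟_; _≤?_; ≤-respˡ-≈; ≤-respʳ-≈)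
      renaming (reflexive to ≤-reflexive; refl to ≤-refl; trans to ≤-trans)
    open IntegerSolver commutativeRing public

    private variable x y z w s : Carrier

    abstract
      x≤y⇒0≤y-x : x ≤ y → 0# ≤ y - x
      x≤y⇒0≤y-x {x} x≤y = ≤-respˡ-≈ (-‿inverseʳ x) (+-monoˡ-≤ (- x) x≤y)

      -- Most inequalities below are proved in this form: the ring solver rewrites the difference as
      -- an expression that is visibly nonnegative.
      0≤s⇒x≤y : 0# ≤ s → y - x ≈ s → x ≤ y
      0≤s⇒x≤y {s} {y} {x} 0≤s y-x≈s = ≤-respˡ-≈ (+-identityˡ x)
        (≤-respʳ-≈ (trans (+-congʳ (sym y-x≈s)) (solve 2 (λ a b → a :- b :+ b := a) y x)) (+-monoˡ-≤ x 0≤s))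

      +-nonNeg : 0# ≤ x → 0# ≤ y → 0# ≤ x + y
      +-nonNeg {x} {y} 0≤x 0≤y = ≤-trans 0≤y (≤-respˡ-≈ (+-identityˡ y) (+-monoˡ-≤ y 0≤x))

      +-mono-≤ : x ≤ y → z ≤ w → x + z ≤ y + w
      +-mono-≤ {x} {y} {z} {w} x≤y z≤w = 0≤s⇒x≤y (+-nonNeg (x≤y⇒0≤y-x x≤y) (x≤y⇒0≤y-x z≤w))
        (solve 4 (λ x y z w → (y :+ w) :- (x :+ z) := (y :- x) :+ (w :- z)) x y z w)

      neg-antimono-≤ : x ≤ y → - y ≤ - x
      neg-antimono-≤ {x} {y} x≤y = 0≤s⇒x≤y (x≤y⇒0≤y-x x≤y) (solve 2 (λ x y → (:- x) :- (:- y) := y :- x) x y)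

      neg-nonNeg : x ≤ 0# → 0# ≤ - x
      neg-nonNeg {x} x≤0 = 0≤s⇒x≤y (x≤y⇒0≤y-x x≤0) (solve 1 (λ x → :- x :- con (+ 0) := con (+ 0) :- x) x)

      square-nonNeg : ∀ x → 0# ≤ x * x
      square-nonNeg x with total 0# x
      ... | inj₁ 0≤x = *-nonNeg 0≤x 0≤x
      ... | inj₂ x≤0 = ≤-respʳ-≈ (solve 1 (λ x → :- x :* :- x := x :* x) x)
                         (*-nonNeg (neg-nonNeg x≤0) (neg-nonNeg x≤0))

      0≤1 : 0# ≤ 1#
      0≤1 = ≤-respʳ-≈ (*-identityˡ 1#) (square-nonNeg 1#)

      <⇒≤ : x < y → x ≤ y
      <⇒≤ {x} {y} y≰x = [ id , (λ y≤x → contradiction y≤x y≰x) ]′ (total x y)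

      <⇒≉ : x < y → ¬ (x ≈ y)
      <⇒≉ y≰x x≈y = y≰x (≤-reflexive (sym x≈y))

      ≤∧≉⇒< : x ≤ y → ¬ (x ≈ y) → x < y
      ≤∧≉⇒< x≤y x≉y y≤x = x≉y (antisym x≤y y≤x)

      <-respˡ : x ≈ y → x < z → y < z
      <-respˡ x≈y z≰x z≤y = z≰x (≤-respʳ-≈ (sym x≈y) z≤y)

      0<1 : 0# < 1#
      0<1 = ≤∧≉⇒< 0≤1 0≉1

      0<s⇒x<y : 0# < s → y - x ≈ s → x < y
      0<s⇒x<y {s} {y} {x} 0<s y-x≈s y≤x = 0<s (≤-respˡ-≈ y-x≈s
        (0≤s⇒x≤y (x≤y⇒0≤y-x y≤x) (solve 2 (λ x y → con (+ 0) :- (y :- x) := x :- y) x y)))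

      x<y⇒0<y-x : x < y → 0# < y - x
      x<y⇒0<y-x {x} {y} y≰x y-x≤0 = y≰x (0≤s⇒x≤y (neg-nonNeg y-x≤0) (solve 2 (λ x y → x :- y := :- (y :- x)) x y))

      +-pos-nonNeg : 0# < x → 0# ≤ y → 0# < x + y
      +-pos-nonNeg {x} {y} 0<x 0≤y x+y≤0 = 0<x (≤-trans (0≤s⇒x≤y 0≤y (solve 2 (λ x y → x :+ y :- x := y) x y)) x+y≤0)

      x-y≈0⇒x≈y : x - y ≈ 0# → x ≈ y
      x-y≈0⇒x≈y {x} {y} h = trans (solve 2 (λ x y → x := (x :- y) :+ y) x y) (trans (+-congʳ h) (+-identityˡ y))

      x≈y⇒x-y≈0 : x ≈ y → x - y ≈ 0#
      x≈y⇒x-y≈0 {x} {y} x≈y = trans (+-congʳ x≈y) (-‿inverseʳ y)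

      +-cancelˡ-≈ : ∀ z → z + x ≈ z + y → x ≈ y
      +-cancelˡ-≈ {x} {y} z h = x-y≈0⇒x≈y (trans (solve 3 (λ x y z → x :- y := (z :+ x) :- (z :+ y)) x y z)
          (x≈y⇒x-y≈0 h))

      ⁻¹-inverseˡ : ∀ x → ¬ (x ≈ 0#) → x ⁻¹ * x ≈ 1#
      ⁻¹-inverseˡ x x≉0 = trans (*-comm _ _) (⁻¹-inverse x x≉0)

      *-cancelˡ-0 : ¬ (x ≈ 0#) → x * y ≈ 0# → y ≈ 0#
      *-cancelˡ-0 {x} {y} x≉0 xy≈0 = trans (sym (*-identityˡ y)) (trans (*-congʳ (sym (⁻¹-inverseˡ x x≉0)))
        (trans (*-assoc _ _ _) (trans (*-congˡ xy≈0) (zeroʳ _))))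

      *-pos : 0# < x → 0# < y → 0# < x * y
      *-pos 0<x 0<y = ≤∧≉⇒< (*-nonNeg (<⇒≤ 0<x) (<⇒≤ 0<y))
        (λ 0≈xy → <⇒≉ 0<y (sym (*-cancelˡ-0 (λ x≈0 → <⇒≉ 0<x (sym x≈0)) (sym 0≈xy))))

      *-cancelˡ-nonNeg : 0# < x → 0# ≤ x * y → 0# ≤ y
      *-cancelˡ-nonNeg {x} {y} 0<x 0≤xy = decidable-stable (0# ≤? y) λ 0≰y →
        *-pos 0<x (x<y⇒0<y-x 0≰y) (0≤s⇒x≤y 0≤xy (solve 2 (λ x y → con (+ 0) :- x :* (con (+ 0) :- y) := x :* y) x y))

      ⁻¹-pos : 0# < x → 0# < x ⁻¹
      ⁻¹-pos {x} 0<x = ≤∧≉⇒< (*-cancelˡ-nonNeg 0<x (≤-respʳ-≈ (sym x*x⁻¹≈1) 0≤1))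
        (λ 0≈x⁻¹ → 0≉1 (trans (sym (zeroʳ x)) (trans (*-congˡ 0≈x⁻¹) x*x⁻¹≈1)))
        where
        x*x⁻¹≈1 : x * x ⁻¹ ≈ 1#
        x*x⁻¹≈1 = ⁻¹-inverse x (λ x≈0 → <⇒≉ 0<x (sym x≈0))

      fromNat-nonNeg : ∀ k → 0# ≤ fromNat k
      fromNat-nonNeg zero    = ≤-refl
      fromNat-nonNeg (suc k) = +-nonNeg 0≤1 (fromNat-nonNeg k)

      fromNat-pos : ∀ k → 0# < fromNat (suc k)
      fromNat-pos k = +-pos-nonNeg 0<1 (fromNat-nonNeg k)

      fromNat≉0 : ∀ k → ¬ (fromNat (suc k) ≈ 0#)
      fromNat≉0 k h = <⇒≉ (fromNat-pos k) (sym h)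

      -- Both expressions are products of two consecutive integers, which never have opposite signs.
      -- Through this lemma the integrality of lattice points enters the description of V(0).
      fromInt-square : ∀ q → 0# ≤ fromInt q * fromInt q + fromInt q × 0# ≤ fromInt q * fromInt q - fromInt q
      fromInt-square (+ zero)  = ≤-reflexive (solve 0 (con (+ 0) := con (+ 0) :* con (+ 0) :+ con (+ 0)))
                               , ≤-reflexive (solve 0 (con (+ 0) := con (+ 0) :* con (+ 0) :- con (+ 0)))
      fromInt-square (+ suc k) =
          +-nonNeg (square-nonNeg _) (fromNat-nonNeg (suc k))
        , ≤-respʳ-≈ (solve 1 (λ p → (con (+ 1) :+ p) :* p := (con (+ 1) :+ p) :* (con (+ 1) :+ p) :- (con (+ 1) :+ p))
            (fromNat k))
            (*-nonNeg (fromNat-nonNeg (suc k)) (fromNat-nonNeg k))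
      fromInt-square -[1+ k ] =
          ≤-respʳ-≈ (solve 1 (λ p → (con (+ 1) :+ p) :* p := (:- (con (+ 1) :+ p)) :* (:- (con (+ 1) :+ p)) :+
              (:- (con (+ 1) :+ p))) (fromNat k))
            (*-nonNeg (fromNat-nonNeg (suc k)) (fromNat-nonNeg k))
        , ≤-respʳ-≈ (solve 1 (λ q → (:- q) :* (:- q) :+ q := (:- q) :* (:- q) :- (:- q)) (fromNat (suc k)))
            (+-nonNeg (square-nonNeg _) (fromNat-nonNeg (suc k)))

      fromInt-nonzero : ∀ q → ¬ (fromInt q ≈ 0#) → 1# ≤ fromInt q ⊎ fromInt q ≤ - 1#
      fromInt-nonzero (+ zero)  q≉0 = contradiction refl q≉0
      fromInt-nonzero (+ suc k) _   = inj₁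
          (0≤s⇒x≤y (fromNat-nonNeg k) (solve 1 (λ p → con (+ 1) :+ p :- con (+ 1) := p) (fromNat k)))
      fromInt-nonzero -[1+ k ]  _   = inj₂
          (neg-antimono-≤ (0≤s⇒x≤y (fromNat-nonNeg k) (solve 1 (λ p → con (+ 1) :+ p :- con (+ 1) := p) (fromNat k))))

      -- δ = ε / (1 + D) works because D < (1 + D)².
      small-multiple : ∀ {ε D} → 0# < ε → 0# ≤ D → ∃[ δ ] 0# < δ × δ * δ * D < ε * ε
      small-multiple {ε} {D} 0<ε 0≤D = δ , *-pos 0<ε (⁻¹-pos 0<1+D) , 0<s⇒x<y
        (*-pos (*-pos 0<δ 0<δ) (+-pos-nonNeg 0<1 (+-nonNeg 0≤D (square-nonNeg D))))
        (trans (+-congʳ (trans (*-cong ε≈ ε≈) refl))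
          (solve 2 (λ d D → (d :* (con (+ 1) :+ D)) :* (d :* (con (+ 1) :+ D)) :- d :* d :* D
                          := d :* d :* (con (+ 1) :+ (D :+ D :* D))) δ D))
        where
        δ : Carrier
        δ = ε * (1# + D) ⁻¹
        0<1+D : 0# < 1# + D
        0<1+D = +-pos-nonNeg 0<1 0≤D
        0<δ : 0# < δ
        0<δ = *-pos 0<ε (⁻¹-pos 0<1+D)
        ε≈ : ε ≈ δ * (1# + D)
        ε≈ = sym (trans (*-assoc _ _ _) (trans (*-congˡ (⁻¹-inverseˡ _ (λ h → <⇒≉ 0<1+D (sym h)))) (*-identityʳ ε)))

      maximum : ∀ {m} (f : Fin (suc m) → Carrier) → ∃[ i ] (∀ k → f k ≤ f i)
      maximum {zero}  f = zero , λ { zero → ≤-refl }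
      maximum {suc m} f with maximum (f ∘ suc)
      ... | i , f≤fi with f zero ≤? f (suc i)
      ...   | yes f0≤fi = suc i , λ { zero → f0≤fi ; (suc k) → f≤fi k }
      ...   | no  f0≰fi = zero , λ { zero → ≤-refl ; (suc k) → ≤-trans (f≤fi k) (<⇒≤ f0≰fi) }

      minimum : ∀ {m} (f : Fin (suc m) → Carrier) → ∃[ i ] (∀ k → f i ≤ f k)
      minimum f with maximum (-_ ∘ f)
      ... | i , h = i , λ k → 0≤s⇒x≤y (x≤y⇒0≤y-x (h k)) (solve 2 (λ a b → a :- b := :- b :- (:- a)) (f k) (f i))

  -- Linear algebra, affine dimension and faces of cones.

  module EuclideanProperties where
    open OrderedFieldProperties
    open Summation semiring public
      using (sum-cong-≋; sum-remove; ∑-distrib-+; ∑-comm; sum-permute; *-distribˡ-sum; *-distribʳ-sum)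
    open SetoidReasoning setoid

    private variable
      m N : ℕ
      x y z x′ y′ : Point N

    lincomb : Vector Carrier m → (Fin m → Point N) → Point N
    lincomb t p = Σᵖ (λ k → t k ⊛ p k)

    frame : Point N → (Fin m → Point N) → Fin (suc m) → Point N
    frame o d zero    = o
    frame o d (suc k) = o ⊕ d k

    abstract
      sum-zero : ∀ {f : Vector Carrier m} → (∀ k → f k ≈ 0#) → sum f ≈ 0#
      sum-zero {zero}  f≈0 = refl
      sum-zero {suc m} f≈0 = trans (+-cong (f≈0 zero) (sum-zero (f≈0 ∘ suc))) (+-identityˡ 0#)

      sum-nonNeg : ∀ {f : Vector Carrier m} → (∀ k → 0# ≤ f k) → 0# ≤ sum f
      sum-nonNeg {zero}  0≤f = ≤-refl
      sum-nonNeg {suc m} 0≤f = +-nonNeg (0≤f zero) (sum-nonNeg (0≤f ∘ suc))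

      sum-nonNeg-zero : ∀ {f : Vector Carrier m} → (∀ k → 0# ≤ f k) → sum f ≈ 0# → ∀ k → f k ≈ 0#
      sum-nonNeg-zero {suc m} {f} 0≤f Σf≈0 k = antisym
        (≤-respʳ-≈ (trans (sym (sum-remove {i = k} f)) Σf≈0)
          (0≤s⇒x≤y (sum-nonNeg (0≤f ∘ punchIn k)) (solve 2 (λ a b → (a :+ b) :- a := b) (f k) _)))
        (0≤f k)

      sum-minus : ∀ (f g : Vector Carrier m) → sum (λ k → f k - g k) ≈ sum f - sum g
      sum-minus f g = begin
        sum (λ k → f k - g k)              ≈⟨ ∑-distrib-+ f (-_ ∘ g) ⟩
        sum f + sum (-_ ∘ g)               ≈⟨ +-congˡ
            (sum-cong-≋ λ k → solve 1 (λ a → :- a := (:- con (+ 1)) :* a) (g k)) ⟩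
        sum f + sum (λ k → - 1# * g k)     ≈⟨ +-congˡ (*-distribˡ-sum (- 1#) g) ⟨
        sum f + - 1# * sum g               ≈⟨ solve 2 (λ a b → a :+ (:- con (+ 1)) :* b := a :- b) (sum f) (sum g) ⟩
        sum f - sum g                      ∎

      sum-mono-≤ : ∀ {f g : Vector Carrier m} → (∀ k → f k ≤ g k) → sum f ≤ sum g
      sum-mono-≤ {f = f} {g} f≤g = 0≤s⇒x≤y (sum-nonNeg (λ k → x≤y⇒0≤y-x (f≤g k))) (sym (sum-minus g f))

      sum-const : ∀ m x → sum {m} (const x) ≈ fromNat m * x
      sum-const zero    x = sym (zeroˡ x)
      sum-const (suc m) x = trans (+-cong (sym (*-identityˡ x)) (sum-const m x)) (sym (distribʳ x 1# (fromNat m)))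

      sum-single : ∀ {f : Vector Carrier m} i → (∀ k → k ≢ i → f k ≈ 0#) → sum f ≈ f i
      sum-single {suc m} {f} i f≈0 = begin
        sum f                        ≈⟨ sum-remove {i = i} f ⟩
        f i + sum (f ∘ punchIn i)    ≈⟨ +-congˡ (sum-zero (λ k → f≈0 (punchIn i k) (punchInᵢ≢i i k))) ⟩
        f i + 0#                     ≈⟨ +-identityʳ (f i) ⟩
        f i                          ∎

      if-yes : ∀ {a} {A : Set a} {k i : Fin m} {x y : A} → k ≡ i → (if does (k ≟ᶠ i) then x else y) ≡ x
      if-yes {k = k} {i} k≡i rewrite dec-true (k ≟ᶠ i) k≡i = ≡.refl

      if-no : ∀ {a} {A : Set a} {k i : Fin m} {x y : A} → k ≢ i → (if does (k ≟ᶠ i) then x else y) ≡ y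
      if-no {k = k} {i} k≢i rewrite dec-false (k ≟ᶠ i) k≢i = ≡.refl

      e-diag : ∀ {k i : Fin m} → k ≡ i → e i k ≈ 1#
      e-diag k≡i = reflexive (if-yes k≡i)

      e-off : ∀ {k i : Fin m} → k ≢ i → e i k ≈ 0#
      e-off k≢i = reflexive (if-no k≢i)

      e-∙ : ∀ i (x : Point N) → e i ∙ x ≈ x i
      e-∙ i x = begin
        e i ∙ x        ≈⟨ sum-single i (λ k k≢i → trans (*-congʳ (e-off k≢i)) (zeroˡ (x k))) ⟩
        e i i * x i    ≈⟨ *-congʳ (e-diag {k = i} ≡.refl) ⟩
        1# * x i       ≈⟨ *-identityˡ (x i) ⟩
        x i            ∎

      ≋-refl : x ≋ x
      ≋-refl k = refl

      ≋-sym : x ≋ y → y ≋ x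
      ≋-sym h k = sym (h k)

      ≋-trans : x ≋ y → y ≋ z → x ≋ z
      ≋-trans g h k = trans (g k) (h k)

      ∙-cong : x ≋ x′ → y ≋ y′ → x ∙ y ≈ x′ ∙ y′
      ∙-cong g h = sum-cong-≋ λ k → *-cong (g k) (h k)

      ∙-congˡ : ∀ (u : Point N) → x ≋ y → u ∙ x ≈ u ∙ y
      ∙-congˡ u = ∙-cong (≋-refl {x = u})

      ∙-comm : ∀ (x y : Point N) → x ∙ y ≈ y ∙ x
      ∙-comm x y = sum-cong-≋ λ k → *-comm (x k) (y k)

      ∙-⊕ : ∀ (u x y : Point N) → u ∙ (x ⊕ y) ≈ u ∙ x + u ∙ y
      ∙-⊕ u x y = trans (sum-cong-≋ λ k → distribˡ (u k) (x k) (y k))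
          (∑-distrib-+ (λ k → u k * x k) (λ k → u k * y k))

      ∙-⊝ : ∀ (u x y : Point N) → u ∙ (x ⊝ y) ≈ u ∙ x - u ∙ y
      ∙-⊝ u x y = trans (sum-cong-≋ λ k → solve 3 (λ u x y → u :* (x :- y) := u :* x :- u :* y) (u k) (x k) (y k))
                    (sum-minus (λ k → u k * x k) (λ k → u k * y k))

      ∙-⊛ : ∀ (u : Point N) t x → u ∙ (t ⊛ x) ≈ t * (u ∙ x)
      ∙-⊛ u t x = trans (sum-cong-≋ λ k → solve 3 (λ u t x → u :* (t :* x) := t :* (u :* x)) (u k) t (x k))
                    (sym (*-distribˡ-sum t (λ k → u k * x k)))

      ∙-lincomb : ∀ (u : Point N) (t : Vector Carrier m) p → u ∙ lincomb t p ≈ sum (λ k → t k * (u ∙ p k))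
      ∙-lincomb u t p = begin
        sum (λ i → u i * sum (λ k → t k * p k i))     ≈⟨ (sum-cong-≋ λ i → *-distribˡ-sum (u i) (λ k → t k * p k i)) ⟩
        sum (λ i → sum (λ k → u i * (t k * p k i)))   ≈⟨ ∑-comm (λ i k → u i * (t k * p k i)) ⟩
        sum (λ k → u ∙ (t k ⊛ p k))                   ≈⟨ sum-cong-≋ (λ k → ∙-⊛ u (t k) (p k)) ⟩
        sum (λ k → t k * (u ∙ p k))                   ∎

      -- Gaussian elimination, cross-multiplied by the pivot to avoid divisions.
      homogeneous-solution : ∀ m (M : Matrix m (suc m)) → Σ[ t ∈ Vector Carrier (suc m) ] (∃[ k ] ¬ (t k ≈ 0#))
          × (∀ r → M r ∙ t ≈ 0#)
      homogeneous-solution zero    M = const 1# , (zero , λ 1≈0 → 0≉1 (sym 1≈0)) , λ ()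
      homogeneous-solution (suc m) M with any? (λ k → ¬? (M zero k ≟ 0#))
      -- A zero first row holds for any unknowns, so the first unknown can be fixed at 0 and the
      -- other rows still face one unknown too many.
      ... | no all-zero with homogeneous-solution m (λ r s → M (suc r) (suc s))
      ...   | t , (k , tk≉0) , Mt≈0 = (0# ∷ t) , (suc k , tk≉0) , λ
              { zero    → sum-zero {f = λ s → M zero s * (0# ∷ t) s} λ s
                  → trans (*-congʳ (decidable-stable (M zero s ≟ 0#) (λ M≉0 → all-zero (s , M≉0))))
                  (zeroˡ ((0# ∷ t) s))
              ; (suc r) → trans (+-cong (zeroʳ (M (suc r) zero)) (Mt≈0 r)) (+-identityˡ 0#) }
      homogeneous-solution (suc m) M | yes (p , a≉0)
        with homogeneous-solution m (λ r s → M zero p * M (suc r) (punchIn p s) - M (suc r) p * M zero (punchIn p s))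
      ... | t , (k , tk≉0) , Et≈0 = u , (punchIn p k , uk≉0) , Mu≈0
        where
        a : Carrier
        a = M zero p
        S : Fin (suc m) → Carrier
        S r = (M r ∘ punchIn p) ∙ t
        u : Vector Carrier (suc (suc m))
        -- Back substitution: once the other unknowns are scaled by the pivot `a`, the value
        -- `- S zero` at the pivot solves the first row.
        u = insertAt (a ⊛ t) p (- S zero)
        u-punchIn : ∀ s → u (punchIn p s) ≈ a * t s
        u-punchIn s = reflexive (insertAt-punchIn (a ⊛ t) p (- S zero) s)
        uk≉0 : ¬ (u (punchIn p k) ≈ 0#)
        uk≉0 h = tk≉0 (*-cancelˡ-0 a≉0 (trans (sym (u-punchIn k)) h))
        expand : ∀ r → M r ∙ u ≈ M r p * - S zero + a * S r
        expand r = begin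
          M r ∙ u                                                        ≈⟨ sum-remove {i = p} (λ s → M r s * u s) ⟩
          M r p * u p + sum (λ s → M r (punchIn p s) * u (punchIn p s))
              ≈⟨ +-cong (*-congˡ (reflexive (insertAt-lookup (a ⊛ t) p (- S zero))))
                                                                              (sum-cong-≋ λ s → *-congˡ {x = M r (punchIn p s)} (u-punchIn s)) ⟩
          M r p * - S zero + (M r ∘ punchIn p) ∙ (a ⊛ t)                 ≈⟨ +-congˡ (∙-⊛ (M r ∘ punchIn p) a t) ⟩
          M r p * - S zero + a * S r                                     ∎
        Mu≈0 : ∀ r → M r ∙ u ≈ 0#
        Mu≈0 zero    = trans (expand zero) (solve 2 (λ a S → a :* (:- S) :+ a :* S := con (+ 0)) a (S zero))
        Mu≈0 (suc r) = begin
          M (suc r) ∙ u                                       ≈⟨ expand (suc r) ⟩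
          b * - S zero + a * S (suc r)
              ≈⟨ solve 4 (λ a b x y → b :* (:- x) :+ a :* y := a :* y :- b :* x) a b (S zero) (S (suc r)) ⟩
          a * S (suc r) - b * S zero
              ≈⟨ +-cong (*-distribˡ-sum a (λ s → Mr s * t s)) (-‿cong (*-distribˡ-sum b (λ s → M₀ s * t s))) ⟩
          sum (λ s → a * (Mr s * t s)) - sum (λ s → b * (M₀ s * t s))
              ≈⟨ sum-minus (λ s → a * (Mr s * t s)) (λ s → b * (M₀ s * t s)) ⟨
          sum (λ s → a * (Mr s * t s) - b * (M₀ s * t s))
              ≈⟨ (sum-cong-≋ λ s → solve 5 (λ a b x y t → a :* (x :* t) :- b :* (y :* t) := (a :* x :- b :* y) :* t) a
              b (Mr s) (M₀ s) (t s)) ⟩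
          sum (λ s → (a * Mr s - b * M₀ s) * t s)             ≈⟨ Et≈0 r ⟩
          0#                                                  ∎
          where
          b : Carrier
          b = M (suc r) p
          Mr M₀ : Fin (suc m) → Carrier
          Mr = M (suc r) ∘ punchIn p
          M₀ = M zero ∘ punchIn p

      sum-lincomb : ∀ {k} (c : Vector Carrier k) (t : Matrix k m) (p : Fin m → Point N) i →
                    sum (λ r → c r * lincomb (t r) p i) ≈ sum (λ s → sum (λ r → c r * t r s) * p s i)
      sum-lincomb c t p i = begin
        sum (λ r → c r * sum (λ s → t r s * p s i))
            ≈⟨ (sum-cong-≋ λ r → *-distribˡ-sum (c r) (λ s → t r s * p s i)) ⟩
        sum (λ r → sum (λ s → c r * (t r s * p s i)))    ≈⟨ ∑-comm (λ r s → c r * (t r s * p s i)) ⟩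
        sum (λ s → sum (λ r → c r * (t r s * p s i)))
            ≈⟨ (sum-cong-≋ λ s → sum-cong-≋ λ r → *-assoc (c r) (t r s) (p s i)) ⟨
        sum (λ s → sum (λ r → c r * t r s * p s i))
            ≈⟨ (sum-cong-≋ λ s → *-distribʳ-sum (p s i) (λ r → c r * t r s)) ⟨
        sum (λ s → sum (λ r → c r * t r s) * p s i)      ∎

      -- The weights of the `suc m` points over `g` give `m` equations in `suc m` unknowns. A
      -- nonzero solution `c` kills every column of weights; as each row of weights sums to 1, it
      -- also has `sum c ≈ 0#` and is an affine dependence.
      affine-span-bound : ∀ (g : Fin m → Point N) (q : Fin (suc m) → Point N) →
                          (∀ r → q r ∈ affineCombinations g) → ¬ AffinelyIndependent q
      affine-span-bound {m} g q q∈aff indep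
        with homogeneous-solution m (λ s r → proj₁ (q∈aff r) s)
      ... | c , (k , ck≉0) , tc≈0 = ck≉0 (indep c Σc≈0 Σcq≈0 k)
        where
        t : Matrix (suc m) m
        t r = proj₁ (q∈aff r)
        ct≈0 : ∀ s → sum (λ r → c r * t r s) ≈ 0#
        ct≈0 s = trans (sum-cong-≋ λ r → *-comm (c r) (t r s)) (tc≈0 s)
        Σc≈0 : sum c ≈ 0#
        Σc≈0 = begin
          sum c
              ≈⟨ (sum-cong-≋ λ r → trans (*-congˡ {x = c r} (proj₁ (proj₂ (q∈aff r)))) (*-identityʳ (c r))) ⟨
          sum (λ r → c r * sum (t r))           ≈⟨ (sum-cong-≋ λ r → *-distribˡ-sum (c r) (t r)) ⟩
          sum (λ r → sum (λ s → c r * t r s))   ≈⟨ ∑-comm (λ r s → c r * t r s) ⟩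
          sum (λ s → sum (λ r → c r * t r s))   ≈⟨ sum-zero ct≈0 ⟩
          0#                                    ∎
        Σcq≈0 : lincomb c q ≋ 𝟎
        Σcq≈0 i = begin
          lincomb c q i
              ≈⟨ (sum-cong-≋ λ r → *-congˡ {x = c r} (proj₂ (proj₂ (q∈aff r)) i)) ⟩
          sum (λ r → c r * lincomb (t r) g i)        ≈⟨ sum-lincomb c t g i ⟩
          sum (λ s → sum (λ r → c r * t r s) * g s i) ≈⟨ sum-zero (λ s → trans (*-congʳ (ct≈0 s)) (zeroˡ (g s i))) ⟩
          0#                                         ∎

      -- One equation says that the weights sum to zero; it takes the place of the coordinate l, which vanishes like k.
      codimension-two-bound : ∀ (o : Point N) (d : Fin (suc m) → Point N) (q : Fin (suc m) → Point N)
          (t : Matrix (suc m) (suc m)) →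
                              (∀ r → q r ≋ o ⊕ lincomb (t r) d) → ∀ {k l} → k ≢ l → (∀ r → t r k ≈ 0#)
                                  → (∀ r → t r l ≈ 0#) →
                              ¬ AffinelyIndependent q
      codimension-two-bound {m = m} o d q t q≋ {k} {l} k≢l tk≈0 tl≈0 indep
        with homogeneous-solution m (λ s r → if does (punchIn k s ≟ᶠ l) then 1# else t r (punchIn k s))
      ... | c , (h , ch≉0) , Mc≈0 = ch≉0 (indep c Σc≈0 Σcq≈0 h)
        where
        Σc≈0 : sum c ≈ 0#
        Σc≈0 = begin
          sum c                ≈⟨ (sum-cong-≋ λ r
              → trans (*-congʳ {x = c r} (reflexive
              (if-yes {y = t r (punchIn k (punchOut k≢l))} (punchIn-punchOut k≢l)))) (*-identityˡ (c r))) ⟨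
          sum (λ r → (if does (punchIn k (punchOut k≢l) ≟ᶠ l) then 1# else t r (punchIn k (punchOut k≢l))) * c r)
              ≈⟨ Mc≈0 (punchOut k≢l) ⟩
          0#                   ∎
        ct≈0 : ∀ s → sum (λ r → c r * t r s) ≈ 0#
        ct≈0 s with k ≟ᶠ s | s ≟ᶠ l
        ... | yes ≡.refl | _          = sum-zero λ r → trans (*-congˡ (tk≈0 r)) (zeroʳ (c r))
        ... | no _       | yes ≡.refl = sum-zero λ r → trans (*-congˡ (tl≈0 r)) (zeroʳ (c r))
        ... | no k≢s     | no s≢l     = trans (sum-cong-≋ λ r → trans (*-comm (c r) (t r s)) (*-congʳ (M≈t r)))
            (Mc≈0 (punchOut k≢s))
          where
          M≈t : ∀ r → t r s ≈ (if does (punchIn k (punchOut k≢s) ≟ᶠ l) then 1# else t r (punchIn k (punchOut k≢s)))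
          M≈t r = reflexive (≡.sym (≡.trans (if-no (λ h → s≢l (≡.trans (≡.sym (punchIn-punchOut k≢s)) h)))
              (≡.cong (t r) (punchIn-punchOut k≢s))))
        Σcq≈0 : lincomb c q ≋ 𝟎
        Σcq≈0 i = begin
          lincomb c q i
              ≈⟨ (sum-cong-≋ λ r → trans (*-congˡ (q≋ r i)) (distribˡ (c r) (o i) (lincomb (t r) d i))) ⟩
          sum (λ r → c r * o i + c r * lincomb (t r) d i)
              ≈⟨ ∑-distrib-+ (λ r → c r * o i) (λ r → c r * lincomb (t r) d i) ⟩
          sum (λ r → c r * o i) + sum (λ r → c r * lincomb (t r) d i)
              ≈⟨ +-cong (sym (*-distribʳ-sum (o i) c)) (sum-lincomb c t d i) ⟩
          sum c * o i + sum (λ s → sum (λ r → c r * t r s) * d s i)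
              ≈⟨ +-cong (trans (*-congʳ Σc≈0) (zeroˡ (o i)))
              (sum-zero (λ s → trans (*-congʳ (ct≈0 s)) (zeroˡ (d s i)))) ⟩
          0# + 0#                                                     ≈⟨ +-identityˡ 0# ⟩
          0#                                                          ∎

      lincomb-frame : ∀ (t : Vector Carrier (suc m)) (o : Point N) d
          → lincomb t (frame o d) ≋ sum t ⊛ o ⊕ lincomb (t ∘ suc) d
      lincomb-frame t o d i = begin
        t zero * o i + sum (λ k → t (suc k) * (o i + d k i))
            ≈⟨ +-congˡ (sum-cong-≋ λ k → distribˡ (t (suc k)) (o i) (d k i)) ⟩
        t zero * o i + sum (λ k → t (suc k) * o i + t (suc k) * d k i)
            ≈⟨ +-congˡ (∑-distrib-+ (λ k → t (suc k) * o i) (λ k → t (suc k) * d k i)) ⟩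
        t zero * o i + (sum (λ k → t (suc k) * o i) + lincomb (t ∘ suc) d i)
            ≈⟨ +-congˡ (+-congʳ (*-distribʳ-sum (o i) (t ∘ suc))) ⟨
        t zero * o i + (sum (t ∘ suc) * o i + lincomb (t ∘ suc) d i)
            ≈⟨ solve 4 (λ a s o l → a :* o :+ (s :* o :+ l) := (a :+ s) :* o :+ l) (t zero) (sum (t ∘ suc)) (o i)
            (lincomb (t ∘ suc) d i) ⟩
        sum t * o i + lincomb (t ∘ suc) d i                                                ∎

      frame-independent : ∀ (o : Point N) (d : Fin m → Point N) → LinearlyIndependent d
          → AffinelyIndependent (frame o d)
      frame-independent o d indep t Σt≈0 Σtq≈0 = λ { zero → t0≈0 ; (suc k) → tk≈0 k }
        where
        tk≈0 : ∀ k → t (suc k) ≈ 0#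
        tk≈0 = indep (t ∘ suc) λ i → begin
          lincomb (t ∘ suc) d i                ≈⟨ +-identityˡ _ ⟨
          0# + lincomb (t ∘ suc) d i           ≈⟨ +-congʳ (trans (*-congʳ Σt≈0) (zeroˡ (o i))) ⟨
          sum t * o i + lincomb (t ∘ suc) d i  ≈⟨ lincomb-frame t o d i ⟨
          lincomb t (frame o d) i              ≈⟨ Σtq≈0 i ⟩
          0#                                   ∎
        t0≈0 : t zero ≈ 0#
        t0≈0 = trans (sym (+-identityʳ (t zero))) (trans (+-congˡ (sym (sum-zero tk≈0))) Σt≈0)

      frame-spans : ∀ (o : Point N) (d : Fin m → Point N) t → x ≋ o ⊕ lincomb t d → x ∈ affineCombinations (frame o d)
      frame-spans {m = m} {x = x} o d t x≋ = t′ , Σt′≈1 , λ i → begin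
          x i                             ≈⟨ x≋ i ⟩
          o i + lincomb t d i             ≈⟨ +-congʳ (trans (*-congʳ Σt′≈1) (*-identityˡ (o i))) ⟨
          sum t′ * o i + lincomb t d i    ≈⟨ lincomb-frame t′ o d i ⟨
          lincomb t′ (frame o d) i        ∎
        where
        t′ : Vector Carrier (suc m)
        -- The origin receives whatever weight the edges leave over.
        t′ = (1# - sum t) ∷ t
        Σt′≈1 : sum t′ ≈ 1#
        Σt′≈1 = solve 1 (λ s → con (+ 1) :- s :+ s := con (+ 1)) (sum t)

      -- In the cone at the corner o, the functional u attains its maximum exactly where the coordinates
      -- in the directions with u ∙ d k ≉ 0 vanish; the dimension of G forces exactly one such direction.
      corner-facet : ∀ (o : Point N) (d : Fin (suc m) → Point N) → LinearlyIndependent d →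
        ∀ (P G : Region N) → o ∈ P → (∀ k → o ⊕ d k ∈ P) →
        (∀ x → x ∈ P → Σ[ t ∈ Vector Carrier (suc m) ] (∀ k → 0# ≤ t k) × x ≋ o ⊕ lincomb t d) →
        IsFaceOfDimension m G P → o ∈ G →
        ∃[ k ] G ≐ (λ x → x ∈ P × Σ[ t ∈ Vector Carrier (suc m) ] t k ≈ 0# × x ≋ o ⊕ lincomb t d)
      corner-facet {m = m} o d indep P G o∈P o+d∈P coord ((u , β , ≤β , G⊆ , ⊆G) , (p , p∈G , p-indep , p-spans)) o∈G
        with any? (λ k → ¬? (u ∙ d k ≟ 0#))
      -- If `u` vanished in every direction, the whole frame would lie in `G`: `suc (suc m)`
      -- affinely independent points in the span of `suc m` points.
      ... | no all-zero = contradiction (frame-independent o d indep)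
            (affine-span-bound p (frame o d) λ { zero → p-spans o∈G ; (suc k) → p-spans (⊆G (o+d∈P k , tight k)) })
        where
        tight : ∀ k → u ∙ (o ⊕ d k) ≈ β
        tight k = trans (∙-⊕ u o (d k)) (trans
            (+-cong (proj₂ (G⊆ o∈G)) (decidable-stable (u ∙ d k ≟ 0#) (λ h → all-zero (k , h)))) (+-identityʳ β))
      ... | yes (k , wk≉0) = k , (λ {x} x∈G → proj₁ (G⊆ x∈G) , let (t , 0≤t , x≋) = coord x (proj₁ (G⊆ x∈G)) in t , t-zero wk≉0 x∈G , x≋)
                               , λ { (x∈P , t , tk≈0 , x≋) → ⊆G (x∈P , value t tk≈0 x≋) }
        where
        w : Fin (suc m) → Carrier
        w l = u ∙ d l
        uo≈β : u ∙ o ≈ β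
        uo≈β = proj₂ (G⊆ o∈G)
        w≤0 : ∀ l → w l ≤ 0#
        w≤0 l = 0≤s⇒x≤y (x≤y⇒0≤y-x (≤β (o ⊕ d l) (o+d∈P l)))
          (trans (solve 2 (λ w b → con (+ 0) :- w := b :- (b :+ w)) (w l) β)
            (+-congˡ (-‿cong (trans (+-congʳ (sym uo≈β)) (sym (∙-⊕ u o (d l)))))))
        expand : ∀ {x} t → x ≋ o ⊕ lincomb t d → u ∙ x ≈ β + sum (λ l → t l * w l)
        expand t x≋ = trans (∙-congˡ u x≋) (trans (∙-⊕ u o (lincomb t d)) (+-cong uo≈β (∙-lincomb u t d)))
        -- For a point of `G` the terms `- (t l * w l)` are nonnegative and add up to the difference
        -- of two values equal to `β`, so each of them vanishes.
        t-zero : ∀ {l} → ¬ (w l ≈ 0#) → ∀ {x} (x∈G : x ∈ G) → proj₁ (coord x (proj₁ (G⊆ x∈G))) l ≈ 0#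
        t-zero {l} wl≉0 {x} x∈G with coord x (proj₁ (G⊆ x∈G))
        ... | t , 0≤t , x≋ = *-cancelˡ-0 wl≉0 (trans (*-comm _ _) (trans (solve 1 (λ a → a := :- (:- a)) (t l * w l))
                (trans (-‿cong (sum-nonNeg-zero {f = λ l → - (t l * w l)} nonNeg total-zero l))
                    (solve 0 (:- con (+ 0) := con (+ 0))))))
          where
          nonNeg : ∀ l → 0# ≤ - (t l * w l)
          nonNeg l = ≤-respʳ-≈ (solve 2 (λ t w → t :* (:- w) := :- (t :* w)) (t l) (w l))
              (*-nonNeg (0≤t l) (neg-nonNeg (w≤0 l)))
          total-zero : sum (λ l → - (t l * w l)) ≈ 0#
          total-zero = begin
            sum (λ l → - (t l * w l))               ≈⟨ (sum-cong-≋ λ l → sym (+-identityˡ (- (t l * w l)))) ⟩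
            sum (λ l → 0# - t l * w l)              ≈⟨ sum-minus (λ _ → 0#) (λ l → t l * w l) ⟩
            sum {suc m} (λ _ → 0#) - S
                ≈⟨ +-congʳ (sum-zero {f = λ (_ : Fin (suc m)) → 0#} (λ _ → refl)) ⟩
            0# - S                                  ≈⟨ solve 2 (λ S b → con (+ 0) :- S := b :- (b :+ S)) S β ⟩
            β - (β + S)                             ≈⟨ +-congˡ (-‿cong (trans (sym (expand t x≋)) (proj₂ (G⊆ x∈G)))) ⟩
            β - β                                   ≈⟨ -‿inverseʳ β ⟩
            0#                                      ∎
            where
            S : Carrier
            S = sum (λ l → t l * w l)
        -- A second direction with `w l ≉ 0#` would make two coordinates vanish on all the points
        -- `p` that witness the dimension of `G`, leaving too little room for them.
        w-zero : ∀ l → l ≢ k → w l ≈ 0#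
        w-zero l l≢k = decidable-stable (w l ≟ 0#) λ wl≉0 →
          codimension-two-bound o d p (λ r → proj₁ (coord (p r) (proj₁ (G⊆ (p∈G r)))))
            (λ r → proj₂ (proj₂ (coord (p r) (proj₁ (G⊆ (p∈G r)))))) l≢k (λ r → t-zero wl≉0 (p∈G r))
                (λ r → t-zero wk≉0 (p∈G r)) p-indep
        value : ∀ {x} t → t k ≈ 0# → x ≋ o ⊕ lincomb t d → u ∙ x ≈ β
        value t tk≈0 x≋ = trans (expand t x≋) (trans (+-congˡ (sum-zero vanish)) (+-identityʳ β))
          where
          vanish : ∀ l → t l * w l ≈ 0#
          vanish l with l ≟ᶠ k
          ... | yes ≡.refl = trans (*-congʳ tk≈0) (zeroˡ (w l))
          ... | no l≢k     = trans (*-congˡ (w-zero l l≢k)) (zeroʳ (t l))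

      norm-⊛ : ∀ t (x : Point N) → ‖ t ⊛ x ‖² ≈ t * t * ‖ x ‖²
      norm-⊛ t x = trans (sum-cong-≋ λ k → solve 2 (λ t x → t :* x :* (t :* x) := t :* t :* (x :* x)) t (x k))
                     (sym (*-distribˡ-sum (t * t) (λ k → x k * x k)))

      norm-nonNeg : ∀ (x : Point N) → 0# ≤ ‖ x ‖²
      norm-nonNeg x = sum-nonNeg λ k → square-nonNeg (x k)

      -- The new point lies on the line from `y` through `x`, slightly beyond `x`. This one
      -- construction supplies the nearby points for relative interiors and for the outer side of
      -- the boundary.
      extrapolate : ∀ {ε} → 0# < ε → ∀ (x y : Point N) → ∃[ δ ] 0# < δ × Near ε x (x ⊕ δ ⊛ (x ⊝ y))
      extrapolate 0<ε x y with small-multiple 0<ε (norm-nonNeg (x ⊝ y))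
      ... | δ , 0<δ , near = δ , 0<δ , <-respˡ (sym (begin
          ‖ x ⊝ (x ⊕ δ ⊛ (x ⊝ y)) ‖²      ≈⟨ ∙-cong difference difference ⟩
          ‖ (- δ) ⊛ (x ⊝ y) ‖²            ≈⟨ norm-⊛ (- δ) (x ⊝ y) ⟩
          - δ * - δ * ‖ x ⊝ y ‖²          ≈⟨ *-congʳ (solve 1 (λ d → :- d :* :- d := d :* d) δ) ⟩
          δ * δ * ‖ x ⊝ y ‖²              ∎)) near
        where
        difference : x ⊝ (x ⊕ δ ⊛ (x ⊝ y)) ≋ (- δ) ⊛ (x ⊝ y)
        difference k = solve 3 (λ x y d → x :- (x :+ d :* (x :- y)) := (:- d) :* (x :- y)) (x k) (y k) δ

      -- The segment from `y` can be prolonged a little beyond `x` inside `P`. There `u` takes the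
      -- value `β + δ * (β - u ∙ y)`, which the bound `β` permits only if `u ∙ y` is not smaller
      -- than `β`.
      relativeInterior-tight : ∀ {P : Region N} (u : Point N) β → (∀ y → y ∈ P → u ∙ y ≤ β) →
                               ∀ {x} → x ∈ relativeInterior P → u ∙ x ≈ β → ∀ {y} → y ∈ P → u ∙ y ≈ β
      relativeInterior-tight {N = N} {P = P} u β ≤β {x} (x∈P , ε , 0<ε , ball) ux≈β {y} y∈P =
          tight (extrapolate 0<ε x y)
        where
        tight : ∃[ δ ] 0# < δ × Near ε x (x ⊕ δ ⊛ (x ⊝ y)) → u ∙ y ≈ β
        tight (δ , 0<δ , near) = antisym (≤β y y∈P)
            (0≤s⇒x≤y (*-cancelˡ-nonNeg 0<δ (≤-respʳ-≈ δ-eq (x≤y⇒0≤y-x (≤β x⁺ (ball x⁺ x⁺∈aff near))))) refl)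
          where
          x⁺ : Point N
          x⁺ = x ⊕ δ ⊛ (x ⊝ y)
          weights : Vector Carrier 2
          weights = (1# + δ) ∷ (- δ) ∷ []
          points : Fin 2 → Point N
          points = x ∷ y ∷ []
          points∈P : ∀ k → points k ∈ P
          points∈P zero       = x∈P
          points∈P (suc zero) = y∈P
          Σweights≈1 : sum weights ≈ 1#
          Σweights≈1 = solve 1 (λ d → con (+ 1) :+ d :+ (:- d :+ con (+ 0)) := con (+ 1)) δ
          x⁺≋ : x⁺ ≋ lincomb weights points
          x⁺≋ k = solve 3 (λ x y d → x :+ d :* (x :- y) := (con (+ 1) :+ d) :* x :+ (:- d :* y :+ con (+ 0))) (x k)
              (y k) δ
          x⁺∈aff : x⁺ ∈ aff P
          x⁺∈aff = 2 , points , points∈P , weights , Σweights≈1 , x⁺≋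
          δ-eq : β - u ∙ x⁺ ≈ δ * (u ∙ y - β)
          δ-eq = begin
            β - u ∙ x⁺                 ≈⟨ +-congˡ (-‿cong (trans (∙-⊕ u x (δ ⊛ (x ⊝ y))) (+-cong ux≈β
                                            (trans (∙-⊛ u δ (x ⊝ y)) (*-congˡ (trans (∙-⊝ u x y) (+-congʳ ux≈β)))))))
                                                ⟩
            β - (β + δ * (β - u ∙ y))  ≈⟨ solve 3 (λ b d y → b :- (b :+ d :* (b :- y)) := d :* (y :- b)) β δ (u ∙ y) ⟩
            δ * (u ∙ y - β)            ∎

  -- Facets of parallelepipeds and their congruence.

  module Parallelepipeds where
    open OrderedFieldProperties
    open EuclideanProperties
    open SetoidReasoning setoid

    private variable
      m N : ℕ

    InUnitInterval : Vector Carrier m → Set ℓ₂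
    InUnitInterval t = ∀ k → 0# ≤ t k × t k ≤ 1#

    abstract

      ≐-trans : ∀ {a b c} {P : Point N → Set a} {Q : Point N → Set b} {R : Point N → Set c} → P ≐ Q → Q ≐ R → P ≐ R
      ≐-trans (P⊆Q , Q⊆P) (Q⊆R , R⊆Q) = (λ x∈P → Q⊆R (P⊆Q x∈P)) , (λ x∈R → Q⊆P (R⊆Q x∈R))

      ≐-sym : ∀ {a b} {P : Point N → Set a} {Q : Point N → Set b} → P ≐ Q → Q ≐ P
      ≐-sym (P⊆Q , Q⊆P) = Q⊆P , P⊆Q

      ∈-translate-box : ∀ (o : Point N) (p : Fin m → Point N) {x} t → InUnitInterval t → x ≋ o ⊕ lincomb t p
          → x ∈ translate o (box p)
      ∈-translate-box o p t bounds x≋ = lincomb t p , (t , bounds , λ k → refl) , x≋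

      coordinates : ∀ (o : Point N) (p : Fin m → Point N) {x} → x ∈ translate o (box p) →
                    Σ[ t ∈ Vector Carrier m ] InUnitInterval t × x ≋ o ⊕ lincomb t p
      coordinates o p (y , (t , bounds , y≋) , x≋) = t , bounds , λ k → trans (x≋ k) (+-congˡ (y≋ k))

      lincomb-remove : ∀ k (t : Vector Carrier (suc m)) (p : Fin (suc m) → Point N) →
                       lincomb t p ≋ t k ⊛ p k ⊕ lincomb (t ∘ punchIn k) (p ∘ punchIn k)
      lincomb-remove k t p i = sum-remove {i = k} (λ l → t l * p l i)

      insertAt-bounds : ∀ (t : Vector Carrier m) k {x} → InUnitInterval t → 0# ≤ x × x ≤ 1#
          → InUnitInterval (insertAt t k x)
      insertAt-bounds t zero    bounds x-bounds zero    = x-bounds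
      insertAt-bounds t zero    bounds x-bounds (suc l) = bounds l
      insertAt-bounds {m = suc m} t (suc k) bounds x-bounds zero    = bounds zero
      insertAt-bounds {m = suc m} t (suc k) bounds x-bounds (suc l) =
          insertAt-bounds (t ∘ suc) k (bounds ∘ suc) x-bounds l

      lincomb-insertAt : ∀ (t : Vector Carrier m) k x (p : Fin (suc m) → Point N) →
                         lincomb (insertAt t k x) p ≋ x ⊛ p k ⊕ lincomb t (p ∘ punchIn k)
      lincomb-insertAt t k x p i = trans (lincomb-remove k (insertAt t k x) p i)
        (+-cong (*-congʳ (reflexive (insertAt-lookup t k x)))
                (sum-cong-≋ λ l → *-congʳ (reflexive (insertAt-punchIn t k x l))))

      lincomb-⊕ : ∀ (s t : Vector Carrier m) (p : Fin m → Point N) → lincomb (s ⊕ t) p ≋ lincomb s p ⊕ lincomb t p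
      lincomb-⊕ s t p i = trans (sum-cong-≋ λ k → distribʳ (p k i) (s k) (t k))
          (∑-distrib-+ (λ k → s k * p k i) (λ k → t k * p k i))

      lincomb-⊝ : ∀ (s t : Vector Carrier m) (p : Fin m → Point N) → lincomb (s ⊝ t) p ≋ lincomb s p ⊝ lincomb t p
      lincomb-⊝ s t p i = trans (sum-cong-≋ λ k
          → solve 3 (λ s t p → (s :- t) :* p := s :* p :- t :* p) (s k) (t k) (p k i))
                            (sum-minus (λ k → s k * p k i) (λ k → t k * p k i))

      independent-unique : ∀ {p : Fin m → Point N} → LinearlyIndependent p → ∀ s t → lincomb s p ≋ lincomb t p → ∀ k
          → s k ≈ t k
      independent-unique {p = p} indep s t eq k =
        x-y≈0⇒x≈y (indep (s ⊝ t) (λ i → trans (lincomb-⊝ s t p i) (x≈y⇒x-y≈0 (eq i))) k)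

      -- A linear functional is maximal over the box at the corner o′ that picks the end of each edge on which it is
      -- larger; the edges are then reversed so that they all leave from o′.
      box-facet : ∀ (o : Point N) (p : Fin (suc m) → Point N) → LinearlyIndependent p →
                  ∀ {P G : Region N} → P ≐ translate o (box p) → IsFaceOfDimension m G P →
                  ∃[ k ] ∃[ o′ ] G ≐ translate o′ (box (p ∘ punchIn k))
      box-facet {N = N} {m = m} o p indep {P} {G} (P⊆ , ⊆P) face@((u , β , ≤β , G⊆ , ⊆G) , (g , g∈G , _)) =
          facet (corner-facet o′ d d-indep P G
        o′∈P o′+d∈P (λ x x∈P → let (t , bounds , x≋) = coordinates o p (P⊆ x∈P) in s t , s-nonNeg bounds , from-corner t x≋) face o′∈G)
        where
        End : Carrier → Carrier → Set (ℓ₁ ⊔ ℓ₂)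
        -- Both alternatives admit `w ≈ 0#`, where either end of the edge is maximal.
        End x w = (x ≈ 0# × w ≤ 0#) ⊎ (x ≈ 1# × 0# ≤ w)
        end : ∀ w → ∃[ x ] End x w
        end w with total w 0#
        ... | inj₁ w≤0 = 0# , inj₁ (refl , w≤0)
        ... | inj₂ 0≤w = 1# , inj₂ (refl , 0≤w)
        ε σ : Vector Carrier (suc m)
        ε k = proj₁ (end (u ∙ p k))
        -- This sign is 1 if `ε k` is 0 and -1 if `ε k` is 1, so that `σ k ⊛ p k` leads from the
        -- chosen end of an edge to the opposite one.
        σ k = 1# - (ε k + ε k)
        ε-end : ∀ k → End (ε k) (u ∙ p k)
        ε-end k = proj₂ (end (u ∙ p k))
        ε-bounds : InUnitInterval ε
        ε-bounds k with ε-end k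
        ... | inj₁ (ε≈0 , _) = ≤-reflexive (sym ε≈0) , ≤-respˡ-≈ (sym ε≈0) 0≤1
        ... | inj₂ (ε≈1 , _) = ≤-respʳ-≈ (sym ε≈1) 0≤1 , ≤-reflexive ε≈1
        σ² : ∀ k → σ k * σ k ≈ 1#
        σ² k with ε-end k
        ... | inj₁ (ε≈0 , _) = trans (*-cong σ≈ σ≈) (*-identityˡ 1#)
          where
          σ≈ : σ k ≈ 1#
          σ≈ = trans (+-congˡ (-‿cong (+-cong ε≈0 ε≈0)))
              (solve 0 (con (+ 1) :- (con (+ 0) :+ con (+ 0)) := con (+ 1)))
        ... | inj₂ (ε≈1 , _) = trans (*-cong σ≈ σ≈) (solve 0 (:- con (+ 1) :* :- con (+ 1) := con (+ 1)))
          where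
          σ≈ : σ k ≈ - 1#
          σ≈ = trans (+-congˡ (-‿cong (+-cong ε≈1 ε≈1)))
              (solve 0 (con (+ 1) :- (con (+ 1) :+ con (+ 1)) := :- con (+ 1)))
        o′ : Point N
        o′ = o ⊕ lincomb ε p
        d : Fin (suc m) → Point N
        d k = σ k ⊛ p k
        s : Vector Carrier (suc m) → Vector Carrier (suc m)
        -- The coordinate measured from the chosen end: `t k` at the end 0 and `1# - t k` at the end
        -- 1, hence nonnegative on the box.
        s t k = σ k * (t k - ε k)
        lincomb-d : ∀ t → lincomb t d ≋ lincomb (λ k → t k * σ k) p
        lincomb-d t i = sum-cong-≋ λ k → sym (*-assoc (t k) (σ k) (p k i))
        from-corner : ∀ t {x} → x ≋ o ⊕ lincomb t p → x ≋ o′ ⊕ lincomb (s t) d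
        from-corner t {x} x≋ i = begin
          x i                                                ≈⟨ x≋ i ⟩
          o i + lincomb t p i
              ≈⟨ solve 3 (λ o t e → o :+ t := o :+ e :+ (t :- e)) (o i) (lincomb t p i) (lincomb ε p i) ⟩
          o′ i + (lincomb t p i - lincomb ε p i)             ≈⟨ +-congˡ (lincomb-⊝ t ε p i) ⟨
          o′ i + lincomb (t ⊝ ε) p i
              ≈⟨ +-congˡ (sum-cong-≋ λ k → *-congʳ {x = p k i} (unflip k)) ⟨
          o′ i + lincomb (λ k → s t k * σ k) p i             ≈⟨ +-congˡ (lincomb-d (s t) i) ⟨
          o′ i + lincomb (s t) d i                           ∎
          where
          unflip : ∀ k → s t k * σ k ≈ t k - ε k
          unflip k = trans (solve 2 (λ a b → a :* b :* a := a :* a :* b) (σ k) (t k - ε k))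
              (trans (*-congʳ (σ² k)) (*-identityˡ _))
        to-origin : ∀ t {x} → x ≋ o′ ⊕ lincomb t d → x ≋ o ⊕ lincomb (ε ⊕ (λ k → t k * σ k)) p
        to-origin t {x} x≋ i = begin
          x i                                                      ≈⟨ x≋ i ⟩
          o i + lincomb ε p i + lincomb t d i                      ≈⟨ +-assoc _ _ _ ⟩
          o i + (lincomb ε p i + lincomb t d i)                    ≈⟨ +-congˡ (+-congˡ (lincomb-d t i)) ⟩
          o i + (lincomb ε p i + lincomb (λ k → t k * σ k) p i)    ≈⟨ +-congˡ (lincomb-⊕ ε (λ k → t k * σ k) p i) ⟨
          o i + lincomb (ε ⊕ (λ k → t k * σ k)) p i                ∎
        s-nonNeg : ∀ {t} → InUnitInterval t → ∀ k → 0# ≤ s t k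
        s-nonNeg {t} bounds k with ε-end k
        ... | inj₁ (ε≈0 , _) = ≤-respʳ-≈ (sym
            (trans (*-cong (+-congˡ (-‿cong (+-cong ε≈0 ε≈0))) (+-congˡ (-‿cong ε≈0)))
                (solve 1 (λ t → (con (+ 1) :- (con (+ 0) :+ con (+ 0))) :* (t :- con (+ 0)) := t) (t k))))
                    (proj₁ (bounds k))
        ... | inj₂ (ε≈1 , _) = ≤-respʳ-≈ (sym
            (trans (*-cong (+-congˡ (-‿cong (+-cong ε≈1 ε≈1))) (+-congˡ (-‿cong ε≈1)))
                (solve 1 (λ t → (con (+ 1) :- (con (+ 1) :+ con (+ 1))) :* (t :- con (+ 1)) := con (+ 1) :- t)
                    (t k)))) (x≤y⇒0≤y-x (proj₂ (bounds k)))
        d-indep : LinearlyIndependent d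
        d-indep t eq k = trans (sym (*-identityʳ (t k)))
            (trans (*-congˡ (sym (σ² k))) (trans (sym (*-assoc (t k) (σ k) (σ k)))
          (trans (*-congʳ (indep (λ k → t k * σ k) (λ i → trans (sym (lincomb-d t i)) (eq i)) k)) (zeroˡ (σ k)))))
        o′∈P : o′ ∈ P
        o′∈P = ⊆P (∈-translate-box o p ε ε-bounds (λ k → refl))
        o′+d∈P : ∀ k → o′ ⊕ d k ∈ P
        o′+d∈P k = ⊆P (∈-translate-box o p t bounds (to-origin (e k) (λ i → +-congˡ (sym (e-lincomb i)))))
          where
          t : Vector Carrier (suc m)
          t = ε ⊕ (λ l → e k l * σ l)
          e-lincomb : ∀ i → lincomb (e k) d i ≈ d k i
          e-lincomb i = e-∙ k (λ l → d l i)
          bounds : InUnitInterval t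
          bounds l with l ≟ᶠ k
          ... | no  _ = ≤-respʳ-≈ (sym keep) (proj₁ (ε-bounds l)) , ≤-respˡ-≈ (sym keep) (proj₂ (ε-bounds l))
            where
            keep : ε l + 0# * σ l ≈ ε l
            keep = trans (+-congˡ (zeroˡ (σ l))) (+-identityʳ (ε l))
          ... | yes _ = ≤-respʳ-≈ (sym other) (x≤y⇒0≤y-x (proj₂ (ε-bounds l)))
                      , ≤-respˡ-≈ (sym other) (0≤s⇒x≤y (proj₁ (ε-bounds l))
                          (solve 1 (λ e → con (+ 1) :- (con (+ 1) :- e) := e) (ε l)))
            where
            other : ε l + 1# * σ l ≈ 1# - ε l
            other = solve 1 (λ e → e :+ con (+ 1) :* (con (+ 1) :- (e :+ e)) := con (+ 1) :- e) (ε l)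
        value : ∀ t {x} → x ≋ o ⊕ lincomb t p → u ∙ x ≈ u ∙ o + sum (λ k → t k * (u ∙ p k))
        value t x≋ = trans (∙-congˡ u x≋) (trans (∙-⊕ u o (lincomb t p)) (+-congˡ (∙-lincomb u t p)))
        o′∈G : o′ ∈ G
        -- `G` is inhabited because its dimension comes with a point `g zero`. The value there is
        -- `β`, and replacing each of its box coordinates by `ε k` can only raise the value.
        o′∈G = ⊆G (o′∈P , antisym (≤β o′ o′∈P) (maximal (coordinates o p (P⊆ (proj₁ (G⊆ (g∈G zero)))))))
          where
          maximal : Σ[ t ∈ Vector Carrier (suc m) ] InUnitInterval t × g zero ≋ o ⊕ lincomb t p → β ≤ u ∙ o′
          maximal (t , bounds , g≋) = ≤-respˡ-≈ (trans (sym (value t g≋)) (proj₂ (G⊆ (g∈G zero))))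
              (≤-respʳ-≈ (sym (value ε (λ k → refl)))
            (+-mono-≤ ≤-refl (sum-mono-≤ better)))
            where
            better : ∀ k → t k * (u ∙ p k) ≤ ε k * (u ∙ p k)
            better k with ε-end k
            ... | inj₁ (ε≈0 , w≤0) = 0≤s⇒x≤y (*-nonNeg (proj₁ (bounds k)) (neg-nonNeg w≤0))
                    (trans (+-congʳ (*-congʳ ε≈0)) (solve 2 (λ t w → con (+ 0) :* w :- t :* w := t :* (:- w)) (t k)
                        (u ∙ p k)))
            ... | inj₂ (ε≈1 , 0≤w) = 0≤s⇒x≤y (*-nonNeg (x≤y⇒0≤y-x (proj₂ (bounds k))) 0≤w)
                    (trans (+-congʳ (*-congʳ ε≈1)) (solve 2
                        (λ t w → con (+ 1) :* w :- t :* w := (con (+ 1) :- t) :* w) (t k) (u ∙ p k)))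
        facet : ∃[ k ] G ≐ (λ x → x ∈ P × Σ[ t ∈ Vector Carrier (suc m) ] t k ≈ 0# × x ≋ o′ ⊕ lincomb t d) →
                ∃[ k ] ∃[ q ] G ≐ translate q (box (p ∘ punchIn k))
        facet (k , G⊆k , k⊆G) = k , q , forward , backward
          where
          q : Point N
          -- On the facet the coordinate `k` is frozen at `ε k`; this constant contribution is
          -- absorbed into the origin of the smaller box.
          q = o ⊕ ε k ⊛ p k
          forward : G ⊆ translate q (box (p ∘ punchIn k))
          forward {x} x∈G = onFace (G⊆k x∈G)
            where
            onFace : x ∈ P × Σ[ r ∈ Vector Carrier (suc m) ] r k ≈ 0# × x ≋ o′ ⊕ lincomb r d
                → x ∈ translate q (box (p ∘ punchIn k))
            onFace (x∈P , r , rk≈0 , x≋r) = inBox (coordinates o p (P⊆ x∈P))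
              where
              inBox : Σ[ t ∈ Vector Carrier (suc m) ] InUnitInterval t × x ≋ o ⊕ lincomb t p
                  → x ∈ translate q (box (p ∘ punchIn k))
              inBox (t , bounds , x≋) = ∈-translate-box q (p ∘ punchIn k) (t ∘ punchIn k) (bounds ∘ punchIn k) λ i
                  → begin
                x i                                                                ≈⟨ x≋ i ⟩
                o i + lincomb t p i
                    ≈⟨ +-congˡ (lincomb-remove k t p i) ⟩
                o i + (t k * p k i + lincomb (t ∘ punchIn k) (p ∘ punchIn k) i)    ≈⟨ +-assoc _ _ _ ⟨
                o i + t k * p k i + lincomb (t ∘ punchIn k) (p ∘ punchIn k) i
                    ≈⟨ +-congʳ (+-congˡ (*-congʳ tk≈)) ⟩
                q i + lincomb (t ∘ punchIn k) (p ∘ punchIn k) i                    ∎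
                where
                tk≈ : t k ≈ ε k
                -- The point is written in two ways, with coefficients `t` from the box and with
                -- coefficients from the corner, where the one at `k` is zero. Independence of `p`
                -- forces them to agree.
                tk≈ = trans (independent-unique {p = p} indep t (ε ⊕ (λ l → r l * σ l))
                              (λ i → +-cancelˡ-≈ (o i) (trans (sym (x≋ i)) (to-origin r x≋r i))) k)
                        (trans (+-congˡ (trans (*-congʳ rk≈0) (zeroˡ (σ k)))) (+-identityʳ (ε k)))
          backward : translate q (box (p ∘ punchIn k)) ⊆ G
          backward {x} x∈ = onFace (coordinates q (p ∘ punchIn k) x∈)
            where
            onFace : Σ[ t ∈ Vector Carrier m ] InUnitInterval t × x ≋ q ⊕ lincomb t (p ∘ punchIn k) → x ∈ G
            onFace (t , bounds , x≋) = k⊆G (⊆P (∈-translate-box o p t⁺ (insertAt-bounds t k bounds (ε-bounds k)) x≋⁺)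
                , s t⁺ , sk≈0 , from-corner t⁺ x≋⁺)
              where
              t⁺ : Vector Carrier (suc m)
              t⁺ = insertAt t k (ε k)
              x≋⁺ : x ≋ o ⊕ lincomb t⁺ p
              x≋⁺ i = trans (x≋ i) (trans (+-assoc _ _ _) (+-congˡ (sym (lincomb-insertAt t k (ε k) p i))))
              sk≈0 : s t⁺ k ≈ 0#
              sk≈0 = trans (*-congˡ (x≈y⇒x-y≈0 (reflexive (insertAt-lookup t k (ε k))))) (zeroʳ (σ k))

      translate-box-dimension : ∀ (o : Point N) (p : Fin m → Point N) → LinearlyIndependent p →
                                ∀ {P : Region N} → P ≐ translate o (box p) → HasDimension m P
      translate-box-dimension {m = m} o p indep {P} (P⊆ , ⊆P) = frame o p , frame∈P , frame-independent o p indep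
        , λ x∈P → let (t , _ , x≋) = coordinates o p (P⊆ x∈P) in frame-spans o p t x≋
        where
        frame∈P : ∀ k → frame o p k ∈ P
        frame∈P zero    = ⊆P (∈-translate-box o p (λ _ → 0#) (λ _ → ≤-refl , 0≤1)
          (λ i → sym (trans (+-congˡ (sum-zero λ k → zeroˡ (p k i))) (+-identityʳ (o i)))))
        frame∈P (suc k) = ⊆P (∈-translate-box o p (e k) e-bounds (λ i → +-congˡ (sym (e-∙ k (λ l → p l i)))))
          where
          e-bounds : InUnitInterval (e k)
          e-bounds l with l ≟ᶠ k
          ... | yes _ = 0≤1 , ≤-refl
          ... | no  _ = ≤-refl , 0≤1

      permute-isometry : ∀ (π : Permutation′ N) x y → ‖ (x ∘ (π ⟨$⟩ʳ_)) ⊝ (y ∘ (π ⟨$⟩ʳ_)) ‖² ≈ ‖ x ⊝ y ‖²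
      permute-isometry π x y = sym (sum-permute (λ k → (x k - y k) * (x k - y k)) π)

      e-permute : ∀ (π : Permutation′ N) a k → e a (π ⟨$⟩ʳ k) ≈ e (π ⟨$⟩ˡ a) k
      e-permute π a k with (π ⟨$⟩ʳ k) ≟ᶠ a | k ≟ᶠ (π ⟨$⟩ˡ a)
      ... | yes _     | yes _     = refl
      ... | no _      | no _      = refl
      ... | yes πk≡a  | no k≢πa   = contradiction (≡.trans (≡.sym (inverseˡ π)) (≡.cong (π ⟨$⟩ˡ_) πk≡a)) k≢πa
      ... | no πk≢a   | yes k≡πa  = contradiction (≡.trans (≡.cong (π ⟨$⟩ʳ_) k≡πa) (inverseʳ π)) πk≢a

      transpose-left : ∀ (k l : Fin m) → Components.transpose k l k ≡ l
      transpose-left k l rewrite dec-true (k ≟ᶠ k) ≡.refl = ≡.refl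

      -- Thus swapping the coordinates `s k` and `s l` of the space swaps the edges `ξ (s k)` and
      -- `ξ (s l)` of a box and fixes its other edges.
      transpose-natural : ∀ {s : Fin m → Fin N} → (∀ {k l} → s k ≡ s l → k ≡ l) →
                          ∀ k l r → Components.transpose (s k) (s l) (s r) ≡ s (Components.transpose k l r)
      transpose-natural {s = s} inj k l r with r ≟ᶠ k
      ... | yes ≡.refl rewrite dec-true (s k ≟ᶠ s k) ≡.refl = ≡.refl
      ... | no r≢k rewrite dec-false (s r ≟ᶠ s k) (λ h → r≢k (inj h)) with r ≟ᶠ l
      ...   | yes ≡.refl rewrite dec-true (s l ≟ᶠ s l) ≡.refl = ≡.refl
      ...   | no r≢l rewrite dec-false (s r ≟ᶠ s l) (λ h → r≢l (inj h)) = ≡.refl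

      -- A coordinate permutation is an isometry. If it swaps the edges `k` and `l`, it carries the
      -- edges remaining without `k` to those remaining without `l`, and a translation then matches
      -- the origins.
      box-facets-congruent : ∀ (p : Fin (suc m) → Point N) k l (π : Permutation′ N) →
        (∀ r → p r ∘ (π ⟨$⟩ʳ_) ≋ p (Components.transpose k l r)) →
        ∀ o o′ {P Q : Region N} → P ≐ translate o (box (p ∘ punchIn k)) → Q ≐ translate o′ (box (p ∘ punchIn l))
            → Congruent P Q
      box-facets-congruent {m = m} {N = N} p k l π p-π o o′ {P} {Q} (P⊆ , ⊆P) (Q⊆ , ⊆Q) = f , isometry , forward
          , backward
        where
        f : Point N → Point N
        f x = o′ ⊕ (x ⊝ o) ∘ (π ⟨$⟩ʳ_)
        isometry : ∀ x y → ‖ f x ⊝ f y ‖² ≈ ‖ x ⊝ y ‖²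
        isometry x y = trans (∙-cong cancel cancel) (permute-isometry π x y)
          where
          cancel : f x ⊝ f y ≋ (x ∘ (π ⟨$⟩ʳ_)) ⊝ (y ∘ (π ⟨$⟩ʳ_))
          cancel i = solve 4 (λ a b x y → (a :+ (x :- b)) :- (a :+ (y :- b)) := x :- y) (o′ i) (o (π ⟨$⟩ʳ i))
              (x (π ⟨$⟩ʳ i)) (y (π ⟨$⟩ʳ i))
        ρ : Permutation′ m
        -- The swap maps the indices other than `k` onto those other than `l`; `ρ` is this bijection
        -- after renumbering both sets.
        ρ = remove k (transpose k l)
        p-ρ : ∀ r → p (punchIn k r) ∘ (π ⟨$⟩ʳ_) ≋ p (punchIn l (ρ ⟨$⟩ʳ r))
        p-ρ r i = trans (p-π (punchIn k r) i) (reflexive (≡.cong (λ q → p q i)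
          (≡.trans (punchIn-permute (transpose k l) k r) (≡.cong (λ q → punchIn q (ρ ⟨$⟩ʳ r)) (transpose-left k l)))))
        f-lincomb : ∀ t {x} → x ≋ o ⊕ lincomb t (p ∘ punchIn k) → f x ≋ o′ ⊕ lincomb (t ∘ (ρ ⟨$⟩ˡ_)) (p ∘ punchIn l)
        f-lincomb t {x} x≋ i = begin
          o′ i + (x (π ⟨$⟩ʳ i) - o (π ⟨$⟩ʳ i))
              ≈⟨ +-congˡ (+-congʳ (x≋ (π ⟨$⟩ʳ i))) ⟩
          o′ i + (o (π ⟨$⟩ʳ i) + lincomb t (p ∘ punchIn k) (π ⟨$⟩ʳ i) - o (π ⟨$⟩ʳ i))
              ≈⟨ +-congˡ (solve 2 (λ a b → a :+ b :- a := b) _ _) ⟩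
          o′ i + lincomb t (p ∘ punchIn k) (π ⟨$⟩ʳ i)
              ≈⟨ +-congˡ (sum-cong-≋ λ r → *-cong (reflexive (≡.cong t (≡.sym (inverseˡ ρ)))) (p-ρ r i)) ⟩
          o′ i + sum (λ r → t (ρ ⟨$⟩ˡ (ρ ⟨$⟩ʳ r)) * p (punchIn l (ρ ⟨$⟩ʳ r)) i)
              ≈⟨ +-congˡ (sum-permute (λ r → t (ρ ⟨$⟩ˡ r) * p (punchIn l r) i) ρ) ⟨
          o′ i + lincomb (t ∘ (ρ ⟨$⟩ˡ_)) (p ∘ punchIn l) i                            ∎
        forward : map f P ⊆ Q
        forward {y} (x , x∈P , y≋) = let (t , bounds , x≋) = coordinates o (p ∘ punchIn k) (P⊆ x∈P) in
          ⊆Q (∈-translate-box o′ (p ∘ punchIn l) (t ∘ (ρ ⟨$⟩ˡ_)) (λ r → bounds (ρ ⟨$⟩ˡ r))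
              (λ i → trans (y≋ i) (f-lincomb t x≋ i)))
        backward : Q ⊆ map f P
        backward {y} y∈Q = let (t , bounds , y≋) = coordinates o′ (p ∘ punchIn l) (Q⊆ y∈Q) in
          o ⊕ lincomb (t ∘ (ρ ⟨$⟩ʳ_)) (p ∘ punchIn k) ,
          ⊆P (∈-translate-box o (p ∘ punchIn k) (t ∘ (ρ ⟨$⟩ʳ_)) (λ r → bounds (ρ ⟨$⟩ʳ r)) (λ i → refl)) ,
          λ i → trans (y≋ i) (sym (trans (f-lincomb (t ∘ (ρ ⟨$⟩ʳ_)) (λ i → refl) i)
            (+-congˡ (sum-cong-≋ λ r → *-congʳ {x = p (punchIn l r) i} (reflexive (≡.cong t (inverseʳ ρ {r})))))))

  -- The Voronoi cell described by coordinate differences.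

  module VoronoiFacets (n : ℕ) where
    open RootLattice F n
    open OrderedFieldProperties
    open EuclideanProperties
    open Parallelepipeds
    open SetoidReasoning setoid

    private variable
      m : ℕ
      i j k l : Fin (suc n)
      x y : Point (suc n)

    Facet : Fin (suc n) → Fin (suc n) → Pred (Point (suc n)) (ℓ₁ ⊔ ℓ₂)
    Facet i j x = x ∈ H × x i - x j ≈ 1# × (∀ k → x j ≤ x k × x k ≤ x i)

    SpreadAtMostOne : Pred (Point (suc n)) (ℓ₁ ⊔ ℓ₂)
    SpreadAtMostOne x = x ∈ H × (∀ i j → x i - x j ≤ 1#)

    abstract

      e-bounds : ∀ (i k : Fin m) → 0# ≤ e i k × e i k ≤ 1#
      e-bounds i k with k ≟ᶠ i
      ... | yes _ = 0≤1 , ≤-refl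
      ... | no  _ = ≤-refl , 0≤1

      H⇒sum≈0 : ∀ x → x ∈ H → sum x ≈ 0#
      H⇒sum≈0 x x∈H = trans (sum-cong-≋ λ k → sym (*-identityʳ (x k))) x∈H

      sum≈0⇒H : ∀ x → sum x ≈ 0# → x ∈ H
      sum≈0⇒H x Σx≈0 = trans (sum-cong-≋ λ k → *-identityʳ (x k)) Σx≈0

      H-cong : ∀ x y → x ≋ y → x ∈ H → y ∈ H
      H-cong x y x≋y x∈H = trans (sum-cong-≋ λ k → *-congʳ {x = 1#} (sym (x≋y k))) x∈H

      H-⊕ : ∀ x y → x ∈ H → y ∈ H → x ⊕ y ∈ H
      H-⊕ x y x∈H y∈H = sum≈0⇒H (x ⊕ y) (trans (∑-distrib-+ x y)
          (trans (+-cong (H⇒sum≈0 x x∈H) (H⇒sum≈0 y y∈H)) (+-identityˡ 0#)))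

      H-⊛ : ∀ t x → x ∈ H → t ⊛ x ∈ H
      H-⊛ t x x∈H = sum≈0⇒H (t ⊛ x) (trans (sym (*-distribˡ-sum t x)) (trans (*-congˡ (H⇒sum≈0 x x∈H)) (zeroʳ t)))

      H-⊖ : ∀ x → x ∈ H → ⊖ x ∈ H
      H-⊖ x x∈H = H-cong (- 1# ⊛ x) (⊖ x) (λ k → solve 1 (λ x → :- con (+ 1) :* x := :- x) (x k)) (H-⊛ (- 1#) x x∈H)

      H-lincomb : ∀ (t : Vector Carrier m) (p : Fin m → Point (suc n)) → (∀ k → p k ∈ H) → lincomb t p ∈ H
      H-lincomb t p p∈H = trans (∙-comm (lincomb t p) 𝟏) (trans (∙-lincomb 𝟏 t p)
        (sum-zero λ k → trans (*-congˡ (trans (∙-comm 𝟏 (p k)) (p∈H k))) (zeroʳ (t k))))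

      H-permute : ∀ (π : Permutation′ (suc n)) x → x ∈ H → x ∘ (π ⟨$⟩ʳ_) ∈ H
      H-permute π x x∈H = sum≈0⇒H (x ∘ (π ⟨$⟩ʳ_)) (trans (sym (sum-permute x π)) (H⇒sum≈0 x x∈H))

      -- Summing the hypothesis over all `k`, the coordinate sums of `x` and `y` drop out and
      -- `fromNat (suc n) * (x l - y l)` remains.
      H-dominated : ∀ x y l → x ∈ H → y ∈ H → (∀ k → x k - x l ≤ y k - y l) → y l ≤ x l
      H-dominated x y l x∈H y∈H h = 0≤s⇒x≤y (*-cancelˡ-nonNeg (fromNat-pos n) (≤-respʳ-≈ (begin
        sum (λ k → (y k - y l) - (x k - x l))
            ≈⟨ (sum-cong-≋ λ k → solve 4 (λ a b c d → (a :- b) :- (c :- d) := (a :- c) :+ (d :- b)) (y k) (y l) (x k)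
            (x l)) ⟩
        sum (λ k → (y k - x k) + (x l - y l))      ≈⟨ ∑-distrib-+ (λ k → y k - x k) (λ _ → x l - y l) ⟩
        sum (λ k → y k - x k) + sum {suc n} (λ _ → x l - y l)
            ≈⟨ +-cong (trans (sum-minus y x) (x≈y⇒x-y≈0 (trans (H⇒sum≈0 y y∈H) (sym (H⇒sum≈0 x x∈H)))))
            (sum-const (suc n) (x l - y l)) ⟩
        0# + fromNat (suc n) * (x l - y l)         ≈⟨ +-identityˡ _ ⟩
        fromNat (suc n) * (x l - y l)              ∎) (sum-nonNeg λ k → x≤y⇒0≤y-x (h k)))) refl

      -- Equal differences determine a point up to a multiple of `𝟏`, and `H` excludes nonzero
      -- multiples. Equations between points are therefore checked on differences, where each `ξ i`
      -- acts as `e i`.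
      H-ext : ∀ x y l → x ∈ H → y ∈ H → (∀ k → x k - x l ≈ y k - y l) → x ≋ y
      H-ext x y l x∈H y∈H h k = begin
        x k                ≈⟨ solve 2 (λ a b → a := (a :- b) :+ b) (x k) (x l) ⟩
        x k - x l + x l    ≈⟨ +-cong (h k) (antisym (H-dominated y x l y∈H x∈H (λ k → ≤-reflexive (sym (h k))))
            (H-dominated x y l x∈H y∈H (λ k → ≤-reflexive (h k)))) ⟩
        y k - y l + y l    ≈⟨ solve 2 (λ a b → (a :- b) :+ b := a) (y k) (y l) ⟩
        y k                ∎

      -- Once `x l` and `y l` agree, the nonnegative gaps in the hypothesis have sum zero and vanish
      -- one by one. This gives the uniqueness needed for a vertex.
      H-dominated-tight : ∀ x y l → x ∈ H → y ∈ H → (∀ k → x k - x l ≤ y k - y l) → x l ≈ y l → x ≋ y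
      H-dominated-tight x y l x∈H y∈H h xl≈yl = H-ext x y l x∈H y∈H λ k
          → sym (x-y≈0⇒x≈y (sum-nonNeg-zero (λ k → x≤y⇒0≤y-x (h k)) total≈0 k))
        where
        total≈0 : sum (λ k → (y k - y l) - (x k - x l)) ≈ 0#
        total≈0 = begin
          sum (λ k → (y k - y l) - (x k - x l))
              ≈⟨ (sum-cong-≋ λ k → trans (+-congʳ (+-congˡ {x = y k} (-‿cong (sym xl≈yl))))
              (solve 3 (λ a b c → (a :- b) :- (c :- b) := a :- c) (y k) (x l) (x k))) ⟩
          sum (λ k → y k - x k)                   ≈⟨ sum-minus y x ⟩
          sum y - sum x                           ≈⟨ x≈y⇒x-y≈0 (trans (H⇒sum≈0 y y∈H) (sym (H⇒sum≈0 x x∈H))) ⟩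
          0#                                      ∎

      sum-e : ∀ (i : Fin m) → sum (e i) ≈ 1#
      sum-e i = trans (sum-single i (λ k → e-off)) (e-diag {k = i} ≡.refl)

      ξ∈H : ∀ i → ξ i ∈ H
      ξ∈H i = sum≈0⇒H (ξ i) (begin
        sum (λ k → e i k - fromNat (suc n) ⁻¹ * 1#)
            ≈⟨ sum-minus (e i) (λ _ → fromNat (suc n) ⁻¹ * 1#) ⟩
        sum (e i) - sum {suc n} (λ _ → fromNat (suc n) ⁻¹ * 1#)
            ≈⟨ +-cong (sum-e i) (-‿cong (sum-const (suc n) _)) ⟩
        1# - fromNat (suc n) * (fromNat (suc n) ⁻¹ * 1#)
            ≈⟨ +-congˡ (-‿cong (trans (*-congˡ (*-identityʳ _)) (⁻¹-inverse _ (fromNat≉0 n)))) ⟩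
        1# - 1#                                                        ≈⟨ -‿inverseʳ 1# ⟩
        0#                                                             ∎)

      ξ-difference : ∀ i k l → ξ i k - ξ i l ≈ e i k - e i l
      ξ-difference i k l = solve 3 (λ a b r → (a :- r) :- (b :- r) := a :- b) (e i k) (e i l)
          (fromNat (suc n) ⁻¹ * 1#)

      lincomb-ξ-difference : ∀ (t : Vector Carrier m) (s : Fin m → Fin (suc n)) k l →
        lincomb t (ξ ∘ s) k - lincomb t (ξ ∘ s) l ≈ lincomb t (e ∘ s) k - lincomb t (e ∘ s) l
      lincomb-ξ-difference t s k l = begin
        lincomb t (ξ ∘ s) k - lincomb t (ξ ∘ s) l
            ≈⟨ sum-minus (λ r → t r * ξ (s r) k) (λ r → t r * ξ (s r) l) ⟨
        sum (λ r → t r * ξ (s r) k - t r * ξ (s r) l)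
            ≈⟨ (sum-cong-≋ λ r → solve 4 (λ t a b c → t :* (a :- c) :- t :* (b :- c) := t :* a :- t :* b) (t r)
            (e (s r) k) (e (s r) l) (fromNat (suc n) ⁻¹ * 1#)) ⟩
        sum (λ r → t r * e (s r) k - t r * e (s r) l)
            ≈⟨ sum-minus (λ r → t r * e (s r) k) (λ r → t r * e (s r) l) ⟩
        lincomb t (e ∘ s) k - lincomb t (e ∘ s) l                    ∎

      lincomb-e-hit : ∀ (t : Vector Carrier m) (s : Fin m → Fin (suc n)) → (∀ {q r} → s q ≡ s r → q ≡ r) → ∀ r
          → lincomb t (e ∘ s) (s r) ≈ t r
      lincomb-e-hit t s inj r = trans (sum-single r
          (λ q q≢r → trans (*-congˡ (e-off {k = s r} (λ h → q≢r (≡.sym (inj h))))) (zeroʳ (t q))))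
        (trans (*-congˡ (e-diag {k = s r} ≡.refl)) (*-identityʳ (t r)))

      lincomb-e-miss : ∀ (t : Vector Carrier m) (s : Fin m → Fin (suc n)) → (∀ r → s r ≢ k) → lincomb t (e ∘ s) k ≈ 0#
      lincomb-e-miss {k = k} t s miss = sum-zero λ r
          → trans (*-congˡ (e-off {k = k} (λ h → miss r (≡.sym h)))) (zeroʳ (t r))

      -- All the `ξ` together sum to zero, so an index `k` outside the family is required. It serves
      -- as reference: the coordinates at `s r` and at `k` differ exactly by `t r`.
      ξ-independent : ∀ (s : Fin m → Fin (suc n)) → (∀ {q r} → s q ≡ s r → q ≡ r) → (∀ r → s r ≢ k)
          → LinearlyIndependent (ξ ∘ s)
      ξ-independent {k = k} s inj miss t eq r = begin
        t r                                              ≈⟨ solve 1 (λ t → t := t :- con (+ 0)) (t r) ⟩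
        t r - 0#
            ≈⟨ +-cong (lincomb-e-hit t s inj r) (-‿cong (lincomb-e-miss t s miss)) ⟨
        lincomb t (e ∘ s) (s r) - lincomb t (e ∘ s) k    ≈⟨ lincomb-ξ-difference t s (s r) k ⟨
        lincomb t (ξ ∘ s) (s r) - lincomb t (ξ ∘ s) k    ≈⟨ x≈y⇒x-y≈0 (trans (eq (s r)) (sym (eq k))) ⟩
        0#                                               ∎

      Facet-cong : ∀ i j x y → x ≋ y → x ∈ Facet i j → y ∈ Facet i j
      Facet-cong i j x y x≋y (x∈H , gap , bounds) = H-cong x y x≋y x∈H
          , trans (+-cong (sym (x≋y i)) (-‿cong (sym (x≋y j)))) gap
        , λ k → ≤-respˡ-≈ (x≋y j) (≤-respʳ-≈ (x≋y k) (proj₁ (bounds k)))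
            , ≤-respˡ-≈ (x≋y k) (≤-respʳ-≈ (x≋y i) (proj₂ (bounds k)))

      ξ∈Facet : i ≢ j → ξ i ∈ Facet i j
      ξ∈Facet {i} {j} i≢j = ξ∈H i
        , trans (ξ-difference i i j) (trans (+-cong (e-diag {k = i} ≡.refl) (-‿cong (e-off (λ h → i≢j (≡.sym h)))))
            (solve 0 (con (+ 1) :- con (+ 0) := con (+ 1))))
        , λ k → 0≤s⇒x≤y (proj₁ (e-bounds i k))
            (trans (ξ-difference i k j) (trans (+-congˡ (-‿cong (e-off (λ h → i≢j (≡.sym h)))))
            (solve 1 (λ a → a :- con (+ 0) := a) (e i k))))
              , 0≤s⇒x≤y (x≤y⇒0≤y-x (proj₂ (e-bounds i k)))
                  (trans (ξ-difference i i k) (+-congʳ (e-diag {k = i} ≡.refl)))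

      ⊖ξ-difference : ∀ j k l → (⊖ ξ j) k - (⊖ ξ j) l ≈ e j l - e j k
      ⊖ξ-difference j k l = trans (solve 2 (λ a b → (:- a) :- (:- b) := b :- a) (ξ j k) (ξ j l)) (ξ-difference j l k)

      ⊖ξ∈Facet : i ≢ j → ⊖ ξ j ∈ Facet i j
      ⊖ξ∈Facet {i} {j} i≢j = H-⊖ (ξ j) (ξ∈H j)
        , trans (⊖ξ-difference j i j) (trans (+-cong (e-diag {k = j} ≡.refl) (-‿cong (e-off i≢j)))
            (solve 0 (con (+ 1) :- con (+ 0) := con (+ 1))))
        , λ k → 0≤s⇒x≤y (x≤y⇒0≤y-x (proj₂ (e-bounds j k)))
            (trans (⊖ξ-difference j k j) (+-congʳ (e-diag {k = j} ≡.refl)))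
              , 0≤s⇒x≤y (proj₁ (e-bounds j k)) (trans (⊖ξ-difference j i k)
                  (trans (+-congˡ (-‿cong (e-off i≢j))) (solve 1 (λ a → a :- con (+ 0) := a) (e j k))))

      -- For any other `k` the difference is `- e i l`, which is not positive. Together with its
      -- mirror image `unit-gap-⊖ξ` this reads `i` and `j` off the points `ξ i` and `⊖ ξ j` of a
      -- facet.
      unit-gap-ξ : ξ i k - ξ i l ≈ 1# → k ≡ i
      unit-gap-ξ {i} {k} {l} gap = decidable-stable (k ≟ᶠ i) λ k≢i → 0<1 (0≤s⇒x≤y (proj₁ (e-bounds i l)) (begin
        0# - 1#                        ≈⟨ +-congˡ
            (-‿cong (trans (sym gap) (trans (ξ-difference i k l) (+-congʳ (e-off k≢i))))) ⟩
        0# - (0# - e i l)              ≈⟨ solve 1 (λ a → con (+ 0) :- (con (+ 0) :- a) := a) (e i l) ⟩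
        e i l                          ∎))

      unit-gap-⊖ξ : (⊖ ξ j) k - (⊖ ξ j) l ≈ 1# → l ≡ j
      unit-gap-⊖ξ {j} {k} {l} gap = unit-gap-ξ {j} {l} {k}
          (trans (ξ-difference j l k) (trans (sym (⊖ξ-difference j k l)) gap))

      Facet⊆Spread : ∀ i j → Facet i j ⊆ SpreadAtMostOne
      Facet⊆Spread i j {x} (x∈H , gap , bounds) = x∈H , λ k l
          → ≤-respʳ-≈ gap (+-mono-≤ (proj₂ (bounds k)) (neg-antimono-≤ (proj₁ (bounds l))))

      Spread∩gap⊆Facet : ∀ i j x → x ∈ SpreadAtMostOne → x i - x j ≈ 1# → x ∈ Facet i j
      Spread∩gap⊆Facet i j x (x∈H , spread) gap = x∈H , gap
        , λ k → 0≤s⇒x≤y (x≤y⇒0≤y-x (spread i k))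
            (trans (solve 3 (λ k j i → k :- j := (i :- j) :- (i :- k)) (x k) (x j) (x i)) (+-congʳ gap))
              , 0≤s⇒x≤y (x≤y⇒0≤y-x (spread k j)) (trans
                  (solve 3 (λ k j i → i :- k := (i :- j) :- (k :- j)) (x k) (x j) (x i)) (+-congʳ gap))

      if-∨ : ∀ {a} {A : Set a} {u w : A} (k i j : Fin m)
          → ((k ≡ i ⊎ k ≡ j) × (if does (k ≟ᶠ i) ∨ does (k ≟ᶠ j) then u else w) ≡ u)
                                                       ⊎ (k ≢ i × k ≢ j × (if does (k ≟ᶠ i) ∨ does (k ≟ᶠ j) then u
                                                           else w) ≡ w)
      if-∨ k i j with k ≟ᶠ i
      ... | yes k≡i = inj₁ (inj₁ k≡i , ≡.refl)
      ... | no  k≢i with k ≟ᶠ j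
      ...   | yes k≡j = inj₁ (inj₂ k≡j , ≡.refl)
      ...   | no  k≢j = inj₂ (k≢i , k≢j , ≡.refl)

      -- The masking of two summands is moved into the coefficients, so that ordinary linear
      -- combinations of all the `ξ` can be used.
      ◇⇒lincomb : ∀ i j → x ∈ ◇ i j → Σ[ t ∈ Vector Carrier (suc n) ] InUnitInterval t × t i ≈ 0# × t j ≈ 0#
          × x ≋ lincomb t ξ
      ◇⇒lincomb {x} i j (t , bounds , x≋) = s , s-bounds , s-zero i (inj₁ ≡.refl) , s-zero j (inj₂ ≡.refl)
        , λ l → trans (x≋ l) (sum-cong-≋ λ k → masked k l)
        where
        s : Vector Carrier (suc n)
        s k = if does (k ≟ᶠ i) ∨ does (k ≟ᶠ j) then 0# else t k
        s-bounds : InUnitInterval s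
        s-bounds k with if-∨ {u = 0#} {w = t k} k i j
        ... | inj₁ (_ , eq)     rewrite eq = ≤-refl , 0≤1
        ... | inj₂ (_ , _ , eq) rewrite eq = bounds k
        s-zero : ∀ k → k ≡ i ⊎ k ≡ j → s k ≈ 0#
        s-zero k h with if-∨ {u = 0#} {w = t k} k i j
        ... | inj₁ (_ , eq) = reflexive eq
        ... | inj₂ (k≢i , k≢j , _) = contradiction h [ k≢i , k≢j ]′
        masked : ∀ k l → (if does (k ≟ᶠ i) ∨ does (k ≟ᶠ j) then 𝟎 else t k ⊛ ξ k) l ≈ s k * ξ k l
        masked k l with does (k ≟ᶠ i) ∨ does (k ≟ᶠ j)
        ... | true  = sym (zeroˡ (ξ k l))
        ... | false = refl

      lincomb⇒◇ : ∀ i j t → InUnitInterval t → t i ≈ 0# → t j ≈ 0# → x ≋ lincomb t ξ → x ∈ ◇ i j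
      lincomb⇒◇ {x} i j t bounds ti≈0 tj≈0 x≋ = t , bounds , λ l → trans (x≋ l) (sum-cong-≋ λ k → masked k l)
        where
        masked : ∀ k l → t k * ξ k l ≈ (if does (k ≟ᶠ i) ∨ does (k ≟ᶠ j) then 𝟎 else t k ⊛ ξ k) l
        masked k l with if-∨ {u = 𝟎} {w = t k ⊛ ξ k} k i j
        ... | inj₂ (_ , _ , eq)         rewrite eq = refl
        ... | inj₁ (inj₁ ≡.refl , eq) rewrite eq = trans (*-congʳ ti≈0) (zeroˡ (ξ k l))
        ... | inj₁ (inj₂ ≡.refl , eq) rewrite eq = trans (*-congʳ tj≈0) (zeroˡ (ξ k l))

      lincomb-e : ∀ (t : Vector Carrier (suc n)) k → lincomb t e k ≈ t k
      lincomb-e t k = lincomb-e-hit t id id k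

      -- In `ξ i ⊕ lincomb t ξ` with `t i` and `t j` zero, the coordinate `k` lies `e i k + t k`
      -- above the coordinate `j`. At `i` this is the unit gap; elsewhere the bounds on `t k` say
      -- that the coordinate lies between those at `j` and `i`.
      ξ+◇≐Facet : i ≢ j → ξ+◇ i j ≐ Facet i j
      ξ+◇≐Facet {i} {j} i≢j = forward , backward
        where
        difference : ∀ t k → (ξ i ⊕ lincomb t ξ) k - (ξ i ⊕ lincomb t ξ) j ≈ (e i k + t k) - (e i j + t j)
        difference t k = begin
          (ξ i ⊕ lincomb t ξ) k - (ξ i ⊕ lincomb t ξ) j
              ≈⟨ solve 4 (λ a b c d → (a :+ b) :- (c :+ d) := (a :- c) :+ (b :- d)) (ξ i k) (lincomb t ξ k) (ξ i j)
              (lincomb t ξ j) ⟩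
          (ξ i k - ξ i j) + (lincomb t ξ k - lincomb t ξ j)
              ≈⟨ +-cong (ξ-difference i k j) (trans (lincomb-ξ-difference t id k j)
              (+-cong (lincomb-e t k) (-‿cong (lincomb-e t j)))) ⟩
          (e i k - e i j) + (t k - t j)
              ≈⟨ solve 4 (λ a b c d → (a :- c) :+ (b :- d) := (a :+ b) :- (c :+ d)) (e i k) (t k) (e i j) (t j) ⟩
          (e i k + t k) - (e i j + t j)                                ∎
        inH : ∀ t → ξ i ⊕ lincomb t ξ ∈ H
        inH t = H-⊕ (ξ i) (lincomb t ξ) (ξ∈H i) (H-lincomb t ξ ξ∈H)
        height : ∀ {t} → t j ≈ 0# → ∀ k → (ξ i ⊕ lincomb t ξ) k - (ξ i ⊕ lincomb t ξ) j ≈ e i k + t k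
        height {t} tj≈0 k = trans (difference t k)
            (trans (+-congˡ (-‿cong (trans (+-cong (e-off (λ h → i≢j (≡.sym h))) tj≈0) (+-identityˡ 0#))))
          (solve 1 (λ a → a :- con (+ 0) := a) (e i k + t k)))
        forward : ξ+◇ i j ⊆ Facet i j
        forward {x} (y , y∈◇ , x≋) = from (◇⇒lincomb i j y∈◇)
          where
          from : Σ[ t ∈ Vector Carrier (suc n) ] InUnitInterval t × t i ≈ 0# × t j ≈ 0# × y ≋ lincomb t ξ
              → x ∈ Facet i j
          from (t , bounds , ti≈0 , tj≈0 , y≋) = Facet-cong i j z x (λ k → sym (trans (x≋ k) (+-congˡ (y≋ k))))
            (inH t , top , λ k → 0≤s⇒x≤y (+-nonNeg (proj₁ (e-bounds i k)) (proj₁ (bounds k))) (height tj≈0 k)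
              , 0≤s⇒x≤y (below-top k) (trans (solve 3 (λ a b c → a :- b := (a :- c) :- (b :- c)) (z i) (z k) (z j))
                  (+-cong top (-‿cong (height tj≈0 k)))))
            where
            z : Point (suc n)
            z = ξ i ⊕ lincomb t ξ
            top : z i - z j ≈ 1#
            top = trans (height tj≈0 i) (trans (+-cong (e-diag {k = i} ≡.refl) ti≈0) (+-identityʳ 1#))
            below-top : ∀ k → 0# ≤ 1# - (e i k + t k)
            below-top k with k ≟ᶠ i
            ... | yes ≡.refl = ≤-reflexive (sym (trans (+-congˡ (-‿cong (+-congˡ ti≈0)))
                (solve 0 (con (+ 1) :- (con (+ 1) :+ con (+ 0)) := con (+ 0)))))
            ... | no _       = ≤-respʳ-≈ (solve 1 (λ t → con (+ 1) :- t := con (+ 1) :- (con (+ 0) :+ t)) (t k))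
                (x≤y⇒0≤y-x (proj₂ (bounds k)))
        backward : Facet i j ⊆ ξ+◇ i j
        backward {x} (x∈H , gap , bounds) = lincomb t ξ
          , lincomb⇒◇ i j t t-bounds ti≈0 tj≈0 (λ l → refl)
          , H-ext x (ξ i ⊕ lincomb t ξ) j x∈H (inH t) (λ k → trans (x-height k) (sym (height tj≈0 k)))
          where
          t : Vector Carrier (suc n)
          -- The height formula solved for the coefficient.
          t k = (x k - x j) - e i k
          ti≈0 : t i ≈ 0#
          ti≈0 = x≈y⇒x-y≈0 (trans gap (sym (e-diag {k = i} ≡.refl)))
          tj≈0 : t j ≈ 0#
          tj≈0 = trans (+-cong (-‿inverseʳ (x j)) (-‿cong (e-off (λ h → i≢j (≡.sym h)))))
              (solve 0 (con (+ 0) :- con (+ 0) := con (+ 0)))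
          x-height : ∀ k → x k - x j ≈ e i k + t k
          x-height k = solve 2 (λ a b → a := b :+ (a :- b)) (x k - x j) (e i k)
          t-bounds : InUnitInterval t
          t-bounds k with k ≟ᶠ i
          ... | yes ≡.refl = ≤-reflexive (sym (x≈y⇒x-y≈0 gap)) , ≤-respˡ-≈ (sym (x≈y⇒x-y≈0 gap)) 0≤1
          ... | no _       = ≤-respʳ-≈ (solve 1 (λ a → a := a :- con (+ 0)) (x k - x j))
              (x≤y⇒0≤y-x (proj₁ (bounds k)))
                           , ≤-respˡ-≈ (solve 1 (λ a → a := a :- con (+ 0)) (x k - x j))
                               (≤-respʳ-≈ gap (+-mono-≤ (proj₂ (bounds k)) ≤-refl))

      norm-⊝ : ∀ (x q : Point m) → ‖ x ⊝ q ‖² - ‖ x ‖² ≈ ‖ q ‖² - (x ∙ q + x ∙ q)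
      norm-⊝ x q = begin
        ‖ x ⊝ q ‖² - ‖ x ‖²
            ≈⟨ sum-minus (λ k → (x k - q k) * (x k - q k)) (λ k → x k * x k) ⟨
        sum (λ k → (x k - q k) * (x k - q k) - x k * x k)
            ≈⟨ (sum-cong-≋ λ k → solve 2 (λ x q → (x :- q) :* (x :- q) :- x :* x := q :* q :- (x :* q :+ x :* q))
            (x k) (q k)) ⟩
        sum (λ k → q k * q k - (x k * q k + x k * q k))
            ≈⟨ sum-minus (λ k → q k * q k) (λ k → x k * q k + x k * q k) ⟩
        ‖ q ‖² - sum (λ k → x k * q k + x k * q k)
            ≈⟨ +-congˡ (-‿cong (∑-distrib-+ (λ k → x k * q k) (λ k → x k * q k))) ⟩
        ‖ q ‖² - (x ∙ q + x ∙ q)                           ∎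

      root-∙ : ∀ i j (x : Point m) → (e i ⊝ e j) ∙ x ≈ x i - x j
      root-∙ i j x = trans (∙-comm (e i ⊝ e j) x)
          (trans (∙-⊝ x (e i) (e j)) (+-cong (trans (∙-comm x (e i)) (e-∙ i x))
          (-‿cong (trans (∙-comm x (e j)) (e-∙ j x)))))

      root-norm : i ≢ j → ‖ e i ⊝ e j ‖² ≈ 1# + 1#
      root-norm {i} {j} i≢j = trans (root-∙ i j (e i ⊝ e j))
        (trans (+-cong (+-cong (e-diag {k = i} ≡.refl) (-‿cong (e-off i≢j)))
            (-‿cong (+-cong (e-off (λ h → i≢j (≡.sym h))) (-‿cong (e-diag {k = j} ≡.refl)))))
          (solve 0 ((con (+ 1) :- con (+ 0)) :- (con (+ 0) :- con (+ 1)) := con (+ 1) :+ con (+ 1))))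

      root∈A : ∀ i j → e i ⊝ e j ∈ A
      root∈A i j = trans (root-∙ i j 𝟏) (-‿inverseʳ 1#) , (λ k → proj₁ (integral k)) , λ k → proj₂ (integral k)
        where
        integral : ∀ k → Σ[ z ∈ ℤ ] (e i ⊝ e j) k ≈ fromInt z
        integral k with k ≟ᶠ i | k ≟ᶠ j
        ... | yes _ | yes _ = + 0    , -‿inverseʳ 1#
        ... | yes _ | no _  = + 1    , solve 0 (con (+ 1) :- con (+ 0) := con (+ 1) :+ con (+ 0))
        ... | no _  | yes _ = -[1+ 0 ] , solve 0 (con (+ 0) :- con (+ 1) := :- (con (+ 1) :+ con (+ 0)))
        ... | no _  | no _  = + 0    , -‿inverseʳ 0#

      0<2 : 0# < 1# + 1#
      0<2 = +-pos-nonNeg 0<1 0≤1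

      halve-≤ : ∀ {a b} → a + a ≤ b + b → a ≤ b
      halve-≤ {a} {b} h = 0≤s⇒x≤y (*-cancelˡ-nonNeg 0<2 (≤-respʳ-≈
        (solve 2 (λ a b → (b :+ b) :- (a :+ a) := (con (+ 1) :+ con (+ 1)) :* (b :- a)) a b) (x≤y⇒0≤y-x h))) refl

      Voronoi⇒∙≤ : ∀ x → x ∈ VoronoiCell → ∀ q → q ∈ A → x ∙ q + x ∙ q ≤ ‖ q ‖²
      Voronoi⇒∙≤ x (_ , closest) q q∈A = 0≤s⇒x≤y (x≤y⇒0≤y-x (closest q q∈A)) (sym (norm-⊝ x q))

      Voronoi⊆Spread : VoronoiCell ⊆ SpreadAtMostOne
      Voronoi⊆Spread {x} x∈V = proj₁ x∈V , spread
        where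
        spread : ∀ i j → x i - x j ≤ 1#
        spread i j with i ≟ᶠ j
        ... | yes ≡.refl = ≤-respˡ-≈ (sym (-‿inverseʳ (x i))) 0≤1
        ... | no i≢j     = halve-≤ (≤-respˡ-≈ (+-cong x∙q x∙q)
            (≤-respʳ-≈ (root-norm i≢j) (Voronoi⇒∙≤ x x∈V (e i ⊝ e j) (root∈A i j))))
          where
          x∙q : x ∙ (e i ⊝ e j) ≈ x i - x j
          x∙q = trans (∙-comm x (e i ⊝ e j)) (root-∙ i j x)

      -- After subtracting the smallest coordinate, x ∙ q ≤ (‖ q ‖² + Σ q) / 2 holds term by term: 2 q y ≤ q² + q is affine in
      -- y ∈ [0, 1], and at the ends it says q² + q ≥ 0 and q² - q ≥ 0.
      Spread⊆Voronoi : SpreadAtMostOne ⊆ VoronoiCell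
      Spread⊆Voronoi {x} (x∈H , spread) = x∈H , λ q q∈A → 0≤s⇒x≤y (x≤y⇒0≤y-x (bound q q∈A)) (norm-⊝ x q)
        where
        least : Fin (suc n)
        least = proj₁ (minimum x)
        bound : ∀ q → q ∈ A → x ∙ q + x ∙ q ≤ ‖ q ‖²
        bound q (q∈H , z , q≈z) = ≤-respˡ-≈ left (≤-respʳ-≈ right (sum-mono-≤ term))
          where
          term : ∀ k → (x k - x least) * q k + (x k - x least) * q k ≤ q k * q k + q k
          term k = 0≤s⇒x≤y (+-nonNeg (*-nonNeg (x≤y⇒0≤y-x (spread k least))
              (≤-respʳ-≈ (+-cong (*-cong (sym (q≈z k)) (sym (q≈z k))) (sym (q≈z k))) (proj₁ (fromInt-square (z k)))))
                                     (*-nonNeg (x≤y⇒0≤y-x (proj₂ (minimum x) k))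
                                         (≤-respʳ-≈ (+-cong (*-cong (sym (q≈z k)) (sym (q≈z k)))
                                         (-‿cong (sym (q≈z k)))) (proj₂ (fromInt-square (z k))))))
            (solve 2 (λ y q → q :* q :+ q :- (y :* q :+ y :* q) := (con (+ 1) :- y) :* (q :* q :+ q) :+ y :*
                (q :* q :- q)) (x k - x least) (q k))
          right : sum (λ k → q k * q k + q k) ≈ ‖ q ‖²
          right = trans (∑-distrib-+ (λ k → q k * q k) q) (trans (+-congˡ (H⇒sum≈0 q q∈H)) (+-identityʳ ‖ q ‖²))
          half : sum (λ k → (x k - x least) * q k) ≈ x ∙ q
          half = begin
            sum (λ k → (x k - x least) * q k)
                ≈⟨ (sum-cong-≋ λ k → solve 3 (λ a b q → (a :- b) :* q := a :* q :- b :* q) (x k) (x least) (q k)) ⟩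
            sum (λ k → x k * q k - x least * q k)      ≈⟨ sum-minus (λ k → x k * q k) (λ k → x least * q k) ⟩
            x ∙ q - sum (λ k → x least * q k)
                ≈⟨ +-congˡ (-‿cong (trans (sym (*-distribˡ-sum (x least) q))
                (trans (*-congˡ (H⇒sum≈0 q q∈H)) (zeroʳ (x least))))) ⟩
            x ∙ q - 0#                             ≈⟨ solve 1 (λ a → a :- con (+ 0) := a) (x ∙ q) ⟩
            x ∙ q                                  ∎
          left : sum (λ k → (x k - x least) * q k + (x k - x least) * q k) ≈ x ∙ q + x ∙ q
          left = trans (∑-distrib-+ (λ k → (x k - x least) * q k) (λ k → (x k - x least) * q k)) (+-cong half half)

      Facet-isFace : ∀ {P : Region (suc n)} → P ≐ Facet i j → IsFace P VoronoiCell
      Facet-isFace {i} {j} (P⊆ , ⊆P) = e i ⊝ e j , 1#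
        , (λ x x∈V → ≤-respˡ-≈ (sym (root-∙ i j x)) (proj₂ (Voronoi⊆Spread {x} x∈V) i j))
        , (λ {x} x∈P → Spread⊆Voronoi {x} (Facet⊆Spread i j {x} (P⊆ x∈P))
            , trans (root-∙ i j x) (proj₁ (proj₂ (P⊆ x∈P))))
        , λ {x} (x∈V , tight) → ⊆P (Spread∩gap⊆Facet i j x (Voronoi⊆Spread {x} x∈V)
            (trans (sym (root-∙ i j x)) tight))

      ⊖ξ∈Voronoi : ∀ i j → i ≢ j → ⊖ ξ j ∈ VoronoiCell
      ⊖ξ∈Voronoi i j i≢j = Spread⊆Voronoi {⊖ ξ j} (Facet⊆Spread i j {⊖ ξ j} (⊖ξ∈Facet i≢j))

      -- In V(0) every other coordinate exceeds the one at `j` by at most 1, and at `⊖ ξ j` all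
      -- these excesses equal 1. Since the sum is fixed, the coordinate `j` is smallest there and
      -- nowhere else, so `⊖ e j` is a supporting functional.
      ⊖ξ-isVertex : i ≢ j → IsVertex (⊖ ξ j) VoronoiCell
      ⊖ξ-isVertex {i} {j} i≢j = ⊖ e j , - (⊖ ξ j) j
        , (λ x x∈V → ≤-respˡ-≈ (sym (value x))
            (neg-antimono-≤ (H-dominated x (⊖ ξ j) j (proj₁ x∈V) (H-⊖ (ξ j) (ξ∈H j)) (dominated x x∈V))))
        , (λ {x} v≋x → Spread⊆Voronoi {x} (Facet⊆Spread i j {x} (Facet-cong i j (⊖ ξ j) x v≋x (⊖ξ∈Facet i≢j)))
            , trans (value x) (-‿cong (sym (v≋x j))))
        , λ {x} (x∈V , tight) → ≋-sym (H-dominated-tight x (⊖ ξ j) j (proj₁ x∈V) (H-⊖ (ξ j) (ξ∈H j)) (dominated x x∈V)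
            (trans (solve 1 (λ a → a := :- (:- a)) (x j))
                (trans (-‿cong (trans (sym (value x)) tight)) (solve 1 (λ a → :- (:- a) := a) ((⊖ ξ j) j)))))
        where
        value : ∀ x → (⊖ e j) ∙ x ≈ - x j
        value x = begin
          (⊖ e j) ∙ x                      ≈⟨ (sum-cong-≋ λ k
              → solve 2 (λ a b → (:- a) :* b := a :* (:- b)) (e j k) (x k)) ⟩
          e j ∙ (⊖ x)                      ≈⟨ e-∙ j (⊖ x) ⟩
          - x j                            ∎
        dominated : ∀ x → x ∈ VoronoiCell → ∀ k → x k - x j ≤ (⊖ ξ j) k - (⊖ ξ j) j
        dominated x x∈V k = ≤-respʳ-≈ (sym (⊖ξ-difference j k j)) bound
          where
          bound : x k - x j ≤ e j j - e j k
          bound with k ≟ᶠ j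
          ... | yes ≡.refl = ≤-reflexive (trans (-‿inverseʳ (x k)) (sym (x≈y⇒x-y≈0 (e-diag {k = k} ≡.refl))))
          ... | no _ = ≤-respʳ-≈ (sym (trans (+-congʳ (e-diag {k = j} ≡.refl))
              (solve 0 (con (+ 1) :- con (+ 0) := con (+ 1))))) (proj₂ (Voronoi⊆Spread {x} x∈V) k j)

  -- Permutation symmetry, the boundary, and nearest neighbours.

  module VoronoiBoundary (n : ℕ) where
    open RootLattice F n
    open OrderedFieldProperties
    open EuclideanProperties
    open Parallelepipeds
    open VoronoiFacets n
    open SetoidReasoning setoid

    private variable
      i j : Fin (suc n)

    abstract

      -- Double transitivity: once `i` is sent to `i′`, one transposition of the remaining indices
      -- brings `j` to `j′`.
      sending : i ≢ j → ∀ {i′ j′ : Fin (suc n)} → i′ ≢ j′ → Σ[ π ∈ Permutation′ (suc n) ] π ⟨$⟩ʳ i ≡ i′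
          × π ⟨$⟩ʳ j ≡ j′
      sending {i} {j} i≢j {i′} {j′} i′≢j′ = π , first , second
        where
        τ : Permutation′ n
        τ = transpose (punchOut i≢j) (punchOut i′≢j′)
        π : Permutation′ (suc n)
        π = insert i i′ τ
        first : π ⟨$⟩ʳ i ≡ i′
        first with i ≟ᶠ i
        ... | yes _  = ≡.refl
        ... | no i≢i = contradiction ≡.refl i≢i
        second : π ⟨$⟩ʳ j ≡ j′
        second = ≡.trans (≡.cong (π ⟨$⟩ʳ_) (≡.sym (punchIn-punchOut i≢j)))
            (≡.trans (insert-punchIn i i′ τ (punchOut i≢j))
          (≡.trans (≡.cong (punchIn i′) (transpose-left (punchOut i≢j) (punchOut i′≢j′))) (punchIn-punchOut i′≢j′)))

      Facet-permute : ∀ (π : Permutation′ (suc n)) i j x → x ∈ Facet (π ⟨$⟩ʳ i) (π ⟨$⟩ʳ j) → x ∘ (π ⟨$⟩ʳ_) ∈ Facet i j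
      Facet-permute π i j x (x∈H , gap , bounds) = H-permute π x x∈H , gap , bounds ∘ (π ⟨$⟩ʳ_)

      Facet-permute⁻¹ : ∀ (π : Permutation′ (suc n)) i j x → x ∈ Facet i j
          → x ∘ (π ⟨$⟩ˡ_) ∈ Facet (π ⟨$⟩ʳ i) (π ⟨$⟩ʳ j)
      Facet-permute⁻¹ π i j x x∈ = Facet-permute (flip π) (π ⟨$⟩ʳ i) (π ⟨$⟩ʳ j) x
        (≡.subst₂ (λ a b → x ∈ Facet a b) (≡.sym (inverseˡ π)) (≡.sym (inverseˡ π)) x∈)

      permuted : ∀ (π : Permutation′ (suc n)) (x : Point (suc n)) → x ≋ x ∘ (π ⟨$⟩ʳ_) ∘ (π ⟨$⟩ˡ_)
      permuted π x k = reflexive (≡.cong x (≡.sym (inverseʳ π)))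

      Facets-congruent : i ≢ j → ∀ {i′ j′} → i′ ≢ j′ → ∀ {P Q : Region (suc n)} → P ≐ Facet i j → Q ≐ Facet i′ j′
          → Congruent P Q
      Facets-congruent {i} {j} i≢j {i′} {j′} i′≢j′ {P} {Q} (P⊆ , ⊆P) (Q⊆ , ⊆Q) = from (sending i≢j i′≢j′)
        where
        from : Σ[ π ∈ Permutation′ (suc n) ] π ⟨$⟩ʳ i ≡ i′ × π ⟨$⟩ʳ j ≡ j′ → Congruent P Q
        from (π , ≡.refl , ≡.refl) = (λ x → x ∘ (π ⟨$⟩ˡ_)) , permute-isometry (flip π)
          , (λ {y} (x , x∈P , y≋) → ⊆Q (Facet-cong (π ⟨$⟩ʳ i) (π ⟨$⟩ʳ j) (x ∘ (π ⟨$⟩ˡ_)) y (≋-sym y≋)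
              (Facet-permute⁻¹ π i j x (P⊆ x∈P))))
          , λ {y} y∈Q → y ∘ (π ⟨$⟩ʳ_) , ⊆P (Facet-permute π i j y (Q⊆ y∈Q)) , permuted π y

      -- The matrix carries `e s` to `e (π s)`, so the entry at `r` of the result comes from the
      -- position that `π` sends to `r`; hence the inverse on coordinates.
      apply-permutation : ∀ (π : Permutation′ (suc n)) {M : Matrix (suc n) (suc n)} → (∀ r s → M r s ≈ e (π ⟨$⟩ʳ s) r)
          →
                          ∀ x → apply M x ≋ x ∘ (π ⟨$⟩ˡ_)
      apply-permutation π {M} M≈ x r = begin
        sum (λ s → M r s * x s)                  ≈⟨ sum-single (π ⟨$⟩ˡ r) (λ s s≢ → trans (*-congʳ (trans (M≈ r s)
                                                      (e-off (λ h → s≢ (≡.trans (≡.sym (inverseˡ π))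
                                                          (≡.cong (π ⟨$⟩ˡ_) (≡.sym h))))))) (zeroˡ (x s))) ⟩
        M r (π ⟨$⟩ˡ r) * x (π ⟨$⟩ˡ r)
            ≈⟨ *-congʳ (trans (M≈ r (π ⟨$⟩ˡ r)) (e-diag {k = r} (≡.sym (inverseʳ π)))) ⟩
        1# * x (π ⟨$⟩ˡ r)                        ≈⟨ *-identityˡ _ ⟩
        x (π ⟨$⟩ˡ r)                             ∎

      image-Facet : ∀ (π : Permutation′ (suc n)) {M : Matrix (suc n) (suc n)} → (∀ r s → M r s ≈ e (π ⟨$⟩ʳ s) r) →
                    ∀ i j {P : Region (suc n)} → P ≐ Facet i j → image M P ≐ Facet (π ⟨$⟩ʳ i) (π ⟨$⟩ʳ j)
      image-Facet π {M} M≈ i j (P⊆ , ⊆P) =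
          (λ {y} (x , x∈P , y≋) → Facet-cong (π ⟨$⟩ʳ i) (π ⟨$⟩ʳ j) (x ∘ (π ⟨$⟩ˡ_)) y
            (≋-sym (≋-trans y≋ (apply-permutation π {M} M≈ x))) (Facet-permute⁻¹ π i j x (P⊆ x∈P)))
        , λ {y} y∈ → y ∘ (π ⟨$⟩ʳ_) , ⊆P (Facet-permute π i j y y∈)
            , ≋-trans (permuted π y) (≋-sym (apply-permutation π {M} M≈ (y ∘ (π ⟨$⟩ʳ_))))

      -- The two points `ξ i` and `⊖ ξ j` decide. Assuming only an equation on the facet, and not
      -- containment in another one, makes this fit the outcome of `relativeInterior-tight`.
      Facet-⊆-injective : ∀ i j i′ j′ → i ≢ j → Facet i j ⊆ (λ x → x i′ - x j′ ≈ 1#) → i ≡ i′ × j ≡ j′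
      Facet-⊆-injective i j i′ j′ i≢j sub = ≡.sym (unit-gap-ξ {i} {i′} {j′} (sub {ξ i} (ξ∈Facet i≢j)))
          , ≡.sym (unit-gap-⊖ξ {j} {i′} {j′} (sub {⊖ ξ j} (⊖ξ∈Facet i≢j)))

      -- A coordinate difference of at least `ε` would contribute a square of at least `ε * ε` to
      -- the squared distance.
      Near-coordinate : ∀ {ε} → 0# < ε → ∀ (x y : Point (suc n)) → Near ε x y → ∀ k → x k - y k < ε
      Near-coordinate {ε} 0<ε x y near k ε≤ =
          near (≤-trans square≤ (≤-respʳ-≈ (sym (sum-remove {i = k} (λ l → (x l - y l) * (x l - y l))))
          (0≤s⇒x≤y (sum-nonNeg λ l → square-nonNeg (x (punchIn k l) - y (punchIn k l)))
              (solve 2 (λ a b → a :+ b :- a := b) ((x k - y k) * (x k - y k)) _))))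
        where
        d : Carrier
        d = x k - y k
        square≤ : ε * ε ≤ d * d
        square≤ = 0≤s⇒x≤y (*-nonNeg (x≤y⇒0≤y-x ε≤) (+-nonNeg (≤-trans (<⇒≤ 0<ε) ε≤) (<⇒≤ 0<ε)))
          (solve 2 (λ e d → d :* d :- e :* e := (d :- e) :* (d :+ e)) ε d)

      Near-sym : ∀ {ε} (x y : Point (suc n)) → Near ε x y → Near ε y x
      Near-sym x y = <-respˡ (sum-cong-≋ λ k
          → solve 2 (λ a b → (a :- b) :* (a :- b) := (b :- a) :* (b :- a)) (x k) (y k))

      Near-refl : ∀ {ε} → 0# < ε → ∀ (x : Point (suc n)) → Near ε x x
      Near-refl 0<ε x = <-respˡ (sym (sum-zero λ k
          → trans (*-congʳ {x = x k - x k} (-‿inverseʳ (x k))) (zeroˡ (x k - x k)))) (*-pos 0<ε 0<ε)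

      half-pos : ∀ {a} → 0# < a → ∃[ b ] 0# < b × b + b ≈ a
      half-pos {a} 0<a = a * (1# + 1#) ⁻¹ , *-pos 0<a (⁻¹-pos 0<2) , (begin
        a * (1# + 1#) ⁻¹ + a * (1# + 1#) ⁻¹
            ≈⟨ solve 2 (λ a h → a :* h :+ a :* h := a :* ((con (+ 1) :+ con (+ 1)) :* h)) a ((1# + 1#) ⁻¹) ⟩
        a * ((1# + 1#) * (1# + 1#) ⁻¹)         ≈⟨ *-congˡ (⁻¹-inverse _ (λ h → <⇒≉ 0<2 (sym h))) ⟩
        a * 1#                                 ≈⟨ *-identityʳ a ⟩
        a                                      ∎)

      -- A largest and a smallest coordinate realise the spread of `x`. A spread above 1 would keep
      -- a neighbourhood of `x` outside the cell, and one below 1 would keep a neighbourhood in `H`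
      -- inside it.
      boundary⇒Facet : ∀ x → x ∈ ∂VoronoiCell → ∃[ i ] ∃[ j ] i ≢ j × x ∈ Facet i j
      boundary⇒Facet x (x∈H , close) = top , bottom , top≢bottom , x∈H , gap , λ k → proj₂ (minimum x) k
          , proj₂ (maximum x) k
        where
        top bottom : Fin (suc n)
        top = proj₁ (maximum x)
        bottom = proj₁ (minimum x)
        width : Carrier
        width = x top - x bottom
        widest : ∀ k l → x k - x l ≤ width
        widest k l = +-mono-≤ (proj₂ (maximum x) k) (neg-antimono-≤ (proj₂ (minimum x) l))
        width≤1 : width ≤ 1#
        width≤1 = decidable-stable (width ≤? 1#) λ wide → separate (half-pos (x<y⇒0<y-x wide))
          where
          separate : ¬ (∃[ ε ] 0# < ε × ε + ε ≈ width - 1#)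
          -- Half the excess suffices, because moving by less than `ε` in each of the two extreme
          -- coordinates lowers their difference by less than the whole excess.
          separate (ε , 0<ε , 2ε≈) with proj₁ (close ε 0<ε)
          ... | y , _ , near , y∈V = Near-coordinate 0<ε y x (Near-sym x y near) bottom
              (flip-bound (Near-coordinate 0<ε x y near top))
            where
            flip-bound : ¬ (ε ≤ x top - y top) → ε ≤ y bottom - x bottom
            flip-bound small = 0≤s⇒x≤y (+-nonNeg (x≤y⇒0≤y-x (<⇒≤ small))
                (x≤y⇒0≤y-x (proj₂ (Voronoi⊆Spread {y} y∈V) top bottom)))
              (begin
                y bottom - x bottom - ε
                    ≈⟨ solve 5 (λ a b c d e → d :- b :- e := (e :- (a :- c)) :+ ((a :- b) :- (e :+ e) :- (c :- d)))
                    (x top) (x bottom) (y top) (y bottom) ε ⟩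
                (ε - (x top - y top)) + (width - (ε + ε) - (y top - y bottom))
                    ≈⟨ +-congˡ (+-congʳ (trans (+-congˡ (-‿cong 2ε≈))
                    (solve 1 (λ a → a :- (a :- con (+ 1)) := con (+ 1)) width))) ⟩
                (ε - (x top - y top)) + (1# - (y top - y bottom))                         ∎)
        gap : width ≈ 1#
        gap = antisym width≤1 (decidable-stable (1# ≤? width) λ narrow → inside (half-pos (x<y⇒0<y-x narrow)))
          where
          inside : ¬ (∃[ ε ] 0# < ε × ε + ε ≈ 1# - width)
          inside (ε , 0<ε , 2ε≈) with proj₂ (close ε 0<ε)
          ... | y , y∈H , near , y∉V = y∉V (Spread⊆Voronoi {y} (y∈H , λ k l → 0≤s⇒x≤y
                (+-nonNeg (x≤y⇒0≤y-x (widest k l)) (+-nonNeg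
                    (x≤y⇒0≤y-x (<⇒≤ (Near-coordinate 0<ε y x (Near-sym x y near) k)))
                                                              (x≤y⇒0≤y-x (<⇒≤ (Near-coordinate 0<ε x y near l)))))
                (begin
                  1# - (y k - y l)
                      ≈⟨ +-congʳ (trans (solve 1 (λ w → con (+ 1) := w :+ (con (+ 1) :- w)) width)
                      (+-congˡ (sym 2ε≈))) ⟩
                  width + (ε + ε) - (y k - y l)
                      ≈⟨ solve 6 (λ w e a b c d → w :+ (e :+ e) :- (c :- d) := (w :- (a :- b)) :+
                      ((e :- (c :- a)) :+ (e :- (b :- d)))) width ε (x k) (x l) (y k) (y l) ⟩
                  (width - (x k - x l)) + ((ε - (y k - x k)) + (ε - (x l - y l)))               ∎)))
        top≢bottom : top ≢ bottom
        top≢bottom top≡bottom = 0≉1 (trans (sym (x≈y⇒x-y≈0 (reflexive (≡.cong x top≡bottom)))) gap)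

      -- The point itself lies in the cell. Pushing it away from `𝟎` by the factor `1# + δ`
      -- stretches the unit gap to `1# + δ`, which V(0) forbids.
      Facet⇒boundary : ∀ i j x → x ∈ Facet i j → x ∈ ∂VoronoiCell
      Facet⇒boundary i j x x∈Facet = proj₁ x∈Facet , λ ε 0<ε
          → (x , proj₁ x∈Facet , Near-refl 0<ε x , Spread⊆Voronoi {x} (Facet⊆Spread i j {x} x∈Facet)) , outside ε 0<ε
        where
        outside : ∀ ε → 0# < ε → ∃[ y ] y ∈ H × Near ε x y × y ∉ VoronoiCell
        outside ε 0<ε with extrapolate 0<ε x 𝟎
        ... | δ , 0<δ , near = y , H-⊕ x (δ ⊛ (x ⊝ 𝟎)) (proj₁ x∈Facet)
            (H-⊛ δ (x ⊝ 𝟎) (H-cong x (x ⊝ 𝟎) (λ k → solve 1 (λ a → a := a :- con (+ 0)) (x k)) (proj₁ x∈Facet)))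
            , near , λ y∈V → 0<δ (0≤s⇒x≤y (x≤y⇒0≤y-x (proj₂ (Voronoi⊆Spread {y} y∈V) i j)) (sym (begin
                1# - (y i - y j)
                    ≈⟨ solve 3 (λ a b d → con (+ 1) :- ((a :+ d :* (a :- con (+ 0))) :- (b :+ d :* (b :- con (+ 0))))
                    := con (+ 1) :- (con (+ 1) :+ d) :* (a :- b)) (x i) (x j) δ ⟩
                1# - (1# + δ) * (x i - x j)           ≈⟨ +-congˡ (-‿cong (*-congˡ (proj₁ (proj₂ x∈Facet)))) ⟩
                1# - (1# + δ) * 1#
                    ≈⟨ solve 1 (λ d → con (+ 1) :- (con (+ 1) :+ d) :* con (+ 1) := con (+ 0) :- d) δ ⟩
                0# - δ                                ∎)))
          where
          y : Point (suc n)
          y = x ⊕ δ ⊛ (x ⊝ 𝟎)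

      -- The index type is arbitrary so that this serves both the faces labelled by pairs and the
      -- rotated copies. If an interior point of `Q r` lies in `Q s`, the gap functional of `Q s` is
      -- tight on all of `Q r`, which forces equal labels and hence equal regions.
      boundary-composed : ∀ {a} {I : Set a} (Q : I → Region (suc n)) (top bottom : I → Fin (suc n))
          → (∀ r → top r ≢ bottom r) →
        (∀ r → Q r ≐ Facet (top r) (bottom r)) → (∀ i j → i ≢ j → ∃[ r ] top r ≡ i × bottom r ≡ j)
            → ∂VoronoiCell ComposedOf Q
      boundary-composed {I = I} Q top bottom top≢bottom Q≐ cover =
          record { union = into , onto ; nonOverlapping = λ r s Qr≉Qs x x∈r x∈s →
          separated r s Qr≉Qs x x∈s , separated s r (λ eq → Qr≉Qs (≐-sym eq)) x x∈r }
        where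
        into : ∂VoronoiCell ⊆ ⋃ I Q
        into {x} x∈∂ = place (boundary⇒Facet x x∈∂)
          where
          place : ∃[ i ] ∃[ j ] i ≢ j × x ∈ Facet i j → x ∈ ⋃ I Q
          place (i , j , i≢j , x∈) with cover i j i≢j
          ... | r , ≡.refl , ≡.refl = r , proj₂ (Q≐ r) x∈
        onto : ⋃ I Q ⊆ ∂VoronoiCell
        onto {x} (r , x∈) = Facet⇒boundary (top r) (bottom r) x (proj₁ (Q≐ r) x∈)
        separated : ∀ r s → ¬ (Q r ≐ Q s) → ∀ x → x ∈ Q s → x ∉ relativeInterior (Q r)
        separated r s Qr≉Qs x x∈s x∈int = Qr≉Qs
            (≐-trans (Q≐ r) (≐-sym (≡.subst₂ (λ i j → Q s ≐ Facet i j) (≡.sym (proj₁ same)) (≡.sym (proj₂ same))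
            (Q≐ s))))
          where
          u : Point (suc n)
          u = e (top s) ⊝ e (bottom s)
          same : top r ≡ top s × bottom r ≡ bottom s
          same = Facet-⊆-injective (top r) (bottom r) (top s) (bottom s) (top≢bottom r) λ {y} y∈
              → trans (sym (root-∙ (top s) (bottom s) y))
            (relativeInterior-tight u 1#
              (λ y y∈r → ≤-respˡ-≈ (sym (root-∙ (top s) (bottom s) y))
                  (proj₂ (Facet⊆Spread (top r) (bottom r) {y} (proj₁ (Q≐ r) y∈r)) (top s) (bottom s)))
              x∈int (trans (root-∙ (top s) (bottom s) x) (proj₁ (proj₂ (proj₁ (Q≐ s) x∈s)))) (proj₂ (Q≐ r) y∈))

      -- A nonzero lattice point has an entry of absolute value at least 1, and pairing it with
      -- `ξ k` or `⊖ ξ k` yields that entry up to sign. As these points lie in V(0), the inequality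
      -- `x ∙ p + x ∙ p ≤ ‖ p ‖²` gives a squared length of at least 2, that of a root.
      root-nearest : i ≢ j → IsNearestNeighbour (e i ⊝ e j)
      root-nearest {i} {j} i≢j = root∈A i j , nonzero , shortest
        where
        2≉0 : ¬ (1# + 1# ≈ 0#)
        2≉0 h = <⇒≉ 0<2 (sym h)
        nonzero : ¬ (e i ⊝ e j ≋ 𝟎)
        nonzero h = 2≉0 (trans (sym (root-norm i≢j))
            (sum-zero λ k → trans (*-congʳ {x = (e i ⊝ e j) k} (h k)) (zeroˡ ((e i ⊝ e j) k))))
        shortest : ∀ p → p ∈ A → ¬ (p ≋ 𝟎) → ‖ e i ⊝ e j ‖² ≤ ‖ p ‖²
        shortest p p∈A@(p∈H , z , p≈z) p≉𝟎 = ≤-respˡ-≈ (sym (root-norm i≢j)) (nontrivial (any? (λ k → ¬? (p k ≟ 0#))))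
          where
          pairing : ∀ x → x ∈ VoronoiCell → 1# ≤ x ∙ p → 1# + 1# ≤ ‖ p ‖²
          pairing x x∈V 1≤ = ≤-trans (+-mono-≤ 1≤ 1≤) (Voronoi⇒∙≤ x x∈V p p∈A)
          -- The multiple of `𝟏` inside `ξ k` does not contribute, because `p` lies in `H`.
          ξ∙p : ∀ k → ξ k ∙ p ≈ p k
          ξ∙p k = begin
            ξ k ∙ p
                ≈⟨ (sum-cong-≋ λ l → solve 3 (λ a r p → (a :- r) :* p := a :* p :- r :* p) (e k l) ν (p l)) ⟩
            sum (λ l → e k l * p l - ν * p l)
                ≈⟨ sum-minus (λ l → e k l * p l) (λ l → ν * p l) ⟩
            e k ∙ p - sum (λ l → ν * p l)
                ≈⟨ +-cong (e-∙ k p) (-‿cong (trans (sym (*-distribˡ-sum ν p))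
                (trans (*-congˡ (H⇒sum≈0 p p∈H)) (zeroʳ ν)))) ⟩
            p k - 0#                                                 ≈⟨ solve 1 (λ a → a :- con (+ 0) := a) (p k) ⟩
            p k                                                      ∎
            where
            ν : Carrier
            ν = fromNat (suc n) ⁻¹ * 1#
          ⊖ξ∙p : ∀ k → (⊖ ξ k) ∙ p ≈ - p k
          ⊖ξ∙p k = trans (∙-comm (⊖ ξ k) p) (trans
              (sum-cong-≋ λ l → solve 2 (λ p x → p :* (:- x) := :- con (+ 1) :* (x :* p)) (p l) (ξ k l))
            (trans (sym (*-distribˡ-sum (- 1#) (λ l → ξ k l * p l)))
                (trans (*-congˡ (ξ∙p k)) (solve 1 (λ a → :- con (+ 1) :* a := :- a) (p k)))))
          ξ∈V : ∀ k → ξ k ∈ VoronoiCell × ⊖ ξ k ∈ VoronoiCell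
          ξ∈V k with k ≟ᶠ i
          ... | yes ≡.refl = Spread⊆Voronoi {ξ k} (Facet⊆Spread k j {ξ k} (ξ∈Facet i≢j))
              , ⊖ξ∈Voronoi j k (λ h → i≢j (≡.sym h))
          ... | no k≢i     = Spread⊆Voronoi {ξ k} (Facet⊆Spread k i {ξ k} (ξ∈Facet k≢i))
              , ⊖ξ∈Voronoi i k (λ h → k≢i (≡.sym h))
          nontrivial : Dec (∃[ k ] ¬ (p k ≈ 0#)) → 1# + 1# ≤ ‖ p ‖²
          nontrivial (no all-zero) = contradiction (λ k → decidable-stable (p k ≟ 0#) (λ h → all-zero (k , h))) p≉𝟎
          nontrivial (yes (k , pk≉0)) with fromInt-nonzero (z k) (λ h → pk≉0 (trans (p≈z k) h))
          ... | inj₁ 1≤z  = pairing (ξ k) (proj₁ (ξ∈V k)) (≤-respʳ-≈ (trans (sym (p≈z k)) (sym (ξ∙p k))) 1≤z)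
          ... | inj₂ z≤-1 = pairing (⊖ ξ k) (proj₂ (ξ∈V k)) (≤-respˡ-≈ (solve 0 (:- (:- con (+ 1)) := con (+ 1)))
                              (≤-respʳ-≈ (trans (-‿cong (sym (p≈z k))) (sym (⊖ξ∙p k))) (neg-antimono-≤ z≤-1)))

      -- The root has squared length 2, so its midpoint has inner product 1 with it, which is the
      -- gap on the facet.
      Facet⊆bisector : i ≢ j → Facet i j ⊆ bisector (e i ⊝ e j)
      Facet⊆bisector {i} {j} i≢j {x} (_ , gap , _) = begin
        q ∙ (x ⊝ fromNat 2 ⁻¹ ⊛ q)              ≈⟨ ∙-⊝ q x (fromNat 2 ⁻¹ ⊛ q) ⟩
        q ∙ x - q ∙ (fromNat 2 ⁻¹ ⊛ q)
            ≈⟨ +-cong (trans (root-∙ i j x) gap)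
            (-‿cong (trans (∙-⊛ q (fromNat 2 ⁻¹) q)
            (*-congˡ (trans (root-norm i≢j) (+-congˡ (sym (+-identityʳ 1#))))))) ⟩
        1# - fromNat 2 ⁻¹ * fromNat 2           ≈⟨ x≈y⇒x-y≈0 (sym (⁻¹-inverseˡ _ (fromNat≉0 1))) ⟩
        0#                                      ∎
        where
        q : Point (suc n)
        q = e i ⊝ e j

  -- Hyper-rhombic cells, and the cells at one vertex.

  module VoronoiCells (m : ℕ) where
    open RootLattice F (suc m)
    open OrderedFieldProperties
    open EuclideanProperties
    open Parallelepipeds
    open VoronoiFacets (suc m)
    open SetoidReasoning setoid

    private
      Index : Set
      Index = Fin (suc (suc m))

      variable
        i j : Index

    -- Enumerates the `m` indices different from `i` and `j`, which turns the masked sum in `◇` into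
    -- a box on an independent family.
    others : ∀ {i j : Index} → i ≢ j → Fin m → Index
    others {i} i≢j r = punchIn i (punchIn (punchOut i≢j) r)

    abstract

      others-injective : ∀ (i≢j : i ≢ j) {q r} → others i≢j q ≡ others i≢j r → q ≡ r
      others-injective {i} i≢j h = punchIn-injective (punchOut i≢j) _ _ (punchIn-injective i _ _ h)

      others-≢ : ∀ (i≢j : i ≢ j) r → others i≢j r ≢ i
      others-≢ {i} i≢j r = punchInᵢ≢i i _

      lincomb-drop : ∀ {l N} k (t : Vector Carrier (suc l)) (p : Fin (suc l) → Point N) → t k ≈ 0# →
                     lincomb t p ≋ lincomb (t ∘ punchIn k) (p ∘ punchIn k)
      lincomb-drop k t p tk≈0 i = trans (lincomb-remove k t p i)
          (trans (+-congʳ (trans (*-congʳ tk≈0) (zeroˡ (p k i)))) (+-identityˡ _))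

      ξ+◇≐box : ∀ (i≢j : i ≢ j) → ξ+◇ i j ≐ translate (ξ i) (box (ξ ∘ others i≢j))
      ξ+◇≐box {i} {j} i≢j = forward , backward
        where
        j′ : Fin (suc m)
        j′ = punchOut i≢j
        forward : ξ+◇ i j ⊆ translate (ξ i) (box (ξ ∘ others i≢j))
        forward {x} (y , y∈◇ , x≋) = from (◇⇒lincomb i j y∈◇)
          where
          from : Σ[ t ∈ Vector Carrier (suc (suc m)) ] InUnitInterval t × t i ≈ 0# × t j ≈ 0# × y ≋ lincomb t ξ
              → x ∈ translate (ξ i) (box (ξ ∘ others i≢j))
          from (t , bounds , ti≈0 , tj≈0 , y≋) = y
              , (t ∘ others i≢j , bounds ∘ others i≢j , ≋-trans y≋ (≋-trans (lincomb-drop i t ξ ti≈0)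
            (lincomb-drop j′ (t ∘ punchIn i) (ξ ∘ punchIn i)
                (trans (reflexive (≡.cong t (punchIn-punchOut i≢j))) tj≈0)))) , x≋
        backward : translate (ξ i) (box (ξ ∘ others i≢j)) ⊆ ξ+◇ i j
        backward {x} (y , (t , bounds , y≋) , x≋) = y
            , lincomb⇒◇ i j t″ (insertAt-bounds t′ i (insertAt-bounds t j′ bounds 0-bounds) 0-bounds)
            (reflexive (insertAt-lookup t′ i 0#)) t″j≈0
            (≋-trans y≋ (≋-sym (≋-trans (insert-zero t′ i ξ) (insert-zero t j′ (ξ ∘ punchIn i))))) , x≋
          where
          0-bounds : 0# ≤ 0# × 0# ≤ 1#
          0-bounds = ≤-refl , 0≤1
          t′ : Vector Carrier (suc m)
          t′ = insertAt t j′ 0#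
          t″ : Vector Carrier (suc (suc m))
          t″ = insertAt t′ i 0#
          t″j≈0 : t″ j ≈ 0#
          t″j≈0 = reflexive (≡.trans (≡.cong t″ (≡.sym (punchIn-punchOut i≢j)))
              (≡.trans (insertAt-punchIn t′ i 0# j′) (insertAt-lookup t j′ 0#)))
          insert-zero : ∀ {l} (t : Vector Carrier l) k (p : Fin (suc l) → Point (suc (suc m)))
              → lincomb (insertAt t k 0#) p ≋ lincomb t (p ∘ punchIn k)
          insert-zero t k p i = trans (lincomb-insertAt t k 0# p i) (trans (+-congʳ (zeroˡ (p k i))) (+-identityˡ _))

      others-independent : ∀ (i≢j : i ≢ j) → LinearlyIndependent (ξ ∘ others i≢j)
      others-independent i≢j = ξ-independent (others i≢j) (others-injective i≢j) (others-≢ i≢j)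

      ξ+◇-isCell : i ≢ j → IsCell (ξ+◇ i j)
      ξ+◇-isCell {i} {j} i≢j = Facet-isFace (ξ+◇≐Facet i≢j)
          , translate-box-dimension (ξ i) (ξ ∘ others i≢j) (others-independent i≢j) (ξ+◇≐box i≢j)

      ξ-permute : ∀ (π : Permutation′ (suc (suc m))) i → ξ i ∘ (π ⟨$⟩ʳ_) ≋ ξ (π ⟨$⟩ˡ i)
      ξ-permute π i k = +-congʳ (e-permute π i k)

      ξ-norm : ∀ i j → ‖ ξ i ‖² ≈ ‖ ξ j ‖²
      ξ-norm i j = trans (sum-permute (λ k → ξ i k * ξ i k) π) (∙-cong same same)
        where
        π : Permutation′ (suc (suc m))
        π = transpose j i
        same : ξ i ∘ (π ⟨$⟩ʳ_) ≋ ξ j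
        same k = trans (ξ-permute π i k) (reflexive (≡.cong (λ l → ξ l k) (transpose-left i j)))

      -- Facets of such a box are boxes on the family with one vector removed, so the class is
      -- closed under the recursion. Any two facets are congruent because swapping two coordinates
      -- of the space exchanges the two removed vectors.
      ξ-box-hyperRhombus : ∀ l (s : Fin l → Index) → (∀ {q r} → s q ≡ s r → q ≡ r) → LinearlyIndependent (ξ ∘ s) →
                           ∀ o {P} → P ≐ translate o (box (ξ ∘ s)) → IsHyperRhombus l P
      ξ-box-hyperRhombus 0 s inj indep o P≐ = point (ξ ∘ s , indep , o , P≐)
      ξ-box-hyperRhombus 1 s inj indep o P≐ = edge (ξ ∘ s , indep , o , P≐)
      ξ-box-hyperRhombus 2 s inj indep o P≐ = rhombus (ξ ∘ s) (indep , o , P≐) (ξ-norm (s zero) (s (suc zero)))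
      ξ-box-hyperRhombus (suc (suc (suc l))) s inj indep o {P} P≐ = higher (ξ ∘ s , indep , o , P≐) (λ G face →
          let (k , o′ , G≐) = box-facet o (ξ ∘ s) indep P≐ face in
          ξ-box-hyperRhombus (suc (suc l)) (s ∘ punchIn k) (λ h → punchIn-injective k _ _ (inj h))
              (restricted-independent k) o′ G≐) facets-congruent
        where
        restricted-independent : ∀ k → LinearlyIndependent (ξ ∘ s ∘ punchIn k)
        restricted-independent k t eq r = trans (reflexive (≡.sym (insertAt-punchIn t k 0# r)))
          (indep (insertAt t k 0#) (λ i → trans (lincomb-insertAt t k 0# (ξ ∘ s) i)
              (trans (+-cong (zeroˡ (ξ (s k) i)) (eq i)) (+-identityˡ 0#))) (punchIn k r))
        facets-congruent : ∀ G G′ → IsFaceOfDimension (suc (suc l)) G P → IsFaceOfDimension (suc (suc l)) G′ P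
            → Congruent G G′
        facets-congruent G G′ face face′ =
          let (k , o₁ , G≐)  = box-facet o (ξ ∘ s) indep P≐ face
              (k′ , o₂ , G′≐) = box-facet o (ξ ∘ s) indep P≐ face′
          -- The arguments of `transpose` are exchanged because `ξ-permute` acts on labels by the
          -- inverse permutation, which exchanges them back.
          in box-facets-congruent (ξ ∘ s) k k′ (transpose (s k′) (s k))
               (λ r i → trans (ξ-permute (transpose (s k′) (s k)) (s r) i)
                   (reflexive (≡.cong (λ q → ξ q i) (transpose-natural inj k k′ r))))
               o₁ o₂ G≐ G′≐

      ξ+◇-hyperRhombus : i ≢ j → IsHyperRhombus m (ξ+◇ i j)
      ξ+◇-hyperRhombus {i} i≢j = ξ-box-hyperRhombus m (others i≢j) (others-injective i≢j) (others-independent i≢j)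
          (ξ i) (ξ+◇≐box i≢j)

      -- The n edges of V(0) at the vertex -ξ_{n+1} point in the directions -ξ_k with k ≤ n.
      cell-at-vertex : ∀ G → IsCell G → ⊖ ξ (fromℕ (suc m)) ∈ G → ∃[ i ] G ≐ Facet (inject₁ i) (fromℕ (suc m))
      cell-at-vertex G cell v∈G = identify
          (corner-facet o d d-independent VoronoiCell G (⊖ξ∈Voronoi zero last (λ ())) o+d∈V coordinate cell v∈G)
        where
        last : Index
        last = fromℕ (suc m)
        o : Point (suc (suc m))
        o = ⊖ ξ last
        d : Fin (suc m) → Point (suc (suc m))
        d k = ⊖ ξ (inject₁ k)
        last≢ : ∀ k → inject₁ k ≢ last
        last≢ k h = fromℕ≢inject₁ (≡.sym h)
        lincomb-d : ∀ t → lincomb t d ≋ ⊖ lincomb t (ξ ∘ inject₁)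
        lincomb-d t i = begin
          sum (λ k → t k * - ξ (inject₁ k) i)
              ≈⟨ (sum-cong-≋ λ k → solve 2 (λ t a → t :* (:- a) := :- con (+ 1) :* (t :* a)) (t k)
              (ξ (inject₁ k) i)) ⟩
          sum (λ k → - 1# * (t k * ξ (inject₁ k) i))     ≈⟨ *-distribˡ-sum (- 1#) (λ k → t k * ξ (inject₁ k) i) ⟨
          - 1# * lincomb t (ξ ∘ inject₁) i               ≈⟨ solve 1 (λ a → :- con (+ 1) :* a := :- a) _ ⟩
          - lincomb t (ξ ∘ inject₁) i                    ∎
        d-independent : LinearlyIndependent d
        d-independent t eq = ξ-independent inject₁ inject₁-injective last≢ t λ i →
          trans (solve 1 (λ a → a := :- (:- a)) _)
              (trans (-‿cong (trans (sym (lincomb-d t i)) (eq i))) (solve 0 (:- con (+ 0) := con (+ 0))))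
        o+d∈V : ∀ k → o ⊕ d k ∈ VoronoiCell
        o+d∈V k = Spread⊆Voronoi {o ⊕ d k} (H-⊕ o (d k) (H-⊖ (ξ last) (ξ∈H last))
            (H-⊖ (ξ (inject₁ k)) (ξ∈H (inject₁ k))) , spread)
          where
          -- Up to a multiple of `𝟏`, the point `o ⊕ d k` is the negative of `top`. The values of
          -- `top` lie between 0 and 1, so the spread is at most 1.
          top : Index → Carrier
          top a = e last a + e (inject₁ k) a
          top≤1 : ∀ a → top a ≤ 1#
          top≤1 a with a ≟ᶠ last
          ... | yes ≡.refl = ≤-reflexive (trans (+-congˡ (e-off (λ h → last≢ k (≡.sym h)))) (+-identityʳ 1#))
          ... | no _       = ≤-respˡ-≈ (sym (+-identityˡ _)) (proj₂ (e-bounds (inject₁ k) a))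
          spread : ∀ a b → (o ⊕ d k) a - (o ⊕ d k) b ≤ 1#
          spread a b = 0≤s⇒x≤y (+-nonNeg (x≤y⇒0≤y-x (top≤1 b))
              (+-nonNeg (proj₁ (e-bounds last a)) (proj₁ (e-bounds (inject₁ k) a)))) (begin
            1# - ((o ⊕ d k) a - (o ⊕ d k) b)
                ≈⟨ solve 4 (λ p q r s → con (+ 1) :- ((p :+ q) :- (r :+ s)) := con (+ 1) :- ((p :- r) :+ (q :- s)))
                (o a) (d k a) (o b) (d k b) ⟩
            1# - ((o a - o b) + (d k a - d k b))
                ≈⟨ +-congˡ (-‿cong (+-cong (⊖ξ-difference last a b) (⊖ξ-difference (inject₁ k) a b))) ⟩
            1# - ((e last b - e last a) + (e (inject₁ k) b - e (inject₁ k) a))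
                ≈⟨ solve 4 (λ p q r s → con (+ 1) :- ((p :- q) :+ (r :- s)) := (con (+ 1) :- (p :+ r)) :+ (q :+ s))
                (e last b) (e last a) (e (inject₁ k) b) (e (inject₁ k) a) ⟩
            (1# - top b) + (e last a + e (inject₁ k) a)                           ∎)
        height : ∀ t k → (o ⊕ lincomb t d) k - (o ⊕ lincomb t d) last ≈ (1# - e last k) - lincomb t (e ∘ inject₁) k
        height t k = begin
          (o ⊕ lincomb t d) k - (o ⊕ lincomb t d) last
              ≈⟨ solve 4 (λ p q r s → (p :+ q) :- (r :+ s) := (p :- r) :+ (q :- s)) (o k) (lincomb t d k) (o last)
              (lincomb t d last) ⟩
          (o k - o last) + (lincomb t d k - lincomb t d last)
              ≈⟨ +-cong (trans (⊖ξ-difference last k last) (+-congʳ (e-diag {k = last} ≡.refl)))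
              (+-cong (lincomb-d t k) (-‿cong (lincomb-d t last))) ⟩
          (1# - e last k) + (- lincomb t (ξ ∘ inject₁) k - - lincomb t (ξ ∘ inject₁) last)
              ≈⟨ +-congˡ (solve 2 (λ a b → :- a :- (:- b) := :- (a :- b)) _ _) ⟩
          (1# - e last k) - (lincomb t (ξ ∘ inject₁) k - lincomb t (ξ ∘ inject₁) last)
              ≈⟨ +-congˡ (-‿cong (trans (lincomb-ξ-difference t inject₁ k last)
              (+-congˡ (-‿cong (lincomb-e-miss t inject₁ last≢))))) ⟩
          (1# - e last k) - (lincomb t (e ∘ inject₁) k - 0#)
              ≈⟨ +-congˡ (-‿cong (solve 1 (λ a → a :- con (+ 0) := a) _)) ⟩
          (1# - e last k) - lincomb t (e ∘ inject₁) k                               ∎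
        height-hit : ∀ t k → (o ⊕ lincomb t d) (inject₁ k) - (o ⊕ lincomb t d) last ≈ 1# - t k
        height-hit t k = trans (height t (inject₁ k))
            (trans (+-cong (+-congˡ (-‿cong (e-off (last≢ k))))
            (-‿cong (lincomb-e-hit t inject₁ inject₁-injective k)))
          (solve 1 (λ a → con (+ 1) :- con (+ 0) :- a := con (+ 1) :- a) (t k)))
        -- The coordinates in the cone at the vertex are the slacks of the inequalities
        -- `x (inject₁ k) - x last ≤ 1#`; a zero coordinate is therefore a unit gap.
        slack : Point (suc (suc m)) → Vector Carrier (suc m)
        slack x k = 1# - (x (inject₁ k) - x last)
        expand : ∀ x → x ∈ H → x ≋ o ⊕ lincomb (slack x) d
        expand x x∈H = H-ext x (o ⊕ lincomb (slack x) d) last x∈H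
          (H-⊕ o (lincomb (slack x) d) (H-⊖ (ξ last) (ξ∈H last))
              (H-lincomb (slack x) d (λ k → H-⊖ (ξ (inject₁ k)) (ξ∈H (inject₁ k))))) same
          where
          same : ∀ k → x k - x last ≈ (o ⊕ lincomb (slack x) d) k - (o ⊕ lincomb (slack x) d) last
          same k with view k
          ... | ‵fromℕ      = trans (-‿inverseʳ (x last)) (sym (-‿inverseʳ ((o ⊕ lincomb (slack x) d) last)))
          ... | ‵inject₁ k′ = sym (trans (height-hit (slack x) k′)
              (solve 1 (λ a → con (+ 1) :- (con (+ 1) :- a) := a) (x k - x last)))
        coordinate : ∀ x → x ∈ VoronoiCell → Σ[ t ∈ Vector Carrier (suc m) ] (∀ k → 0# ≤ t k) × x ≋ o ⊕ lincomb t d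
        coordinate x x∈V = slack x , (λ k → x≤y⇒0≤y-x (proj₂ (Voronoi⊆Spread {x} x∈V) (inject₁ k) last))
            , expand x (proj₁ x∈V)
        identify : ∃[ k ] G ≐ (λ x → x ∈ VoronoiCell × Σ[ t ∈ Vector Carrier (suc m) ] t k ≈ 0# × x ≋ o ⊕ lincomb t d)
            →
                   ∃[ i ] G ≐ Facet (inject₁ i) last
        identify (k , G⊆ , ⊆G) = k
          , (λ {x} x∈G → let (x∈V , t , tk≈0 , x≋) = G⊆ x∈G in Spread∩gap⊆Facet (inject₁ k) last x (Voronoi⊆Spread {x} x∈V)
              (trans (+-cong (x≋ (inject₁ k)) (-‿cong (x≋ last)))
                  (trans (height-hit t k) (trans (+-congˡ (-‿cong tk≈0))
                  (solve 0 (con (+ 1) :- con (+ 0) := con (+ 1)))))))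
          , λ {x} x∈F → ⊆G (Spread⊆Voronoi {x} (Facet⊆Spread (inject₁ k) last {x} x∈F) , slack x
              , x≈y⇒x-y≈0 (sym (proj₁ (proj₂ x∈F))) , expand x (proj₁ x∈F))

  -- Circular shift matrices acting on the faces.

  module ShiftMatrices where
    open OrderedFieldProperties
    open EuclideanProperties

    Represents : ∀ {N} → Permutation′ N → Matrix N N → Set ℓ₁
    Represents π M = ∀ r s → M r s ≈ e (π ⟨$⟩ʳ s) r

    abstract

      Γ-represents : ∀ p k → Represents (rotation p k) (Γ (suc p) k)
      Γ-represents p k r s = refl

      -- The order is reversed because `∘ₚ` applies its left argument first, whereas a matrix
      -- product applies its right factor first.
      ⊗-represents : ∀ {N} (π ρ : Permutation′ N) {M M′ : Matrix N N} → Represents π M → Represents ρ M′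
          → Represents (ρ ∘ₚ π) (M ⊗ M′)
      ⊗-represents π ρ {M} {M′} M≈ M′≈ r s = trans
        (sum-single (ρ ⟨$⟩ʳ s) (λ t t≢ → trans (*-congˡ (trans (M′≈ t s) (e-off t≢))) (zeroʳ (M r t))))
        (trans (*-congˡ (trans (M′≈ (ρ ⟨$⟩ʳ s) s) (e-diag {k = ρ ⟨$⟩ʳ s} ≡.refl)))
            (trans (*-identityʳ _) (M≈ r (ρ ⟨$⟩ʳ s))))

      bordered-represents : ∀ {N} (π : Permutation′ N) {M : Matrix N N} → Represents π M
          → Represents (fixLast π) (bordered M)
      bordered-represents {N} π M≈ r s with view r | view s
      ... | ‵fromℕ      | ‵fromℕ      = sym (e-diag (≡.sym (fixLast-fromℕ π)))
      ... | ‵fromℕ      | ‵inject₁ s′ = sym (e-off (λ h → fromℕ≢inject₁ (≡.trans h (fixLast-inject₁ π s′))))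
      ... | ‵inject₁ r′ | ‵fromℕ      = sym
          (e-off {k = inject₁ r′} (λ h → fromℕ≢inject₁ (≡.sym (≡.trans h (fixLast-fromℕ π)))))
      ... | ‵inject₁ r′ | ‵inject₁ s′ = trans (M≈ r′ s′) (decide (r′ ≟ᶠ (π ⟨$⟩ʳ s′)))
        where
        decide : Dec (r′ ≡ π ⟨$⟩ʳ s′) → e (π ⟨$⟩ʳ s′) r′ ≈ e (fixLast π ⟨$⟩ʳ inject₁ s′) (inject₁ r′)
        decide (yes r′≡) = trans (e-diag {k = r′} r′≡)
            (sym (e-diag {k = inject₁ r′} (≡.trans (≡.cong inject₁ r′≡) (≡.sym (fixLast-inject₁ π s′)))))
        decide (no r′≢)  = trans (e-off r′≢)
            (sym (e-off (λ h → r′≢ (inject₁-injective (≡.trans h (fixLast-inject₁ π s′))))))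

    module _ (m : ℕ) where
      open RootLattice F (suc m)
      open VoronoiFacets (suc m)
      open VoronoiBoundary (suc m)
      open Parallelepipeds

      private
        n : ℕ
        n = suc m
        last : Fin (suc n)
        last = fromℕ n

      abstract

        -- With one-based indices modulo n + 1, the inner shift sends 1 to i - j and fixes n + 1;
        -- the outer shift then adds j, giving i and j. Tracking these two indices suffices because
        -- they label the face.
        shiftMatrix-face : ∀ {i j} → i ≢ j → ξ+◇ i j ≐ image (shiftMatrix i j) (ξ+◇ zero last)
        shiftMatrix-face {i} {j} i≢j = ≐-trans (ξ+◇≐Facet i≢j)
            (≐-sym (≡.subst₂ (λ a b → image (shiftMatrix i j) (ξ+◇ zero last) ≐ Facet a b) top bottom
            (image-Facet π (⊗-represents outer (fixLast inner) {Γ (suc n) (№ j % suc n)} {bordered (Γ n E)}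
                (Γ-represents n (№ j % suc n)) (bordered-represents inner (Γ-represents m E)))
              zero last (ξ+◇≐Facet λ ()))))
          where
          open ≡-Reasoning
          E : ℕ
          E = innerShift i j
          outer π : Permutation′ (suc n)
          inner : Permutation′ n
          outer = rotation n (№ j % suc n)
          inner = rotation m E
          π = fixLast inner ∘ₚ outer
          bottom : π ⟨$⟩ʳ last ≡ j
          bottom = ≡.trans (≡.cong (outer ⟨$⟩ʳ_) (fixLast-fromℕ inner)) (rotation-last n j)
          top : π ⟨$⟩ʳ zero ≡ i
          top = toℕ-injective (begin
            toℕ (outer ⟨$⟩ʳ (fixLast inner ⟨$⟩ʳ zero))
                ≡⟨ ≡.cong (λ k → toℕ (outer ⟨$⟩ʳ k)) (fixLast-inject₁ inner zero) ⟩
            toℕ (outer ⟨$⟩ʳ inject₁ (E mod n))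
                ≡⟨ toℕ-mod (toℕ (inject₁ (E mod n)) ℕ.+ № j % suc n) (suc n) ⟩
            (toℕ (inject₁ (E mod n)) ℕ.+ № j % suc n) % suc n
                ≡⟨ ≡.cong (λ k → (k ℕ.+ № j % suc n) % suc n)
                (≡.trans (toℕ-inject₁ (E mod n)) (≡.trans (toℕ-mod E n) (m<n⇒m%n≡m (innerShift<n i≢j)))) ⟩
            (E ℕ.+ № j % suc n) % suc n
                ≡⟨ ≡.cong (_% suc n) (ℕ.+-comm E (№ j % suc n)) ⟩
            (№ j % suc n ℕ.+ E) % suc n                                      ≡⟨ %-remove-inner (№ j) E (suc n) ⟩
            (№ j ℕ.+ E) % suc n                                              ≡⟨ ≡.cong (_% suc n) (ℕ.+-comm (№ j) E) ⟩
            (E ℕ.+ № j) % suc n                                              ≡⟨ innerShift-% i j ⟩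
            toℕ i                                                            ∎)

        rotated-faces-compose : ∂VoronoiCell ComposedOf
            (λ ((k , i) : Fin (suc n) × Fin n) → image (Γ (suc n) (toℕ k)) (ξ+◇ (inject₁ i) last))
        rotated-faces-compose = boundary-composed (λ (k , i) → image (Γ (suc n) (toℕ k)) (ξ+◇ (inject₁ i) last))
            (λ (k , i) → ρ k ⟨$⟩ʳ inject₁ i) (λ (k , i) → ρ k ⟨$⟩ʳ last)
            (λ (k , i) h → last≢ i (⟨$⟩ʳ-injective (ρ k) h))
            (λ (k , i) → image-Facet (ρ k) (Γ-represents n (toℕ k)) (inject₁ i) last (ξ+◇≐Facet (last≢ i)))
            cover
          where
          ρ : Fin (suc n) → Permutation′ (suc n)
          ρ k = rotation n (toℕ k)
          last≢ : ∀ i → inject₁ i ≢ last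
          last≢ i h = fromℕ≢inject₁ (≡.sym h)
          cover : ∀ i j → i ≢ j → ∃[ r ] ρ (proj₁ r) ⟨$⟩ʳ inject₁ (proj₂ r) ≡ i × ρ (proj₁ r) ⟨$⟩ʳ last ≡ j
          cover i j i≢j = (k , proj₁ preimage) , ≡.trans (≡.cong (ρ k ⟨$⟩ʳ_) (proj₂ preimage)) (inverseʳ (ρ k))
              , bottom
            where
            k : Fin (suc n)
            -- The only shift that carries the last index to `j`.
            k = № j mod suc n
            bottom : ρ k ⟨$⟩ʳ last ≡ j
            bottom = ≡.trans (≡.cong (λ l → rotation n l ⟨$⟩ʳ last) (toℕ-mod (№ j) (suc n))) (rotation-last n j)
            -- The index that is carried to `i` cannot be the last one, which goes to `j`.
            preimage : ∃[ i′ ] inject₁ i′ ≡ ρ k ⟨$⟩ˡ i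
            preimage with ρ k ⟨$⟩ˡ i in eq
            ... | i″ with view i″
            ...   | ‵inject₁ i′ = i′ , ≡.refl
            ...   | ‵fromℕ = contradiction (≡.trans (≡.sym (inverseʳ (ρ k))) (≡.trans (≡.cong (ρ k ⟨$⟩ʳ_) eq) bottom))
                i≢j

  -- Sorting coordinates and the images of the roof.

  module Roofs where
    open OrderedFieldProperties
    open EuclideanProperties
    open SetoidReasoning setoid

    -- step k is the indicator of {0, …, k}: up to a multiple of 𝟏, the vertex v (suc k) of the roof.
    step : ∀ {n} → Fin n → Fin (suc n) → Carrier
    step k       zero    = 1#
    step zero    (suc c) = 0#
    step (suc k) (suc c) = step k c

    abstract

      step-bounds : ∀ {n} (k : Fin n) c → 0# ≤ step k c × step k c ≤ 1#
      step-bounds k       zero    = 0≤1 , ≤-refl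
      step-bounds zero    (suc c) = ≤-refl , 0≤1
      step-bounds (suc k) (suc c) = step-bounds k c

      step-antitone : ∀ {n} (k : Fin n) {a b} → a ≤ᶠ b → step k b ≤ step k a
      step-antitone k       {zero}  {b}     _         = proj₂ (step-bounds k b)
      step-antitone zero    {suc a} {suc b} _         = ≤-refl
      step-antitone (suc k) {suc a} {suc b} (s≤s a≤b) = step-antitone k a≤b

      step-at : ∀ {n} (k : Fin n) → step k (inject₁ k) ≈ 1#
      step-at zero    = refl
      step-at (suc k) = step-at k

      step-above : ∀ {n} (k : Fin n) {c} → inject₁ k <ᶠ c → step k c ≈ 0#
      step-above zero    {suc c} _         = refl
      step-above (suc k) {suc c} (s≤s k<c) = step-above k k<c

      step-last : ∀ {n} (k : Fin n) → step k (fromℕ n) ≈ 0#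
      step-last zero    = refl
      step-last (suc k) = step-last k

      -- Only the terms with k at least c survive, and these differences telescope. The lemma
      -- expresses a vector through step vectors, with its consecutive drops as coefficients.
      step-telescope : ∀ {n} (x : Point (suc n)) c
          → sum (λ k → (x (inject₁ k) - x (suc k)) * step k c) ≈ x c - x (fromℕ n)
      step-telescope {zero}  x zero    = sym (-‿inverseʳ (x zero))
      step-telescope {suc n} x zero    = trans (+-congˡ (step-telescope (x ∘ suc) zero))
        (solve 3 (λ a b c → (a :- b) :* con (+ 1) :+ (b :- c) := a :- c) (x zero) (x (suc zero)) (x (suc (fromℕ n))))
      step-telescope {suc n} x (suc c) = trans (+-cong (zeroʳ (x zero - x (suc zero))) (step-telescope (x ∘ suc) c))
          (+-identityˡ _)

      sum-e-below : ∀ {n} (k : Fin n) c → sum (λ (i : Fin′ (suc k)) → e (inject {i = suc k} i) c) ≈ step k c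
      sum-e-below {suc n} k       zero    =
          trans (+-congˡ (sum-zero {f = λ (i : Fin′ k) → e (suc (inject {i = k} i)) (zero {n = suc n})} (λ _ → refl)))
          (+-identityʳ 1#)
      sum-e-below {suc n} zero    (suc c) = +-identityˡ 0#
      sum-e-below {suc n} (suc k) (suc c) = trans (+-identityˡ _) (sum-e-below k c)

      sort : ∀ {n} (x : Point n) → Σ[ π ∈ Permutation′ n ] (∀ {a b} → a ≤ᶠ b → x (π ⟨$⟩ʳ b) ≤ x (π ⟨$⟩ʳ a))
      sort {zero}  x = Permutation.id , λ { {()} }
      sort {suc n} x = π , sorted
        where
        i : Fin (suc n)
        i = proj₁ (maximum x)
        π′ : Permutation′ n
        π′ = proj₁ (sort (x ∘ punchIn i))
        π : Permutation′ (suc n)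
        π = insert zero i π′
        sorted : ∀ {a b} → a ≤ᶠ b → x (π ⟨$⟩ʳ b) ≤ x (π ⟨$⟩ʳ a)
        sorted {zero}  {b}     _         = proj₂ (maximum x) (π ⟨$⟩ʳ b)
        sorted {suc a} {suc b} (s≤s a≤b) = proj₂ (sort (x ∘ punchIn i)) a≤b

    -- The end of the range of positions starting at `suc zero` on which an edge is flat. For `m`
    -- zero it is set to `suc zero` as well, so that the functional in `roofImage-edge` becomes zero
    -- and the edge is the whole one-point roof.
    penultimate : ∀ m → Fin (suc (suc m))
    penultimate zero    = suc zero
    penultimate (suc m) = inject₁ (fromℕ (suc m))

    first≤penultimate : ∀ m → suc {suc m} zero ≤ᶠ penultimate m
    first≤penultimate zero    = s≤s z≤n
    first≤penultimate (suc m) = s≤s z≤n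

    middle≤penultimate : ∀ m {a : Fin (suc (suc m))} → a ≢ zero → a ≢ fromℕ (suc m) → a ≤ᶠ penultimate m
    middle≤penultimate zero    {zero}     a≢0 _ = contradiction ≡.refl a≢0
    middle≤penultimate zero    {suc zero} _ a≢l = contradiction ≡.refl a≢l
    middle≤penultimate (suc m) {a} _ a≢l =
        ≡.subst (toℕ a ℕ.≤_) (≡.sym (≡.trans (toℕ-inject₁ (fromℕ (suc m))) (toℕ-fromℕ (suc m))))
      (ℕ.≤-pred (ℕ.≤∧≢⇒< (ℕ.≤-pred (toℕ<n a)) λ h
          → a≢l (toℕ-injective (≡.trans h (≡.sym (toℕ-fromℕ (suc (suc m))))))))

    0<a : ∀ {m} {a : Fin (suc (suc m))} → a ≢ zero → suc {suc m} zero ≤ᶠ a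
    0<a {a = zero}  a≢0 = contradiction ≡.refl a≢0
    0<a {a = suc a} _   = s≤s z≤n

    abstract

      -- For `m` zero the two positions coincide; otherwise the penultimate position is not the
      -- last, and the left side is 0.
      e-last-penultimate : ∀ m (π : Permutation′ (suc (suc m))) →
                           e (π ⟨$⟩ʳ fromℕ (suc m)) (π ⟨$⟩ʳ penultimate m) ≤ e (π ⟨$⟩ʳ fromℕ (suc m))
                               (π ⟨$⟩ʳ suc zero)
      e-last-penultimate zero    π = ≤-refl
      e-last-penultimate (suc m) π = ≤-respˡ-≈ (sym (e-off {k = π ⟨$⟩ʳ penultimate (suc m)} λ h →
          penultimate≢last (⟨$⟩ʳ-injective π h)))
          (e-nonNeg (π ⟨$⟩ʳ fromℕ (suc (suc m))) (π ⟨$⟩ʳ suc zero))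
        where
        penultimate≢last : penultimate (suc m) ≢ fromℕ (suc (suc m))
        penultimate≢last h = fromℕ≢inject₁ (≡.sym h)
        e-nonNeg : ∀ {l} (i k : Fin l) → 0# ≤ e i k
        e-nonNeg i k with k ≟ᶠ i
        ... | yes _ = 0≤1
        ... | no  _ = ≤-refl

    module _ (m : ℕ) where
      open RootLattice F (suc m)
      open VoronoiFacets (suc m)
      open VoronoiBoundary (suc m)
      open Parallelepipeds

      private
        n : ℕ
        n = suc m
        last : Fin (suc n)
        last = fromℕ n
        variable
          i j : Fin (suc n)

      -- The image of the roof under `π` in terms of inequalities: `π` lists the indices in an order
      -- of decreasing coordinates, and the extreme ones differ by 1.
      Chamber : Permutation′ (suc n) → Pred (Point (suc n)) (ℓ₁ ⊔ ℓ₂)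
      Chamber π x = x ∈ H × x (π ⟨$⟩ʳ zero) - x (π ⟨$⟩ʳ last) ≈ 1# × (∀ {a b} → a ≤ᶠ b → x (π ⟨$⟩ʳ b) ≤ x (π ⟨$⟩ʳ a))

      abstract

        Chamber-cong : ∀ π x y → x ≋ y → x ∈ Chamber π → y ∈ Chamber π
        Chamber-cong π x y x≋y (x∈H , gap , sorted) = H-cong x y x≋y x∈H
          , trans (+-cong (sym (x≋y _)) (-‿cong (sym (x≋y _)))) gap
          , λ a≤b → ≤-respˡ-≈ (x≋y _) (≤-respʳ-≈ (x≋y _) (sorted a≤b))

        lincomb-difference : ∀ {l} (t : Vector Carrier l) (p : Fin l → Point (suc n)) a b
            → lincomb t p a - lincomb t p b ≈ sum (λ k → t k * (p k a - p k b))
        lincomb-difference t p a b = trans (sym (sum-minus (λ k → t k * p k a) (λ k → t k * p k b)))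
          (sum-cong-≋ λ k → solve 3 (λ t a b → t :* a :- t :* b := t :* (a :- b)) (t k) (p k a) (p k b))

        hull⊆Chamber : ∀ π {l} (p : Fin l → Point (suc n)) → (∀ k → p k ∈ Chamber π) → ∀ x → x ∈ hull p
            → x ∈ Chamber π
        hull⊆Chamber π p p∈ x (t , 0≤t , Σt≈1 , x≋) =
            Chamber-cong π (lincomb t p) x (≋-sym x≋) (H-lincomb t p (λ k → proj₁ (p∈ k))
          , trans (lincomb-difference t p _ _)
              (trans (sum-cong-≋ λ k → trans (*-congˡ {x = t k} (proj₁ (proj₂ (p∈ k)))) (*-identityʳ (t k))) Σt≈1)
          , λ a≤b → 0≤s⇒x≤y (sum-nonNeg λ k → *-nonNeg (0≤t k) (x≤y⇒0≤y-x (proj₂ (proj₂ (p∈ k)) a≤b)))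
              (lincomb-difference t p _ _))

        v-difference : ∀ (k : Fin n) a b → v (suc k) a - v (suc k) b ≈ step k a - step k b
        v-difference k a b = begin
          v (suc k) a - v (suc k) b
              ≈⟨ sum-minus (λ i → ξ (inject {i = suc k} i) a) (λ i → ξ (inject {i = suc k} i) b) ⟨
          sum (λ i → ξ (inject {i = suc k} i) a - ξ (inject {i = suc k} i) b)
              ≈⟨ (sum-cong-≋ λ i → ξ-difference (inject {i = suc k} i) a b) ⟩
          sum (λ i → e (inject {i = suc k} i) a - e (inject {i = suc k} i) b)
              ≈⟨ sum-minus (λ i → e (inject {i = suc k} i) a) (λ i → e (inject {i = suc k} i) b) ⟩
          sum (λ i → e (inject {i = suc k} i) a) - sum (λ i → e (inject {i = suc k} i) b)
              ≈⟨ +-cong (sum-e-below k a) (-‿cong (sum-e-below k b)) ⟩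
          step k a - step k b                                                          ∎

        v∈H : ∀ k → v (suc k) ∈ H
        v∈H k = H-cong (lincomb (const 1#) p) (v (suc k)) (λ a → sum-cong-≋ λ i → *-identityˡ (p i a))
            (H-lincomb (const 1#) p (λ i → ξ∈H (inject {i = suc k} i)))
          where
          p : Fin′ (suc k) → Point (suc n)
          p i = ξ (inject {i = suc k} i)

        v∈Chamber : ∀ k → v (suc k) ∈ Chamber Permutation.id
        v∈Chamber k = v∈H k
          , trans (v-difference k zero last) (trans (+-congˡ (-‿cong (step-last k)))
              (solve 0 (con (+ 1) :- con (+ 0) := con (+ 1))))
          , λ {a} {b} a≤b → 0≤s⇒x≤y (x≤y⇒0≤y-x (step-antitone k a≤b)) (v-difference k a b)

        -- The drops between consecutive coordinates serve as barycentric weights: sorting makes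
        -- them nonnegative, and they add up to the unit gap.
        Chamber⊆roof : ∀ x → x ∈ Chamber Permutation.id → x ∈ roof
        Chamber⊆roof x (x∈H , gap , sorted) = t , (λ k → x≤y⇒0≤y-x (sorted (adjacent k)))
            , trans (sum-cong-≋ λ k → sym (*-identityʳ (t k))) (trans (step-telescope x zero) gap)
            , H-ext x (lincomb t (v ∘ suc)) last x∈H (H-lincomb t (v ∘ suc) v∈H) same
          where
          t : Vector Carrier n
          t k = x (inject₁ k) - x (suc k)
          adjacent : ∀ {l} (k : Fin l) → inject₁ k ≤ᶠ suc k
          adjacent k = ≡.subst (ℕ._≤ suc (toℕ k)) (≡.sym (toℕ-inject₁ k)) (ℕ.n≤1+n (toℕ k))
          same : ∀ a → x a - x last ≈ lincomb t (v ∘ suc) a - lincomb t (v ∘ suc) last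
          same a = sym (begin
            lincomb t (v ∘ suc) a - lincomb t (v ∘ suc) last      ≈⟨ lincomb-difference t (v ∘ suc) a last ⟩
            sum (λ k → t k * (v (suc k) a - v (suc k) last))
                ≈⟨ (sum-cong-≋ λ k → *-congˡ {x = t k} (trans (v-difference k a last)
                                                                       (trans (+-congˡ (-‿cong (step-last k)))
                                                                           (solve 1 (λ s → s :- con (+ 0) := s)
                                                                           (step k a))))) ⟩
            sum (λ k → t k * step k a)                            ≈⟨ step-telescope x a ⟩
            x a - x last                                          ∎)

        roofImage≐Chamber : ∀ π → image (permutationMatrix (π ⟨$⟩ʳ_)) roof ≐ Chamber π
        roofImage≐Chamber π = forward , backward
          where
          M : Matrix (suc n) (suc n)
          M = permutationMatrix (π ⟨$⟩ʳ_)
          forward : image M roof ⊆ Chamber π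
          forward {y} (x , x∈roof , y≋) = Chamber-cong π (x ∘ (π ⟨$⟩ˡ_)) y
              (≋-sym (≋-trans y≋ (apply-permutation π {M} (λ r s → refl) x)))
              (permuted-in (hull⊆Chamber Permutation.id (v ∘ suc) v∈Chamber x x∈roof))
            where
            back : ∀ a → x (π ⟨$⟩ˡ (π ⟨$⟩ʳ a)) ≈ x a
            back a = reflexive (≡.cong x (inverseˡ π))
            permuted-in : x ∈ Chamber Permutation.id → x ∘ (π ⟨$⟩ˡ_) ∈ Chamber π
            permuted-in (x∈H , gap , sorted) = H-permute (flip π) x x∈H
                , trans (+-cong (back zero) (-‿cong (back last))) gap
              , λ {a} {b} a≤b → ≤-respˡ-≈ (sym (back b)) (≤-respʳ-≈ (sym (back a)) (sorted a≤b))
          backward : Chamber π ⊆ image M roof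
          backward {y} (y∈H , gap , sorted) = y ∘ (π ⟨$⟩ʳ_)
              , Chamber⊆roof (y ∘ (π ⟨$⟩ʳ_)) (H-permute π y y∈H , gap , sorted)
            , ≋-trans (permuted π y) (≋-sym (apply-permutation π {M} (λ r s → refl) (y ∘ (π ⟨$⟩ʳ_))))

        Chamber⊆Facet : ∀ π x → x ∈ Chamber π → x ∈ Facet (π ⟨$⟩ʳ zero) (π ⟨$⟩ʳ last)
        Chamber⊆Facet π x (x∈H , gap , sorted) = x∈H , gap , λ k →
            ≤-respʳ-≈ (at k) (sorted (≤fromℕ (π ⟨$⟩ˡ k))) , ≤-respˡ-≈ (at k) (sorted z≤n)
          where
          at : ∀ k → x (π ⟨$⟩ʳ (π ⟨$⟩ˡ k)) ≈ x k
          at k = reflexive (≡.cong x (inverseʳ π))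

        e-antitone : ∀ (π : Permutation′ (suc n)) {a b} → a ≤ᶠ b
            → e (π ⟨$⟩ʳ zero) (π ⟨$⟩ʳ b) ≤ e (π ⟨$⟩ʳ zero) (π ⟨$⟩ʳ a)
        e-antitone π {a} {b} a≤b with b ≟ᶠ zero
        ... | yes ≡.refl = ≤-reflexive (reflexive (≡.cong (λ a → e (π ⟨$⟩ʳ zero) (π ⟨$⟩ʳ a)) (≤ᶠ-antisym z≤n a≤b)))
        ... | no b≢0     = ≤-respˡ-≈ (sym (e-off {k = π ⟨$⟩ʳ b} (λ h → b≢0 (⟨$⟩ʳ-injective π h))))
                             (proj₁ (e-bounds (π ⟨$⟩ʳ zero) (π ⟨$⟩ʳ a)))

        e-monotone : ∀ (π : Permutation′ (suc n)) {a b} → a ≤ᶠ b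
            → e (π ⟨$⟩ʳ last) (π ⟨$⟩ʳ a) ≤ e (π ⟨$⟩ʳ last) (π ⟨$⟩ʳ b)
        e-monotone π {a} {b} a≤b with a ≟ᶠ last
        ... | yes ≡.refl = ≤-reflexive (reflexive
            (≡.cong (λ a → e (π ⟨$⟩ʳ last) (π ⟨$⟩ʳ a)) (≤ᶠ-antisym a≤b (≤fromℕ b))))
        ... | no a≢l     = ≤-respˡ-≈ (sym (e-off {k = π ⟨$⟩ʳ a} (λ h → a≢l (⟨$⟩ʳ-injective π h))))
                             (proj₁ (e-bounds (π ⟨$⟩ʳ last) (π ⟨$⟩ʳ b)))

        ends≢ : ∀ (π : Permutation′ (suc n)) → π ⟨$⟩ʳ zero ≢ π ⟨$⟩ʳ last
        ends≢ π h = contradiction (⟨$⟩ʳ-injective π h) λ ()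

        ξ∈Chamber : ∀ π → ξ (π ⟨$⟩ʳ zero) ∈ Chamber π
        ξ∈Chamber π = ξ∈H (π ⟨$⟩ʳ zero) , proj₁ (proj₂ (ξ∈Facet (ends≢ π)))
          , λ {a} {b} a≤b → 0≤s⇒x≤y (x≤y⇒0≤y-x (e-antitone π a≤b)) (ξ-difference (π ⟨$⟩ʳ zero) (π ⟨$⟩ʳ a) (π ⟨$⟩ʳ b))

        ⊖ξ∈Chamber : ∀ π → ⊖ ξ (π ⟨$⟩ʳ last) ∈ Chamber π
        ⊖ξ∈Chamber π = H-⊖ (ξ (π ⟨$⟩ʳ last)) (ξ∈H (π ⟨$⟩ʳ last)) , proj₁ (proj₂ (⊖ξ∈Facet (ends≢ π)))
          , λ {a} {b} a≤b → 0≤s⇒x≤y (x≤y⇒0≤y-x (e-monotone π a≤b)) (⊖ξ-difference (π ⟨$⟩ʳ last) (π ⟨$⟩ʳ a) (π ⟨$⟩ʳ b))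

        -- On the simplex, the edge is where the coordinates at the positions 2, …, n agree.
        roofImage-edge : ∀ π → IsFace (segment (ξ (π ⟨$⟩ʳ zero)) (⊖ ξ (π ⟨$⟩ʳ last)))
            (image (permutationMatrix (π ⟨$⟩ʳ_)) roof)
        roofImage-edge π = e q ⊝ e p , 0# , bounded , forward , backward
          where
          i₀ j₀ p q : Fin (suc n)
          i₀ = π ⟨$⟩ʳ zero
          j₀ = π ⟨$⟩ʳ last
          p = π ⟨$⟩ʳ suc zero
          q = π ⟨$⟩ʳ penultimate m
          ends : Fin 2 → Point (suc n)
          ends = ξ i₀ ∷ (⊖ ξ j₀) ∷ []
          ends∈ : ∀ k → ends k ∈ Chamber π
          ends∈ zero       = ξ∈Chamber π
          ends∈ (suc zero) = ⊖ξ∈Chamber π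
          bounded : ∀ x → x ∈ image (permutationMatrix (π ⟨$⟩ʳ_)) roof → (e q ⊝ e p) ∙ x ≤ 0#
          bounded x x∈ = ≤-respˡ-≈ (sym (root-∙ q p x))
              (0≤s⇒x≤y (x≤y⇒0≤y-x (proj₂ (proj₂ (proj₁ (roofImage≐Chamber π) x∈)) (first≤penultimate m)))
            (solve 2 (λ a b → con (+ 0) :- (a :- b) := b :- a) (x q) (x p)))
          flat-ends : ∀ k → ends k q - ends k p ≈ 0#
          flat-ends zero = trans (ξ-difference i₀ q p)
              (trans (+-cong (e-off (distinct (λ h
              → contradiction (≡.subst (suc {suc m} zero ≤ᶠ_) h (first≤penultimate m)) λ ())))
              (-‿cong (e-off (distinct λ ()))))
              (-‿inverseʳ 0#))
            where
            distinct : ∀ {a b} → a ≢ b → π ⟨$⟩ʳ a ≢ π ⟨$⟩ʳ b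
            distinct a≢b h = a≢b (⟨$⟩ʳ-injective π h)
          flat-ends (suc zero) = trans (⊖ξ-difference j₀ q p)
              (x≈y⇒x-y≈0 (antisym (e-monotone π (first≤penultimate m)) (e-last-penultimate m π)))
          forward : segment (ξ i₀) (⊖ ξ j₀) ⊆ (λ x → x ∈ image (permutationMatrix (π ⟨$⟩ʳ_)) roof
              × (e q ⊝ e p) ∙ x ≈ 0#)
          forward {x} x∈@(t , _ , _ , x≋) = proj₂ (roofImage≐Chamber π) (hull⊆Chamber π ends ends∈ x x∈) , (begin
            (e q ⊝ e p) ∙ x                             ≈⟨ root-∙ q p x ⟩
            x q - x p                                   ≈⟨ +-cong (x≋ q) (-‿cong (x≋ p)) ⟩
            lincomb t ends q - lincomb t ends p         ≈⟨ lincomb-difference t ends q p ⟩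
            sum (λ k → t k * (ends k q - ends k p))
                ≈⟨ sum-zero (λ k → trans (*-congˡ (flat-ends k)) (zeroʳ (t k))) ⟩
            0#                                          ∎)
          backward : (λ x → x ∈ image (permutationMatrix (π ⟨$⟩ʳ_)) roof × (e q ⊝ e p) ∙ x ≈ 0#) ⊆ segment (ξ i₀)
              (⊖ ξ j₀)
          backward {x} (x∈ , tight) = from (proj₁ (roofImage≐Chamber π) x∈)
            where
            from : x ∈ Chamber π → x ∈ segment (ξ i₀) (⊖ ξ j₀)
            from (x∈H , gap , sorted) = t
                , (λ { zero → x≤y⇒0≤y-x (sorted z≤n) ; (suc zero) → x≤y⇒0≤y-x (sorted (≤fromℕ (suc zero))) })
                , trans (solve 3 (λ a b c → (a :- b) :+ ((b :- c) :+ con (+ 0)) := a :- c) (x i₀) (x p) (x j₀)) gap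
                , H-ext x (lincomb t ends) j₀ x∈H (H-lincomb t ends (λ k → proj₁ (ends∈ k))) same
              where
              t : Vector Carrier 2
              -- The weights are the two drops, from the top coordinate to the common middle value
              -- and from there to the bottom one.
              t = (x i₀ - x p) ∷ (x p - x j₀) ∷ []
              flat : ∀ {a} → a ≢ zero → a ≢ last → x (π ⟨$⟩ʳ a) ≈ x p
              flat a≢0 a≢l = antisym (sorted (0<a a≢0))
                  (≤-respˡ-≈ (x-y≈0⇒x≈y (trans (sym (root-∙ q p x)) tight)) (sorted (middle≤penultimate m a≢0 a≢l)))
              offset : ∀ k → lincomb t ends k - lincomb t ends j₀ ≈ (x i₀ - x p) * e i₀ k + (x p - x j₀) *
                  (1# - e j₀ k)
              offset k = begin
                lincomb t ends k - lincomb t ends j₀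
                    ≈⟨ lincomb-difference t ends k j₀ ⟩
                (x i₀ - x p) * (ξ i₀ k - ξ i₀ j₀) + ((x p - x j₀) * ((⊖ ξ j₀) k - (⊖ ξ j₀) j₀) + 0#)
                  ≈⟨ +-cong (*-congˡ (trans (ξ-difference i₀ k j₀)
                      (trans (+-congˡ (-‿cong (e-off (λ h → ends≢ π (≡.sym h)))))
                      (solve 1 (λ a → a :- con (+ 0) := a) (e i₀ k)))))
                            (trans (+-identityʳ _) (*-congˡ (trans (⊖ξ-difference j₀ k j₀)
                                (+-congʳ (e-diag {k = j₀} ≡.refl))))) ⟩
                (x i₀ - x p) * e i₀ k + (x p - x j₀) * (1# - e j₀ k)                          ∎
              by-position : ∀ a → x (π ⟨$⟩ʳ a) - x j₀ ≈ (x i₀ - x p) * e i₀ (π ⟨$⟩ʳ a) + (x p - x j₀) *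
                  (1# - e j₀ (π ⟨$⟩ʳ a))
              by-position a = cases (a ≟ᶠ zero) (a ≟ᶠ last)
                where
                distinct : ∀ {b} → a ≢ b → π ⟨$⟩ʳ a ≢ π ⟨$⟩ʳ b
                distinct a≢b h = a≢b (⟨$⟩ʳ-injective π h)
                y : Carrier
                y = x (π ⟨$⟩ʳ a)
                cases : Dec (a ≡ zero) → Dec (a ≡ last)
                    → y - x j₀ ≈ (x i₀ - x p) * e i₀ (π ⟨$⟩ʳ a) + (x p - x j₀) * (1# - e j₀ (π ⟨$⟩ʳ a))
                cases (yes ≡.refl) _ = sym (trans (+-cong (*-congˡ (e-diag {k = i₀} ≡.refl))
                    (*-congˡ (+-congˡ (-‿cong (e-off (ends≢ π))))))
                  (solve 3 (λ i p j → (i :- p) :* con (+ 1) :+ (p :- j) :* (con (+ 1) :- con (+ 0)) := i :- j) (x i₀)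
                      (x p) (x j₀)))
                cases (no a≢0) (yes ≡.refl) = sym (trans
                    (+-cong (*-congˡ (e-off (distinct a≢0))) (*-congˡ (+-congˡ (-‿cong (e-diag {k = j₀} ≡.refl)))))
                  (solve 3 (λ i p j → (i :- p) :* con (+ 0) :+ (p :- j) :* (con (+ 1) :- con (+ 1)) := j :- j) (x i₀)
                      (x p) (x j₀)))
                cases (no a≢0) (no a≢l) = trans (+-congʳ (flat a≢0 a≢l))
                    (sym (trans (+-cong (*-congˡ (e-off (distinct a≢0)))
                    (*-congˡ (+-congˡ (-‿cong (e-off (distinct a≢l))))))
                  (solve 3 (λ i p j → (i :- p) :* con (+ 0) :+ (p :- j) :* (con (+ 1) :- con (+ 0)) := p :- j) (x i₀)
                      (x p) (x j₀))))
              same : ∀ k → x k - x j₀ ≈ lincomb t ends k - lincomb t ends j₀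
              same k = ≡.subst (λ k → x k - x j₀ ≈ lincomb t ends k - lincomb t ends j₀) (inverseʳ π)
                (trans (by-position (π ⟨$⟩ˡ k)) (sym (offset (π ⟨$⟩ʳ (π ⟨$⟩ˡ k)))))

        Facet⊆Chamber : i ≢ j → ∀ x → x ∈ Facet i j → Σ[ π ∈ Permutation′ (suc n) ] π ⟨$⟩ʳ zero ≡ i × π ⟨$⟩ʳ last ≡ j
            × x ∈ Chamber π
        Facet⊆Chamber {i} {j} i≢j x (x∈H , gap , bounds) = π , first , final , x∈H
            , trans (+-cong (reflexive (≡.cong x first)) (-‿cong (reflexive (≡.cong x final)))) gap , sorted
          where
          -- Raising the top coordinate and lowering the bottom one makes them the strict extremes, so ties are sorted correctly.
          x′ : Point (suc n)
          x′ k = x k + (e i k - e j k)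
          π : Permutation′ (suc n)
          π = proj₁ (sort x′)
          x′-sorted : ∀ {a b} → a ≤ᶠ b → x′ (π ⟨$⟩ʳ b) ≤ x′ (π ⟨$⟩ʳ a)
          x′-sorted = proj₂ (sort x′)
          x′-top : x′ i ≈ x i + 1#
          x′-top = +-congˡ (trans (+-cong (e-diag {k = i} ≡.refl) (-‿cong (e-off i≢j)))
              (solve 0 (con (+ 1) :- con (+ 0) := con (+ 1))))
          x′-bottom : x′ j ≈ x j - 1#
          x′-bottom = +-congˡ (trans (+-cong (e-off (λ h → i≢j (≡.sym h))) (-‿cong (e-diag {k = j} ≡.refl)))
              (solve 0 (con (+ 0) :- con (+ 1) := :- con (+ 1))))
          first : π ⟨$⟩ʳ zero ≡ i
          -- If another index `k` came first, `x′ k` would be at least `x i + 1#`, although away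
          -- from `i` it is at most `x k`, hence at most `x i`.
          first = decidable-stable (π ⟨$⟩ʳ zero ≟ᶠ i) λ k≢i
              → 0<1 (0≤s⇒x≤y (+-nonNeg (+-nonNeg (x≤y⇒0≤y-x
              (≤-respˡ-≈ x′-top (≤-respˡ-≈ (reflexive (≡.cong x′ (inverseʳ π))) (x′-sorted {zero} {π ⟨$⟩ˡ i} z≤n))))
              (proj₁ (e-bounds j k))) (x≤y⇒0≤y-x (proj₂ (bounds k)))) (begin
                0# - 1#
                    ≈⟨ solve 3 (λ k i e → con (+ 0) :- con (+ 1) := ((k :+ (con (+ 0) :- e)) :- (i :+ con (+ 1))) :+ e
                    :+ (i :- k)) (x k) (x i) (e j k) ⟩
                ((x k + (0# - e j k)) - (x i + 1#)) + e j k + (x i - x k)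
                    ≈⟨ +-congʳ (+-congʳ (+-congʳ (+-congˡ (+-congʳ (e-off k≢i))))) ⟨
                (x′ k - (x i + 1#)) + e j k + (x i - x k)                                ∎))
            where
            k : Fin (suc n)
            k = π ⟨$⟩ʳ zero
          final : π ⟨$⟩ʳ last ≡ j
          final = decidable-stable (π ⟨$⟩ʳ last ≟ᶠ j) λ k≢j
              → 0<1 (0≤s⇒x≤y (+-nonNeg (+-nonNeg (x≤y⇒0≤y-x
              (≤-respʳ-≈ x′-bottom (≤-respʳ-≈ (reflexive (≡.cong x′ (inverseʳ π))) (x′-sorted (≤fromℕ (π ⟨$⟩ˡ j))))))
              (proj₁ (e-bounds i k))) (x≤y⇒0≤y-x (proj₁ (bounds k)))) (begin
                0# - 1#
                    ≈⟨ solve 3 (λ k j e → con (+ 0) :- con (+ 1) := ((j :- con (+ 1)) :- (k :+ (e :- con (+ 0)))) :+ e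
                    :+ (k :- j)) (x k) (x j) (e i k) ⟩
                ((x j - 1#) - (x k + (e i k - 0#))) + e i k + (x k - x j)
                    ≈⟨ +-congʳ (+-congʳ (+-congˡ (-‿cong (+-congˡ (+-congˡ (-‿cong (e-off k≢j))))))) ⟨
                ((x j - 1#) - x′ k) + e i k + (x k - x j)                                ∎))
            where
            k : Fin (suc n)
            k = π ⟨$⟩ʳ last
          away : ∀ {a} → a ≢ zero → a ≢ last → x′ (π ⟨$⟩ʳ a) ≈ x (π ⟨$⟩ʳ a)
          away {a} a≢0 a≢l = trans (+-congˡ (trans
              (+-cong (e-off {k = π ⟨$⟩ʳ a} (distinct first a≢0))
              (-‿cong (e-off {k = π ⟨$⟩ʳ a} (distinct final a≢l)))) (-‿inverseʳ 0#))) (+-identityʳ _)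
            where
            distinct : ∀ {b k} → π ⟨$⟩ʳ b ≡ k → a ≢ b → π ⟨$⟩ʳ a ≢ k
            distinct {b} ≡.refl a≢b h = a≢b (⟨$⟩ʳ-injective π h)
          sorted : ∀ {a b} → a ≤ᶠ b → x (π ⟨$⟩ʳ b) ≤ x (π ⟨$⟩ʳ a)
          sorted {a} {b} a≤b with a ≟ᶠ zero | b ≟ᶠ last
          ... | yes a≡0 | _ = ≤-respʳ-≈ (reflexive (≡.cong x (≡.sym (≡.trans (≡.cong (π ⟨$⟩ʳ_) a≡0) first))))
              (proj₂ (bounds (π ⟨$⟩ʳ b)))
          ... | no _ | yes b≡l = ≤-respˡ-≈ (reflexive (≡.cong x (≡.sym (≡.trans (≡.cong (π ⟨$⟩ʳ_) b≡l) final))))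
              (proj₁ (bounds (π ⟨$⟩ʳ a)))
          ... | no a≢0 | no b≢l = ≤-respˡ-≈ (away b≢0 b≢l) (≤-respʳ-≈ (away a≢0 a≢l) (x′-sorted a≤b))
            where
            b≢0 : b ≢ zero
            b≢0 ≡.refl = a≢0 (≤ᶠ-antisym a≤b z≤n)
            a≢l : a ≢ last
            a≢l ≡.refl = b≢l (≤ᶠ-antisym (≤fromℕ b) a≤b)

        -- A monotone bijection of positions fixes the first and the last one, so both chambers
        -- impose the unit gap on the same pair, and the ordering for `π` implies that for `π′`.
        Chamber-⊆ : ∀ (π π′ : Permutation′ (suc n)) → (∀ {a b} → a ≤ᶠ b → π ⟨$⟩ˡ (π′ ⟨$⟩ʳ a) ≤ᶠ π ⟨$⟩ˡ (π′ ⟨$⟩ʳ b))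
            → Chamber π ⊆ Chamber π′
        Chamber-⊆ π π′ monotone {y} (y∈H , gap , sorted) = y∈H
            , trans (+-cong (reflexive (≡.cong y first)) (-‿cong (reflexive (≡.cong y final)))) gap
            , λ {a} {b} a≤b → ≤-respˡ-≈ (at b) (≤-respʳ-≈ (at a) (sorted (monotone a≤b)))
          where
          at : ∀ a → y (π ⟨$⟩ʳ (π ⟨$⟩ˡ (π′ ⟨$⟩ʳ a))) ≈ y (π′ ⟨$⟩ʳ a)
          at a = reflexive (≡.cong y (inverseʳ π))
          preimage : ∀ a → π ⟨$⟩ˡ (π′ ⟨$⟩ʳ (π′ ⟨$⟩ˡ (π ⟨$⟩ʳ a))) ≡ a
          preimage a = ≡.trans (≡.cong (π ⟨$⟩ˡ_) (inverseʳ π′)) (inverseˡ π)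
          to-π : ∀ {a} → π ⟨$⟩ˡ (π′ ⟨$⟩ʳ a) ≡ a → π′ ⟨$⟩ʳ a ≡ π ⟨$⟩ʳ a
          to-π h = ≡.trans (≡.sym (inverseʳ π)) (≡.cong (π ⟨$⟩ʳ_) h)
          first : π′ ⟨$⟩ʳ zero ≡ π ⟨$⟩ʳ zero
          first = to-π (≤ᶠ-antisym (≡.subst (π ⟨$⟩ˡ (π′ ⟨$⟩ʳ zero) ≤ᶠ_) (preimage zero) (monotone z≤n)) z≤n)
          final : π′ ⟨$⟩ʳ last ≡ π ⟨$⟩ʳ last
          final = to-π (≤ᶠ-antisym (≤fromℕ _) (≡.subst (_≤ᶠ π ⟨$⟩ˡ (π′ ⟨$⟩ʳ last)) (preimage last)
              (monotone (≤fromℕ _))))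

        -- A point with strictly decreasing coordinates along `π` admits no other sorting order, so
        -- any chamber containing it imposes the same order.
        same-order : ∀ (π π′ : Permutation′ (suc n)) x → (∀ {a b} → a <ᶠ b → x (π ⟨$⟩ʳ b) < x (π ⟨$⟩ʳ a))
            → x ∈ Chamber π′ → Chamber π ≐ Chamber π′
        same-order π π′ x strict (_ , _ , sorted) = (λ {y} → Chamber-⊆ π π′ forward {y}) , λ {y}
            → Chamber-⊆ π′ π backward {y}
          where
          at : ∀ k → x (π ⟨$⟩ʳ (π ⟨$⟩ˡ k)) ≈ x k
          at k = reflexive (≡.cong x (inverseʳ π))
          forward : ∀ {a b} → a ≤ᶠ b → π ⟨$⟩ˡ (π′ ⟨$⟩ʳ a) ≤ᶠ π ⟨$⟩ˡ (π′ ⟨$⟩ʳ b)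
          forward {a} {b} a≤b with π ⟨$⟩ˡ (π′ ⟨$⟩ʳ a) ≤ᶠ? π ⟨$⟩ˡ (π′ ⟨$⟩ʳ b)
          ... | yes below = below
          ... | no ¬below = contradiction (≤-respˡ-≈ (sym (at _)) (≤-respʳ-≈ (sym (at _)) (sorted a≤b)))
              (strict (ℕ.≰⇒> ¬below))
          backward : ∀ {a b} → a ≤ᶠ b → π′ ⟨$⟩ˡ (π ⟨$⟩ʳ a) ≤ᶠ π′ ⟨$⟩ˡ (π ⟨$⟩ʳ b)
          backward {a} {b} a≤b with π′ ⟨$⟩ˡ (π ⟨$⟩ʳ a) ≤ᶠ? π′ ⟨$⟩ˡ (π ⟨$⟩ʳ b)
          ... | yes below = below
          -- The opposite order under `π′`, sent through `forward`, gives `b ≤ᶠ a`; so the positions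
          -- are equal and the claim is reflexivity.
          ... | no ¬below = ≡.subst (λ c → π′ ⟨$⟩ˡ (π ⟨$⟩ʳ a) ≤ᶠ π′ ⟨$⟩ˡ (π ⟨$⟩ʳ c)) (≤ᶠ-antisym a≤b b≤a) ≤ᶠ-refl
            where
            at′ : ∀ c → π ⟨$⟩ˡ (π′ ⟨$⟩ʳ (π′ ⟨$⟩ˡ (π ⟨$⟩ʳ c))) ≡ c
            at′ c = ≡.trans (≡.cong (π ⟨$⟩ˡ_) (inverseʳ π′)) (inverseˡ π)
            b≤a : b ≤ᶠ a
            b≤a = ≡.subst₂ _≤ᶠ_ (at′ b) (at′ a) (forward (ℕ.<⇒≤ (ℕ.≰⇒> ¬below)))

        -- A roof image with this edge contains `ξ i` and `⊖ ξ j`, whose unit gaps identify the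
        -- first and last index of `π`. For non-overlap, an interior point of a roof image is
        -- strictly sorted, and then a second image containing it must coincide with the first.
        faces-of-roofImages : i ≢ j → ξ+◇ i j ComposedOf roofImage {ξ i} {⊖ ξ j}
        faces-of-roofImages {i} {j} i≢j = record { union = into , onto ; nonOverlapping = λ r s r≉s x x∈r x∈s →
            separated r s r≉s x x∈s , separated s r (λ eq → r≉s (≐-sym eq)) x x∈r }
          where
          faces : RoofImageWithEdge (ξ i) (⊖ ξ j) → Region (suc n)
          faces = roofImage {ξ i} {⊖ ξ j}
          into : ξ+◇ i j ⊆ ⋃ (RoofImageWithEdge (ξ i) (⊖ ξ j)) faces
          into {x} x∈ = place (Facet⊆Chamber i≢j x (proj₁ (ξ+◇≐Facet i≢j) x∈))
            where
            place : Σ[ π ∈ Permutation′ (suc n) ] π ⟨$⟩ʳ zero ≡ i × π ⟨$⟩ʳ last ≡ j × x ∈ Chamber π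
                → x ∈ ⋃ (RoofImageWithEdge (ξ i) (⊖ ξ j)) faces
            place (π , ≡.refl , ≡.refl , x∈Chamber) = (π , roofImage-edge π) , proj₂ (roofImage≐Chamber π) x∈Chamber
          onto : ⋃ (RoofImageWithEdge (ξ i) (⊖ ξ j)) faces ⊆ ξ+◇ i j
          onto {x} ((π , _ , _ , _ , segment⊆ , _) , x∈) = proj₂ (ξ+◇≐Facet i≢j)
              (≡.subst₂ (λ a b → x ∈ Facet a b) top bottom (Chamber⊆Facet π x (proj₁ (roofImage≐Chamber π) x∈)))
            where
            ξ∈segment : ξ i ∈ segment (ξ i) (⊖ ξ j)
            ξ∈segment = (1# ∷ 0# ∷ []) , (λ { zero → 0≤1 ; (suc zero) → ≤-refl })
                , solve 0 (con (+ 1) :+ (con (+ 0) :+ con (+ 0)) := con (+ 1))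
              , λ k → solve 2 (λ a b → a := con (+ 1) :* a :+ (con (+ 0) :* b :+ con (+ 0))) (ξ i k) ((⊖ ξ j) k)
            ⊖ξ∈segment : ⊖ ξ j ∈ segment (ξ i) (⊖ ξ j)
            ⊖ξ∈segment = (0# ∷ 1# ∷ []) , (λ { zero → ≤-refl ; (suc zero) → 0≤1 })
                , solve 0 (con (+ 0) :+ (con (+ 1) :+ con (+ 0)) := con (+ 1))
              , λ k → solve 2 (λ a b → b := con (+ 0) :* a :+ (con (+ 1) :* b :+ con (+ 0))) (ξ i k) ((⊖ ξ j) k)
            top : π ⟨$⟩ʳ zero ≡ i
            top = unit-gap-ξ {i} {π ⟨$⟩ʳ zero} {π ⟨$⟩ʳ last}
                (proj₁ (proj₂ (proj₁ (roofImage≐Chamber π) (proj₁ (segment⊆ ξ∈segment)))))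
            bottom : π ⟨$⟩ʳ last ≡ j
            bottom = unit-gap-⊖ξ {j} {π ⟨$⟩ʳ zero} {π ⟨$⟩ʳ last}
                (proj₁ (proj₂ (proj₁ (roofImage≐Chamber π) (proj₁ (segment⊆ ⊖ξ∈segment)))))
          separated : ∀ (r s : RoofImageWithEdge (ξ i) (⊖ ξ j)) → ¬ (faces r ≐ faces s) → ∀ x → x ∈ faces s
              → x ∉ relativeInterior (faces r)
          separated (π , _) (π′ , _) r≉s x x∈s x∈int = r≉s (≐-trans (roofImage≐Chamber π) (≐-trans
              (same-order π π′ x strict (proj₁ (roofImage≐Chamber π′) x∈s)) (≐-sym (roofImage≐Chamber π′))))
            where
            chamber : ∀ {y} → y ∈ image (permutationMatrix (π ⟨$⟩ʳ_)) roof → y ∈ Chamber π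
            chamber = proj₁ (roofImage≐Chamber π)
            strict : ∀ {a b} → a <ᶠ b → x (π ⟨$⟩ʳ b) < x (π ⟨$⟩ʳ a)
            strict {a} {b} a<b xa≤xb with view a
            ... | ‵fromℕ      = ℕ.<⇒≱ a<b (≤fromℕ b)
            -- A tie at `x` would make `u` constant on the roof image. But the vertex `v (suc a′)`
            -- is 1 higher at position `a` than at any later position, so after permutation `u` is
            -- -1 there.
            ... | ‵inject₁ a′ = 0≉1 (x-y≈0⇒x≈y (begin
                0# - 1#
                    ≈⟨ +-cong (step-above a′ a<b) (-‿cong (step-at a′)) ⟨
                step a′ b - step a′ a                                    ≈⟨ v-difference a′ b a ⟨
                v (suc a′) b - v (suc a′) a                              ≈⟨ +-cong (back b) (-‿cong (back a)) ⟨
                y (π ⟨$⟩ʳ b) - y (π ⟨$⟩ʳ a)                              ≈⟨ root-∙ (π ⟨$⟩ʳ b) (π ⟨$⟩ʳ a) y ⟨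
                u ∙ y
                    ≈⟨ relativeInterior-tight u 0# bounded x∈int tight {y} y∈ ⟩
                0#                                                       ∎))
              where
              u y : Point (suc n)
              u = e (π ⟨$⟩ʳ b) ⊝ e (π ⟨$⟩ʳ a)
              y = v (suc a′) ∘ (π ⟨$⟩ˡ_)
              back : ∀ c → y (π ⟨$⟩ʳ c) ≈ v (suc a′) c
              back c = reflexive (≡.cong (v (suc a′)) (inverseˡ π))
              y∈ : y ∈ image (permutationMatrix (π ⟨$⟩ʳ_)) roof
              y∈ = v (suc a′) , Chamber⊆roof (v (suc a′)) (v∈Chamber a′)
                , ≋-sym (apply-permutation π {permutationMatrix (π ⟨$⟩ʳ_)} (λ r s → refl) (v (suc a′)))
              bounded : ∀ z → z ∈ image (permutationMatrix (π ⟨$⟩ʳ_)) roof → u ∙ z ≤ 0#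
              bounded z z∈ = ≤-respˡ-≈ (sym (root-∙ (π ⟨$⟩ʳ b) (π ⟨$⟩ʳ a) z))
                  (0≤s⇒x≤y (x≤y⇒0≤y-x (proj₂ (proj₂ (chamber {z} z∈)) (ℕ.<⇒≤ a<b)))
                (solve 2 (λ p q → con (+ 0) :- (p :- q) := q :- p) (z (π ⟨$⟩ʳ b)) (z (π ⟨$⟩ʳ a))))
              tight : u ∙ x ≈ 0#
              tight = antisym (bounded x (proj₁ x∈int))
                  (≤-respʳ-≈ (sym (root-∙ (π ⟨$⟩ʳ b) (π ⟨$⟩ʳ a) x)) (x≤y⇒0≤y-x xa≤xb))

lemma9 : ∀ {c ℓ₁ ℓ₂} (F : OrderedField c ℓ₁ ℓ₂) (n : ℕ) .{{_ : NonZero n}} →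
    let open Euclidean F
        open RootLattice F n
        last = fromℕ n
    in
      ( IsVertex (⊖ ξ last) VoronoiCell
      × (∀ (i : Fin n) → IsCell (ξ+◇ (inject₁ i) last)
                       × IsHyperRhombus (pred n) (ξ+◇ (inject₁ i) last)
                       × (⊖ ξ last) ∈ ξ+◇ (inject₁ i) last)
      × (∀ G → IsCell G → (⊖ ξ last) ∈ G → ∃[ i ] G ≐ ξ+◇ (inject₁ i) last)
      × ∂VoronoiCell ComposedOf
          (λ ((k , i) : Fin (suc n) × Fin n) → image (Γ (suc n) (toℕ k)) (ξ+◇ (inject₁ i) last))
      )
    × ( (∀ i j → i ≢ j → IsCell (ξ+◇ i j) × IsHyperRhombus (pred n) (ξ+◇ i j))
      × (∀ i j i′ j′ → i ≢ j → i′ ≢ j′ → Congruent (ξ+◇ i j) (ξ+◇ i′ j′))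
      × (∀ i j i′ j′ → i ≢ j → i′ ≢ j′ → ξ+◇ i j ≐ ξ+◇ i′ j′ → i ≡ i′ × j ≡ j′)
      × ∂VoronoiCell ComposedOf faceAt
      )
    × (∀ i j → i ≢ j →
        ξ+◇ i j ≐ image (shiftMatrix i j) (ξ+◇ zero last)
      × ( IsNearestNeighbour (e i ⊝ e j)
        × ξ+◇ i j ⊆ bisector (e i ⊝ e j)
        )
      × ξ+◇ i j ComposedOf roofImage {ξ i} {⊖ ξ j}
      )
lemma9 F n@(suc m) =
    -- As the dimension is at least 1, the index `zero` differs from the last one and names a facet
    -- through the vertex.
    ( ⊖ξ-isVertex {i = zero} (λ ())
    , (λ i → ξ+◇-isCell (≢last i) , ξ+◇-hyperRhombus (≢last i) , proj₂ (ξ+◇≐Facet (≢last i)) (⊖ξ∈Facet (≢last i)))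
    , (λ G cell v∈G → let (i , G≐) = cell-at-vertex G cell v∈G in i , ≐-trans G≐ (≐-sym (ξ+◇≐Facet (≢last i))))
    , rotated-faces-compose m
    )
  , ( (λ i j i≢j → ξ+◇-isCell i≢j , ξ+◇-hyperRhombus i≢j)
    , (λ i j i′ j′ i≢j i′≢j′ → Facets-congruent i≢j i′≢j′ (ξ+◇≐Facet i≢j) (ξ+◇≐Facet i′≢j′))
    , (λ i j i′ j′ i≢j i′≢j′ same → Facet-⊆-injective i j i′ j′ i≢j λ x∈ →
        proj₁ (proj₂ (proj₁ (ξ+◇≐Facet i′≢j′) (proj₁ same (proj₂ (ξ+◇≐Facet i≢j) x∈)))))
    , boundary-composed faceAt (λ ((i , j) , _) → i) (λ ((i , j) , _) → j) proj₂
        (λ (_ , i≢j) → ξ+◇≐Facet i≢j) (λ i j i≢j → ((i , j) , i≢j) , ≡.refl , ≡.refl)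
    )
  , λ i j i≢j → shiftMatrix-face m i≢j
      , (root-nearest i≢j , λ {x} x∈ → Facet⊆bisector i≢j {x} (proj₁ (ξ+◇≐Facet i≢j) x∈))
      , faces-of-roofImages m i≢j
  where
  open RootLattice F n using (faceAt)
  open Geometry F
  open Parallelepipeds
  open VoronoiFacets n
  open VoronoiBoundary n
  open VoronoiCells m
  open ShiftMatrices
  open Roofs
  ≢last : ∀ (i : Fin n) → inject₁ i ≢ fromℕ n
  ≢last i h = fromℕ≢inject₁ (≡.sym h)
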